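{- Let $K,L$ be étale $\mathbb Q$-algebras and let $R$ and $S$ be sieves for $K$ and $L$, respectively. Let $A:\mathcal O_K\to\mathcal O_L$ be a $\mathbb Z$-linear map; for each prime number $p$ denote also by $A$ the induced $\mathbb Z_p$-linear map $\mathcal O_{K,p}\to\mathcal O_{L,p}$. Assume that there are infinitely many prime numbers $p$ satisfying all of the following conditions: (a) $A(V_p(K,R))\subseteq V_p(L,S)$. (b) $A(\mathcal O_K)\cap S_{\mathfrak q}\ne\emptyset$ for all primes $\mathfrak q\mid p$ of $L$. (c) $\sum_{\mathfrak p\mid p\text{ prime of }K}\operatorname{meas}(R_{\mathfrak p})<1$. (d) $p$ splits completely in both $K$ and $L$. Then $A$ is the composition $M_\varepsilon\circ\tau$ of (the restriction to $\mathcal O_K$ of) a $\mathbb Q$-algebra homomorphism $\tau:K\to L$ and the multiplication map $M_\varepsilon:\mathcal O_L\to\mathcal O_L$, $x\mapsto\varepsilon x$, for some $\varepsilon\in\mathcal O_L$.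
   Context: An étale $\mathbb Q$-algebra is a cartesian product $K=K_1\times\cdots\times K_r$ ($r\ge1$) of finitely many number fields; its ring of integers is $\mathcal O_K=\prod_i\mathcal O_{K_i}$. A prime $\mathfrak p$ of $K$ is a maximal ideal of $\mathcal O_K$ (i.e. a nonzero prime ideal in one factor times the full ring in the other factors). $\mathcal O_{K,\mathfrak p}$ is the $\mathfrak p$-adic completion of $\mathcal O_K$, carrying the Haar measure $\operatorname{meas}$ normalized by $\operatorname{meas}(\mathcal O_{K,\mathfrak p})=1$. For a prime number $p$, $\mathcal O_{K,p}=\mathcal O_K\otimes_{\mathbb Z}\mathbb Z_p$, identified with $\prod_{\mathfrak p\mid p}\mathcal O_{K,\mathfrak p}$. Elements of $\mathcal O_K$ are viewed in $\mathcal O_{K,\mathfrak p}$ and $\mathcal O_{K,p}$ via the natural maps. A sieve for $K$ is a collection $R=(R_{\mathfrak p})_{\mathfrak p}$ of compact open subsets $R_{\mathfrak p}\subseteq\mathcal O_{K,\mathfrak p}$ (possibly empty or everything), one for each prime $\mathfrak p$ of $K$; and $V_p(K,R)=\prod_{\mathfrak p\mid p}(\mathcal O_{K,\mathfrak p}\setminus R_{\mathfrak p})\subseteq\mathcal O_{K,p}$. A prime number $p$ splits completely in $K$ if $K\otimes_{\mathbb Q}\mathbb Q_p\cong\mathbb Q_p^n$ as $\mathbb Q_p$-algebras, where $n=\dim_{\mathbb Q}K$. -}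

module Defs where

import Algebra.Definitions
import Algebra.Definitions.RawMonoid
import Algebra.Morphism.RingMonomorphism as RingMonomorphism
import Data.Integer.Properties as ℤ
import Data.Nat.Properties as ℕ
import Data.Rational.Properties as ℚ
open import Algebra using (CommutativeRing; RawRing)
open import Algebra.Morphism.Construct.Identity using (isRingHomomorphism)
open import Algebra.Morphism.Structures
  using (IsGroupHomomorphism; IsRingHomomorphism; IsRingMonomorphism; IsRingIsomorphism)
open import Algebra.Solver.Ring.AlmostCommutativeRing
  using (fromCommutativeRing; _-Raw-AlmostCommutative⟶_; Induced-equivalence)
open import Data.Empty using (⊥)
open import Data.Fin.Base using (Fin; zero; suc; toℕ; fromℕ<; punchIn; combine; remQuot)
open import Data.Fin.Properties
  using (toℕ<n; toℕ-fromℕ<; punchIn-injective; punchInᵢ≢i; remQuot-combine)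
open import Data.Integer.Base as ℤ using (ℤ; +_; -[1+_]; _⊖_)
open import Data.List.Base using (List; []; _∷_; _++_; map; foldr; cartesianProductWith)
open import Data.List.Relation.Unary.Any using (Any)
open import Data.Maybe.Base using (just; nothing)
open import Data.Nat.Base as ℕ using (ℕ; zero; suc; s≤s)
open import Data.Product using (Σ; Σ-syntax; ∃-syntax; _×_; _,_; proj₁; proj₂)
open import Data.Rational.Base as ℚ using (ℚ)
open import Data.Rational.Unnormalised.Base as ℚᵘ using (ℚᵘ; _≃_)
open import Data.Rational.Unnormalised.Properties using (drop-*≡*)
open import Data.Sum.Base using (inj₁; inj₂; [_,_]′)
open import Data.Unit.Base using (⊤; tt)
open import Data.Vec.Functional using (Vector)
open import Function.Base using (_∘_; id)
open import Level as Level using (0ℓ)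
open import Relation.Binary.Bundles using (Setoid)
open import Relation.Binary.Definitions using (WeaklyDecidable)
open import Relation.Binary.PropositionalEquality as ≡ using (_≡_; _≢_)
open import Relation.Binary.Structures using (IsEquivalence)
open import Relation.Nullary using (¬_; yes; no; contradiction)
open import Relation.Unary using (Pred; _⊆_; _≐_; _∪_)

Ring₀ : Set₁
Ring₀ = CommutativeRing 0ℓ 0ℓ

module Integers (R : Ring₀) where
  open CommutativeRing R hiding (zero)
  open import Algebra.Properties.Ring ring
  open import Algebra.Properties.AbelianGroup +-abelianGroup using (⁻¹-∙-comm)
  open import Algebra.Properties.Monoid.Mult +-monoid
    using (×-homo-+) renaming (_×_ to infixr 8 _·_)
  open import Relation.Binary.Reasoning.Setoid setoid

  fromℤ : ℤ → Carrier
  fromℤ (+ n)      = n · 1#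
  fromℤ (-[1+ n ]) = - (suc n · 1#)

  private
    cancel : ∀ x y z → x + y - (x + z) ≈ y - z
    cancel x y z = begin
      x + y - (x + z)       ≈⟨ +-congˡ (⁻¹-∙-comm x z) ⟨
      x + y + (- x - z)     ≈⟨ +-congʳ (+-comm x y) ⟩
      y + x + (- x - z)     ≈⟨ +-assoc y x _ ⟩
      y + (x + (- x - z))   ≈⟨ +-congˡ (+-assoc x _ _) ⟨
      y + ((x - x) - z)     ≈⟨ +-congˡ (+-congʳ (-‿inverseʳ x)) ⟩
      y + (0# - z)          ≈⟨ +-congˡ (+-identityˡ _) ⟩
      y - z                 ∎

    fromℤ-⊖ : ∀ m n → fromℤ (m ⊖ n) ≈ m · 1# - n · 1#
    fromℤ-⊖ m       zero    = sym (trans (+-congˡ -0#≈0#) (+-identityʳ _))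
    fromℤ-⊖ zero    (suc n) = sym (+-identityˡ _)
    fromℤ-⊖ (suc m) (suc n) = begin
      fromℤ (suc m ⊖ suc n)        ≡⟨ ≡.cong fromℤ (ℤ.[1+m]⊖[1+n]≡m⊖n m n) ⟩
      fromℤ (m ⊖ n)                ≈⟨ fromℤ-⊖ m n ⟩
      m · 1# - n · 1#              ≈⟨ cancel 1# _ _ ⟨
      suc m · 1# - suc n · 1#      ∎

  fromℤ-+ : ∀ i j → fromℤ (i ℤ.+ j) ≈ fromℤ i + fromℤ j
  fromℤ-+ (+ m)      (+ n)      = ×-homo-+ 1# m n
  fromℤ-+ (+ m)      (-[1+ n ]) = fromℤ-⊖ m (suc n)
  fromℤ-+ (-[1+ m ]) (+ n)      = trans (fromℤ-⊖ n (suc m)) (+-comm _ _)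
  fromℤ-+ (-[1+ m ]) (-[1+ n ]) = begin
    - (suc (suc (m ℕ.+ n)) · 1#)         ≡⟨ ≡.cong (λ k → - (k · 1#)) (≡.cong suc (ℕ.+-suc m n)) ⟨
    - ((suc m ℕ.+ suc n) · 1#)           ≈⟨ -‿cong (×-homo-+ 1# (suc m) (suc n)) ⟩
    - (suc m · 1# + suc n · 1#)          ≈⟨ ⁻¹-∙-comm _ _ ⟨
    - (suc m · 1#) - suc n · 1#          ∎

  fromℤ-neg : ∀ i → fromℤ (ℤ.- i) ≈ - fromℤ i
  fromℤ-neg (+ zero)   = sym -0#≈0#
  fromℤ-neg (+ suc n)  = refl
  fromℤ-neg (-[1+ n ]) = sym (-‿involutive _)

  private
    fromℤ-*⁺ : ∀ n j → fromℤ (+ n ℤ.* j) ≈ fromℤ (+ n) * fromℤ j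
    fromℤ-*⁺ zero    j = sym (zeroˡ _)
    fromℤ-*⁺ (suc n) j = begin
      fromℤ (+ suc n ℤ.* j)                ≡⟨ ≡.cong fromℤ (ℤ.suc-* (+ n) j) ⟩
      fromℤ (j ℤ.+ + n ℤ.* j)              ≈⟨ fromℤ-+ j (+ n ℤ.* j) ⟩
      fromℤ j + fromℤ (+ n ℤ.* j)          ≈⟨ +-cong (sym (*-identityˡ _)) (fromℤ-*⁺ n j) ⟩
      1# * fromℤ j + fromℤ (+ n) * fromℤ j ≈⟨ distribʳ _ _ _ ⟨
      fromℤ (+ suc n) * fromℤ j            ∎

  fromℤ-* : ∀ i j → fromℤ (i ℤ.* j) ≈ fromℤ i * fromℤ j
  fromℤ-* (+ n)      j = fromℤ-*⁺ n j
  fromℤ-* (-[1+ n ]) j = begin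
    fromℤ (-[1+ n ] ℤ.* j)               ≡⟨ ≡.cong fromℤ (ℤ.neg-distribˡ-* (+ suc n) j) ⟨
    fromℤ (ℤ.- (+ suc n ℤ.* j))          ≈⟨ fromℤ-neg (+ suc n ℤ.* j) ⟩
    - fromℤ (+ suc n ℤ.* j)              ≈⟨ -‿cong (fromℤ-*⁺ (suc n) j) ⟩
    - (fromℤ (+ suc n) * fromℤ j)        ≈⟨ -‿distribˡ-* _ _ ⟩
    fromℤ -[1+ n ] * fromℤ j             ∎

  -- Equality in R need not be decidable; taking ℤ as the coefficient ring still
  -- lets the solver cancel terms.
  private
    coefficients : CommutativeRing.rawRing ℤ.+-*-commutativeRing
                     -Raw-AlmostCommutative⟶ fromCommutativeRing R
    coefficients = record
      { ⟦_⟧    = fromℤ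
      ; +-homo = fromℤ-+
      ; *-homo = fromℤ-*
      ; -‿homo = fromℤ-neg
      ; 0-homo = refl
      ; 1-homo = +-identityʳ 1#
      }

    _≟_ : WeaklyDecidable (Induced-equivalence coefficients)
    i ≟ j with i ℤ.≟ j
    ... | yes ≡.refl = just refl
    ... | no  _      = nothing

  open import Algebra.Solver.Ring _ _ coefficients _≟_ public
    using (solve; _:=_; _:+_; _:*_; _:-_; :-_; con)

module _ (R : Ring₀) where
  open CommutativeRing R hiding (zero)
  open Integers R
  open import Algebra.Properties.Semiring.Exp semiring using (_^_)
  open import Algebra.Properties.Semiring.Sum semiring
    using (sum; sum-cong-≋; sum-remove)
  open import Relation.Binary.Reasoning.Setoid setoid

  Integral : Pred Carrier 0ℓ
  Integral x = Σ[ n ∈ ℕ ] Σ[ c ∈ Vector ℤ n ]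
    x ^ n + sum (λ i → fromℤ (c i) * x ^ toℕ i) ≈ 0#

  -- Integral elements form a subring: if x and y are integral then z = x + y
  -- and z = x * y act on the ℤ-span of the finitely many monomials xⁱ yʲ.
  -- Eliminating in the resulting linear system, whose coefficient matrix is
  -- monic in z on the diagonal, gives a monic equation for z.
  private
    fromℤ-1 : fromℤ (+ 1) ≈ 1#
    fromℤ-1 = +-identityʳ 1#

    sum-factor : ∀ {n} a (c : Vector ℤ n) (h : Vector Carrier n) →
      a * sum (λ i → fromℤ (c i) * h i) ≈ sum (λ i → fromℤ (c i) * (a * h i))
    sum-factor {zero}  a c h = zeroʳ a
    sum-factor {suc n} a c h = trans (distribˡ _ _ _) (+-cong
      (solve 3 (λ a c h → a :* (c :* h) := c :* (a :* h)) refl a (fromℤ (c zero)) (h zero))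
      (sum-factor a (c ∘ suc) (h ∘ suc)))

    sum-0 : ∀ {n} (h : Vector Carrier n) → sum (λ i → 0# * h i) ≈ 0#
    sum-0 {zero}  h = refl
    sum-0 {suc n} h = trans (+-cong (zeroˡ _) (sum-0 (h ∘ suc))) (+-identityˡ 0#)

    module Span {N : ℕ} (g : Vector Carrier N) where

      Spanned : Pred Carrier 0ℓ
      Spanned x = Σ[ c ∈ Vector ℤ N ] x ≈ sum (λ i → fromℤ (c i) * g i)

      spanned-resp : ∀ {x y} → x ≈ y → Spanned x → Spanned y
      spanned-resp x≈y (c , p) = c , trans (sym x≈y) p

      private
        sum-+ : ∀ {n} (c d : Vector ℤ n) (h : Vector Carrier n) →
          sum (λ i → fromℤ (c i) * h i) + sum (λ i → fromℤ (d i) * h i)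
            ≈ sum (λ i → fromℤ (c i ℤ.+ d i) * h i)
        sum-+ {zero}  c d h = +-identityˡ 0#
        sum-+ {suc n} c d h = begin
          (a * h₀ + s) + (b * h₀ + t)
            ≈⟨ solve 5 (λ a b h s t → (a :* h :+ s) :+ (b :* h :+ t) :=
                 (a :+ b) :* h :+ (s :+ t)) refl a b h₀ s t ⟩
          (a + b) * h₀ + (s + t)
            ≈⟨ +-cong (*-congʳ (sym (fromℤ-+ (c zero) (d zero))))
                      (sum-+ (c ∘ suc) (d ∘ suc) (h ∘ suc)) ⟩
          sum (λ i → fromℤ (c i ℤ.+ d i) * h i) ∎
          where
          a = fromℤ (c zero)
          b = fromℤ (d zero)
          h₀ = h zero
          s = sum (λ i → fromℤ (c (suc i)) * h (suc i))
          t = sum (λ i → fromℤ (d (suc i)) * h (suc i))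

        sum-scale : ∀ {n} k (c : Vector ℤ n) (h : Vector Carrier n) →
          fromℤ k * sum (λ i → fromℤ (c i) * h i)
            ≈ sum (λ i → fromℤ (k ℤ.* c i) * h i)
        sum-scale {zero}  k c h = zeroʳ _
        sum-scale {suc n} k c h = trans (distribˡ _ _ _)
          (+-cong (trans (sym (*-assoc _ _ _)) (*-congʳ (sym (fromℤ-* k (c zero)))))
                  (sum-scale k (c ∘ suc) (h ∘ suc)))

      spanned-+ : ∀ {x y} → Spanned x → Spanned y → Spanned (x + y)
      spanned-+ (c , p) (d , q) =
        (λ i → c i ℤ.+ d i) , trans (+-cong p q) (sum-+ c d g)

      spanned-scale : ∀ k {x} → Spanned x → Spanned (fromℤ k * x)
      spanned-scale k (c , p) =
        (λ i → k ℤ.* c i) , trans (*-congˡ p) (sum-scale k c g)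

      spanned-0 : Spanned 0#
      spanned-0 = (λ _ → + 0) , sym (sum-0 g)

      spanned-sum : ∀ {n} (h : Vector Carrier n) → (∀ i → Spanned (h i)) → Spanned (sum h)
      spanned-sum {zero}  h p = spanned-0
      spanned-sum {suc n} h p = spanned-+ (p zero) (spanned-sum (h ∘ suc) (p ∘ suc))

    δ : ∀ {n} → Fin n → Fin n → ℤ
    δ zero    zero    = + 1
    δ zero    (suc _) = + 0
    δ (suc _) zero    = + 0
    δ (suc i) (suc j) = δ i j

    δ-diag : ∀ {n} (i : Fin n) → δ i i ≡ + 1
    δ-diag zero    = ≡.refl
    δ-diag (suc i) = δ-diag i

    δ-off : ∀ {n} (i j : Fin n) → i ≢ j → δ i j ≡ + 0
    δ-off zero    zero    i≢j = contradiction ≡.refl i≢j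
    δ-off zero    (suc j) i≢j = ≡.refl
    δ-off (suc i) zero    i≢j = ≡.refl
    δ-off (suc i) (suc j) i≢j = δ-off i j (i≢j ∘ ≡.cong suc)

    sum-δ : ∀ {n} (i : Fin n) (h : Vector Carrier n) → sum (λ j → fromℤ (δ i j) * h j) ≈ h i
    sum-δ zero h = begin
      fromℤ (+ 1) * h zero + sum (λ j → 0# * h (suc j))
        ≈⟨ +-cong (trans (*-congʳ fromℤ-1) (*-identityˡ _)) (sum-0 (h ∘ suc)) ⟩
      h zero + 0#  ≈⟨ +-identityʳ _ ⟩
      h zero       ∎
    sum-δ (suc i) h = trans (+-cong (zeroˡ _) (sum-δ i (h ∘ suc))) (+-identityˡ _)

    module Elimination (z : Carrier) where

      -- Low d e: e is an integer polynomial in z of degree < d.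
      data Low : ℕ → Carrier → Set where
        low-nil  : ∀ {e} → e ≈ 0# → Low zero e
        low-cons : ∀ {d e l} c → Low d l → e ≈ fromℤ c + z * l → Low (suc d) e

      Monic : ℕ → Carrier → Set
      Monic d e = Σ[ l ∈ Carrier ] Low d l × e ≈ z ^ d + l

      low-resp : ∀ {d e f} → e ≈ f → Low d e → Low d f
      low-resp e≈f (low-nil p)      = low-nil (trans (sym e≈f) p)
      low-resp e≈f (low-cons c l p) = low-cons c l (trans (sym e≈f) p)

      low-0 : ∀ d → Low d 0#
      low-0 zero    = low-nil refl
      low-0 (suc d) = low-cons (+ 0) (low-0 d) (sym (trans (+-identityˡ _) (zeroʳ z)))

      low-+ : ∀ {d e f} → Low d e → Low d f → Low d (e + f)
      low-+ (low-nil p)      (low-nil q)      = low-nil (trans (+-cong p q) (+-identityˡ 0#))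
      low-+ (low-cons {l = l} c low p) (low-cons {l = m} k low′ q) =
        low-cons (c ℤ.+ k) (low-+ low low′) (begin
          _                                        ≈⟨ +-cong p q ⟩
          (fromℤ c + z * l) + (fromℤ k + z * m)    ≈⟨ solve 5 (λ c k z l m →
            (c :+ z :* l) :+ (k :+ z :* m) := (c :+ k) :+ z :* (l :+ m)) refl _ _ z l m ⟩
          (fromℤ c + fromℤ k) + z * (l + m)        ≈⟨ +-congʳ (fromℤ-+ c k) ⟨
          fromℤ (c ℤ.+ k) + z * (l + m)            ∎)

      low-scale : ∀ {d e} k → Low d e → Low d (fromℤ k * e)
      low-scale k (low-nil p) = low-nil (trans (*-congˡ p) (zeroʳ _))
      low-scale k (low-cons {l = l} c low p) =
        low-cons (k ℤ.* c) (low-scale k low) (begin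
          _                                    ≈⟨ *-congˡ p ⟩
          fromℤ k * (fromℤ c + z * l)          ≈⟨ solve 4 (λ k c z l →
            k :* (c :+ z :* l) := k :* c :+ z :* (k :* l)) refl _ _ z l ⟩
          fromℤ k * fromℤ c + z * (fromℤ k * l) ≈⟨ +-congʳ (fromℤ-* k c) ⟨
          fromℤ (k ℤ.* c) + z * (fromℤ k * l)  ∎)

      low-neg : ∀ {d e} → Low d e → Low d (- e)
      low-neg {e = e} low = low-resp
        (solve 1 (λ e → con (ℤ.- + 1) :* e := :- e) refl e) (low-scale (ℤ.- + 1) low)

      low-weaken : ∀ {d e} → Low d e → Low (suc d) e
      low-weaken (low-nil p)      = low-resp (sym p) (low-0 1)
      low-weaken (low-cons c l p) = low-cons c (low-weaken l) p

      low-weaken⁺ : ∀ k {d e} → Low d e → Low (k ℕ.+ d) e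
      low-weaken⁺ zero    l = l
      low-weaken⁺ (suc k) l = low-weaken (low-weaken⁺ k l)

      low-shift : ∀ {d e} → Low d e → Low (suc d) (z * e)
      low-shift l = low-cons (+ 0) l (sym (+-identityˡ _))

      low-shift⁺ : ∀ k {d e} → Low d e → Low (k ℕ.+ d) (z ^ k * e)
      low-shift⁺ zero    l = low-resp (sym (*-identityˡ _)) l
      low-shift⁺ (suc k) l = low-resp (sym (*-assoc _ _ _)) (low-shift (low-shift⁺ k l))

      low-* : ∀ {a b e f} → Low a e → Low b f → Low (a ℕ.+ b) (e * f)
      low-* {b = b} (low-nil p) m = low-resp (sym (trans (*-congʳ p) (zeroˡ _))) (low-0 b)
      low-* {a = suc a} {f = f} (low-cons {l = l} c low p) m = low-resp
        (begin
          fromℤ c * f + z * (l * f)  ≈⟨ solve 4 (λ c z l f →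
            c :* f :+ z :* (l :* f) := (c :+ z :* l) :* f) refl _ z l f ⟩
          (fromℤ c + z * l) * f      ≈⟨ *-congʳ p ⟨
          _                          ∎)
        (low-+ (low-weaken⁺ (suc a) (low-scale c m)) (low-shift (low-* low m)))

      monic*low : ∀ {d e f} → Monic d e → Low d f → Low (d ℕ.+ d) (e * f)
      monic*low {d} (l , low , p) m = low-resp
        (sym (trans (*-congʳ p) (distribʳ _ _ _))) (low-+ (low-shift⁺ d m) (low-* low m))

      private
        ^-+ : ∀ m n → z ^ m * z ^ n ≈ z ^ (m ℕ.+ n)
        ^-+ zero    n = *-identityˡ _
        ^-+ (suc m) n = trans (*-assoc _ _ _) (*-congˡ (^-+ m n))

      monic*monic-low : ∀ {d e f g} → Monic d e → Monic d f → Low (d ℕ.+ d) g →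
                        Monic (d ℕ.+ d) (e * f - g)
      monic*monic-low {d} {e} {f} {g} (l , low , p) (m , low′ , q) lowg =
        _ , low-+ (low-+ (low-+ (low-shift⁺ d low′) (low-shift⁺ d low)) (low-* low low′))
                  (low-neg lowg) ,
        (begin
          e * f - g                              ≈⟨ +-congʳ (*-cong p q) ⟩
          (z ^ d + l) * (z ^ d + m) - g          ≈⟨ solve 4 (λ y l m g →
            (y :+ l) :* (y :+ m) :- g :=
              y :* y :+ (((y :* m :+ y :* l) :+ l :* m) :+ (:- g))) refl (z ^ d) l m g ⟩
          z ^ d * z ^ d + (((z ^ d * m + z ^ d * l) + l * m) - g)
                                                 ≈⟨ +-congʳ (^-+ d d) ⟩
          z ^ (d ℕ.+ d) + (((z ^ d * m + z ^ d * l) + l * m) - g) ∎)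

      monic⇒integral : ∀ {d e} → Monic d e → e ≈ 0# → Integral z
      monic⇒integral {d} (l , low , p) e≈0 =
        d , proj₁ (coeffs low) , trans (+-congˡ (sym (proj₂ (coeffs low)))) (trans (sym p) e≈0)
        where
        coeffs : ∀ {d e} → Low d e →
          Σ[ c ∈ Vector ℤ d ] e ≈ sum (λ i → fromℤ (c i) * z ^ toℕ i)
        coeffs (low-nil p) = (λ ()) , p
        coeffs (low-cons c low p) with coeffs low
        ... | cs , q = (λ { zero → c ; (suc i) → cs i }) ,
          trans p (+-cong (sym (*-identityʳ _)) (trans (*-congˡ q) (sum-factor z cs (λ i → z ^ toℕ i))))

      private
        sum-lin : ∀ {n} a b (u v m : Vector Carrier n) →
          sum (λ j → (a * u j - b * v j) * m j)
            ≈ a * sum (λ j → u j * m j) - b * sum (λ j → v j * m j)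
        sum-lin {zero}  a b u v m =
          solve 2 (λ a b → con (+ 0) := a :* con (+ 0) :- b :* con (+ 0)) refl a b
        sum-lin {suc n} a b u v m = trans
          (+-congˡ (sum-lin a b (u ∘ suc) (v ∘ suc) (m ∘ suc)))
          (solve 7 (λ a b u v m s t →
            (a :* u :- b :* v) :* m :+ (a :* s :- b :* t) :=
              a :* (u :* m :+ s) :- b :* (v :* m :+ t)) refl a b (u zero) (v zero) (m zero) _ _)

      eliminate : ∀ n d (P : Fin (suc n) → Fin (suc n) → Carrier) (m : Vector Carrier (suc n)) →
        (∀ i → Monic d (P i i)) → (∀ i j → i ≢ j → Low d (P i j)) →
        (∀ i → sum (λ j → P i j * m j) ≈ 0#) →
        Σ[ D ∈ ℕ ] Σ[ e ∈ Carrier ] Monic D e × e * m zero ≈ 0#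
      eliminate zero    d P m mon low eq =
        d , P zero zero , mon zero , trans (sym (+-identityʳ _)) (eq zero)
      eliminate (suc n) d P m mon low eq =
        eliminate n (d ℕ.+ d) P′ (m ∘ π)
          (λ i → monic*monic-low (mon 1F) (mon (π i))
                   (low-* (low (π i) 1F (π≢ i)) (low 1F (π i) (π≢ i ∘ ≡.sym))))
          (λ i j i≢j → low-+ (monic*low (mon 1F) (low (π i) (π j) (i≢j ∘ punchIn-injective 1F i j)))
             (low-neg (low-* (low (π i) 1F (π≢ i)) (low 1F (π j) (π≢ j ∘ ≡.sym)))))
          eq′
        where
        1F : Fin (suc (suc n))
        1F = suc zero
        π : Fin (suc n) → Fin (suc (suc n))
        π = punchIn 1F
        π≢ : ∀ i → π i ≢ 1F
        π≢ i = punchInᵢ≢i 1F i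
        P′ : Fin (suc n) → Fin (suc n) → Carrier
        P′ i j = P 1F 1F * P (π i) (π j) - P (π i) 1F * P 1F (π j)
        rest : ∀ i → Carrier
        rest i = sum (λ j → P i (π j) * m (π j))
        split : ∀ i → P i 1F * m 1F + rest i ≈ 0#
        split i = trans (sym (sum-remove {i = 1F} (λ j → P i j * m j))) (eq i)
        eq′ : ∀ i → sum (λ j → P′ i j * m (π j)) ≈ 0#
        eq′ i = begin
          sum (λ j → P′ i j * m (π j))
            ≈⟨ sum-lin (P 1F 1F) (P (π i) 1F) (P (π i) ∘ π) (P 1F ∘ π) (m ∘ π) ⟩
          a * rest (π i) - b * rest 1F
            ≈⟨ solve 5 (λ a b x r s → a :* r :- b :* s :=
                 a :* (b :* x :+ r) :- b :* (a :* x :+ s)) refl a b (m 1F) _ _ ⟩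
          a * (b * m 1F + rest (π i)) - b * (a * m 1F + rest 1F)
            ≈⟨ +-cong (*-congˡ (split (π i))) (-‿cong (*-congˡ (split 1F))) ⟩
          a * 0# - b * 0#
            ≈⟨ solve 2 (λ a b → a :* con (+ 0) :- b :* con (+ 0) := con (+ 0)) refl a b ⟩
          0# ∎
          where
          a = P 1F 1F
          b = P (π i) 1F

      stable-span⇒integral : ∀ {N} (g : Vector Carrier (suc N)) → g zero ≈ 1# →
        (∀ i → Span.Spanned g (z * g i)) → Integral z
      stable-span⇒integral {N} g g₀≈1 stable = monic⇒integral (proj₁ (proj₂ (proj₂ result)))
        (trans (sym (*-identityʳ _)) (trans (*-congˡ (sym g₀≈1)) (proj₂ (proj₂ (proj₂ result)))))
        where
        C : Fin (suc N) → Fin (suc N) → ℤ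
        C i = proj₁ (stable i)
        P : Fin (suc N) → Fin (suc N) → Carrier
        P i j = z * fromℤ (δ i j) - fromℤ (+ 1) * fromℤ (C i j)
        entry : ∀ k c → z * fromℤ k - fromℤ (+ 1) * fromℤ c ≈ fromℤ (ℤ.- c) + z * fromℤ k
        entry k c = trans
          (solve 3 (λ z k c → z :* k :- con (+ 1) :* c := (:- c) :+ z :* k) refl z (fromℤ k) (fromℤ c))
          (+-congʳ (sym (fromℤ-neg c)))
        diag : ∀ i → Monic 1 (P i i)
        diag i = fromℤ (ℤ.- C i i) ,
          low-cons (ℤ.- C i i) (low-nil refl) (sym (trans (+-congˡ (zeroʳ z)) (+-identityʳ _))) ,
          trans (entry (δ i i) (C i i))
            (trans (+-comm _ _) (+-congʳ (*-congˡ (trans (reflexive (≡.cong fromℤ (δ-diag i))) fromℤ-1))))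
        off : ∀ i j → i ≢ j → Low 1 (P i j)
        off i j i≢j = low-cons (ℤ.- C i j) (low-nil refl)
          (trans (entry (δ i j) (C i j)) (+-congˡ (*-congˡ (reflexive (≡.cong fromℤ (δ-off i j i≢j))))))
        vanish : ∀ i → sum (λ j → P i j * g j) ≈ 0#
        vanish i = begin
          sum (λ j → P i j * g j)
            ≈⟨ sum-lin z (fromℤ (+ 1)) (λ j → fromℤ (δ i j)) (λ j → fromℤ (C i j)) g ⟩
          z * sum (λ j → fromℤ (δ i j) * g j) - fromℤ (+ 1) * sum (λ j → fromℤ (C i j) * g j)
            ≈⟨ +-cong (*-congˡ (sum-δ i g)) (-‿cong (*-congˡ (sym (proj₂ (stable i))))) ⟩
          z * g i - fromℤ (+ 1) * (z * g i)
            ≈⟨ solve 1 (λ x → x :- con (+ 1) :* x := con (+ 0)) refl (z * g i) ⟩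
          0# ∎
        result = eliminate N 1 P g diag off vanish

    module Monomials (x y : Carrier) (x-int : Integral x) (y-int : Integral y) where

      m n : ℕ
      m = proj₁ x-int
      n = proj₁ y-int

      g : Vector Carrier (suc m ℕ.* suc n)
      g k = let i , j = remQuot {suc m} (suc n) k in x ^ toℕ i * y ^ toℕ j

      open Span g public

      g₀≈1 : g zero ≈ 1#
      g₀≈1 = *-identityˡ 1#

      generator : ∀ (i : Fin (suc m)) (j : Fin (suc n)) → Spanned (x ^ toℕ i * y ^ toℕ j)
      generator i j = δ k , sym (trans (sum-δ k g) (reflexive
        (≡.cong (λ (i , j) → x ^ toℕ i * y ^ toℕ j) (remQuot-combine i j))))
        where k = combine i j

      monomial : ∀ i j → i ℕ.≤ m → j ℕ.≤ n → Spanned (x ^ i * y ^ j)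
      monomial i j i≤m j≤n = ≡.subst₂ (λ i j → Spanned (x ^ i * y ^ j))
        (toℕ-fromℕ< (s≤s i≤m)) (toℕ-fromℕ< (s≤s j≤n))
        (generator (fromℕ< (s≤s i≤m)) (fromℕ< (s≤s j≤n)))

      -- The monic equation of w, multiplied by w * u.
      reduce : ∀ w u ((d , c , _) : Integral w) →
        w ^ suc d * u ≈ sum (λ i → fromℤ (ℤ.- c i) * (w ^ suc (toℕ i) * u))
      reduce w u (d , c , p) = begin
        (w * w ^ d) * u
          ≈⟨ solve 4 (λ w v u s → (w :* v) :* u := (w :* u) :* (v :+ s) :- (w :* u) :* s)
               refl w (w ^ d) u S ⟩
        (w * u) * (w ^ d + S) - (w * u) * S   ≈⟨ +-congʳ (trans (*-congˡ p) (zeroʳ _)) ⟩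
        0# - (w * u) * S                      ≈⟨ +-identityˡ _ ⟩
        - ((w * u) * S)                       ≈⟨ go c ⟩
        sum (λ i → fromℤ (ℤ.- c i) * (w ^ suc (toℕ i) * u)) ∎
        where
        S = sum (λ i → fromℤ (c i) * w ^ toℕ i)
        go′ : ∀ {k} (c : Vector ℤ k) (h : Vector Carrier k) →
          - ((w * u) * sum (λ i → fromℤ (c i) * h i))
            ≈ sum (λ i → fromℤ (ℤ.- c i) * ((w * h i) * u))
        go′ {zero}  c h = solve 1 (λ a → :- (a :* con (+ 0)) := con (+ 0)) refl (w * u)
        go′ {suc k} c h = trans
          (solve 5 (λ w u c h s → :- ((w :* u) :* (c :* h :+ s)) :=
             (:- c) :* ((w :* h) :* u) :+ (:- ((w :* u) :* s))) refl w u _ (h zero) _)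
          (+-cong (*-congʳ (sym (fromℤ-neg (c zero)))) (go′ (c ∘ suc) (h ∘ suc)))
        go : ∀ {k} (c : Vector ℤ k) → - ((w * u) * sum (λ i → fromℤ (c i) * w ^ toℕ i))
            ≈ sum (λ i → fromℤ (ℤ.- c i) * (w ^ suc (toℕ i) * u))
        go c = go′ c (λ i → w ^ toℕ i)

      x-monomial : ∀ i j → i ℕ.≤ m → j ℕ.≤ n → Spanned (x ^ suc i * y ^ j)
      x-monomial i j i≤m j≤n with ℕ.m≤n⇒m<n∨m≡n i≤m
      ... | inj₁ i<m    = monomial (suc i) j i<m j≤n
      ... | inj₂ ≡.refl = spanned-resp (sym (reduce x (y ^ j) x-int))
        (spanned-sum _ (λ k → spanned-scale (ℤ.- proj₁ (proj₂ x-int) k) (monomial (suc (toℕ k)) j (toℕ<n k) j≤n)))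

      y-monomial : ∀ i j → i ℕ.≤ m → j ℕ.≤ n → Spanned (x ^ i * y ^ suc j)
      y-monomial i j i≤m j≤n with ℕ.m≤n⇒m<n∨m≡n j≤n
      ... | inj₁ j<n    = monomial i (suc j) i≤m j<n
      ... | inj₂ ≡.refl = spanned-resp (sym (trans (*-comm (x ^ i) (y ^ suc j)) (reduce y (x ^ i) y-int)))
        (spanned-sum _ (λ k → spanned-scale (ℤ.- proj₁ (proj₂ y-int) k)
          (spanned-resp (*-comm (x ^ i) (y ^ suc (toℕ k))) (monomial i (suc (toℕ k)) i≤m (toℕ<n k)))))

      x-stable : ∀ i → Spanned (x * g i)
      x-stable k = let i , j = remQuot {suc m} (suc n) k in
        spanned-resp (*-assoc x (x ^ toℕ i) (y ^ toℕ j))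
          (x-monomial (toℕ i) (toℕ j) (ℕ.s≤s⁻¹ (toℕ<n i)) (ℕ.s≤s⁻¹ (toℕ<n j)))

      y-stable : ∀ i → Spanned (y * g i)
      y-stable k = let i , j = remQuot {suc m} (suc n) k in
        spanned-resp (solve 3 (λ a y b → a :* (y :* b) := y :* (a :* b)) refl
                        (x ^ toℕ i) y (y ^ toℕ j))
          (y-monomial (toℕ i) (toℕ j) (ℕ.s≤s⁻¹ (toℕ<n i)) (ℕ.s≤s⁻¹ (toℕ<n j)))

      x-spanned : ∀ {w} → Spanned w → Spanned (x * w)
      x-spanned (c , p) = spanned-resp (sym (trans (*-congˡ p) (sum-factor x c g)))
        (spanned-sum _ (λ i → spanned-scale (c i) (x-stable i)))

  abstract
    integral-fromℤ : ∀ c → Integral (fromℤ c)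
    integral-fromℤ c = 1 , (λ _ → ℤ.- c) ,
      trans (+-congˡ (+-congʳ (*-congʳ (fromℤ-neg c))))
        (solve 2 (λ c o → c :* o :+ ((:- c) :* o :+ con (+ 0)) := con (+ 0)) refl (fromℤ c) 1#)

    integral-resp : ∀ {x y} → x ≈ y → Integral x → Integral y
    integral-resp x≈y (n , c , p) = n , c ,
      trans (sym (+-cong (^-congˡ n x≈y) (sum-cong-≋ {n} {term _} {term _}
        (λ i → *-congˡ (^-congˡ (toℕ i) x≈y))))) p
      where
      term : Carrier → Vector Carrier n
      term w i = fromℤ (c i) * w ^ toℕ i
      open import Algebra.Properties.Semiring.Exp semiring using (^-congˡ)

    integral-+ : ∀ {x y} → Integral x → Integral y → Integral (x + y)
    integral-+ {x} {y} p q = Elimination.stable-span⇒integral (x + y) g g₀≈1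
      (λ i → spanned-resp (sym (distribʳ _ _ _)) (spanned-+ (x-stable i) (y-stable i)))
      where open Monomials x y p q

    integral-* : ∀ {x y} → Integral x → Integral y → Integral (x * y)
    integral-* {x} {y} p q = Elimination.stable-span⇒integral (x * y) g g₀≈1
      (λ i → spanned-resp (sym (*-assoc _ _ _)) (x-spanned (y-stable i)))
      where open Monomials x y p q

    integral-neg : ∀ {x} → Integral x → Integral (- x)
    integral-neg {x} p = integral-resp
      (solve 1 (λ x → con (ℤ.- + 1) :* x := :- x) refl x)
      (integral-* (integral-fromℤ (ℤ.- + 1)) p)

private
  module _ (R : RawRing 0ℓ 0ℓ) where
    open RawRing R
    open Algebra.Definitions _≈_

    makeRing :
      IsEquivalence _≈_ → Congruent₂ _+_ → Congruent₂ _*_ → Congruent₁ -_ →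
      Associative _+_ → Commutative _+_ → LeftIdentity 0# _+_ → LeftInverse 0# -_ _+_ →
      Associative _*_ → Commutative _*_ → LeftIdentity 1# _*_ → _*_ DistributesOverˡ _+_ →
      Ring₀
    makeRing isEq +-cong *-cong neg-cong +-assoc +-comm +-idˡ +-invˡ *-assoc *-comm *-idˡ distribˡ =
      record { isCommutativeRing = record
        { isRing = record
          { +-isAbelianGroup = record
            { isGroup = record
              { isMonoid = record
                { isSemigroup = record
                  { isMagma = record { isEquivalence = isEq ; ∙-cong = +-cong }
                  ; assoc = +-assoc }
                ; identity = comm∧idˡ⇒id +-comm +-idˡ }
              ; inverse = comm∧invˡ⇒inv +-comm +-invˡ
              ; ⁻¹-cong = neg-cong }
            ; comm = +-comm }
          ; *-cong = *-cong
          ; *-assoc = *-assoc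
          ; *-identity = comm∧idˡ⇒id *-comm *-idˡ
          ; distrib = comm∧distrˡ⇒distr +-cong *-comm distribˡ }
        ; *-comm = *-comm } }
      where
      S : Setoid 0ℓ 0ℓ
      S = record { isEquivalence = isEq }
      open import Algebra.Consequences.Setoid S
        using (comm∧idˡ⇒id; comm∧invˡ⇒inv; comm∧distrˡ⇒distr)

  module _ (R S : RawRing 0ℓ 0ℓ) where
    private
      module R = RawRing R
      module S = RawRing S

    makeHomo : (f : R.Carrier → S.Carrier) →
      (∀ {x y} → x R.≈ y → f x S.≈ f y) →
      (∀ x y → f (x R.+ y) S.≈ f x S.+ f y) → (∀ x y → f (x R.* y) S.≈ f x S.* f y) →
      (∀ x → f (R.- x) S.≈ S.- f x) → f R.0# S.≈ S.0# → f R.1# S.≈ S.1# →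
      IsRingHomomorphism R S f
    makeHomo f cong +-homo *-homo neg-homo 0-homo 1-homo = record
      { isSemiringHomomorphism = record
        { isNearSemiringHomomorphism = record
          { +-isMonoidHomomorphism = record
            { isMagmaHomomorphism = record
              { isRelHomomorphism = record { cong = cong }
              ; homo = +-homo }
            ; ε-homo = 0-homo }
          ; *-homo = *-homo }
        ; 1#-homo = 1-homo }
      ; -‿homo = neg-homo }

Π : {I : Set} → (I → Ring₀) → Ring₀
Π {I} R = makeRing raw
  (record { refl = λ i → R.refl i ; sym = λ p i → R.sym i (p i) ; trans = λ p q i → R.trans i (p i) (q i) })
  (λ p q i → R.+-cong i (p i) (q i)) (λ p q i → R.*-cong i (p i) (q i)) (λ p i → R.-‿cong i (p i))
  (λ x y z i → R.+-assoc i _ _ _) (λ x y i → R.+-comm i _ _) (λ x i → R.+-identityˡ i _)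
  (λ x i → R.-‿inverseˡ i _) (λ x y z i → R.*-assoc i _ _ _) (λ x y i → R.*-comm i _ _)
  (λ x i → R.*-identityˡ i _) (λ x y z i → R.distribˡ i _ _ _)
  where
  module R (i : I) = CommutativeRing (R i)
  raw : RawRing 0ℓ 0ℓ
  raw = record
    { Carrier = ∀ i → R.Carrier i
    ; _≈_ = λ x y → ∀ i → R._≈_ i (x i) (y i)
    ; _+_ = λ x y i → R._+_ i (x i) (y i)
    ; _*_ = λ x y i → R._*_ i (x i) (y i)
    ; -_  = λ x i → R.-_ i (x i)
    ; 0#  = λ i → R.0# i
    ; 1#  = λ i → R.1# i
    }

integralClosure : Ring₀ → Ring₀
integralClosure R = record
  { isCommutativeRing = RingMonomorphism.isCommutativeRing
      {R₁ = raw} {R₂ = rawRing} {proj₁} mono isCommutativeRing }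
  where
  open CommutativeRing R
  open Integers R
  raw : RawRing 0ℓ 0ℓ
  raw = record
    { Carrier = Σ Carrier (Integral R)
    ; _≈_ = λ x y → proj₁ x ≈ proj₁ y
    ; _+_ = λ (x , p) (y , q) → x + y , integral-+ R p q
    ; _*_ = λ (x , p) (y , q) → x * y , integral-* R p q
    ; -_  = λ (x , p) → - x , integral-neg R p
    ; 0#  = 0# , integral-fromℤ R (+ 0)
    ; 1#  = 1# , integral-resp R (+-identityʳ 1#) (integral-fromℤ R (+ 1))
    }
  mono : IsRingMonomorphism raw rawRing proj₁
  mono = record
    { isRingHomomorphism = makeHomo raw rawRing proj₁ id
        (λ _ _ → refl) (λ _ _ → refl) (λ _ → refl) refl refl
    ; injective = id }

record _-Algebra (R : Ring₀) : Set₁ where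
  field
    ring : Ring₀
  open CommutativeRing ring public using (Carrier; rawRing)
  field
    ι      : CommutativeRing.Carrier R → Carrier
    ι-homo : IsRingHomomorphism (CommutativeRing.rawRing R) rawRing ι

ℤ-ring ℚ-ring : Ring₀
ℤ-ring = ℤ.+-*-commutativeRing
ℚ-ring = ℚ.+-*-commutativeRing

ℤ-algebra : Ring₀ → ℤ-ring -Algebra
ℤ-algebra R = record
  { ring = R
  ; ι = fromℤ
  ; ι-homo = makeHomo (CommutativeRing.rawRing ℤ-ring) rawRing fromℤ
      (λ { ≡.refl → refl }) fromℤ-+ fromℤ-* fromℤ-neg refl (+-identityʳ 1#)
  }
  where
  open CommutativeRing R
  open Integers R

-- A ⊗_R B: formal sums of pure tensors modulo the smallest congruence that makes
-- ⊗ additive in both arguments and R-balanced.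
module Tensor {R : Ring₀} (A B : R -Algebra) where
  private
    module R = CommutativeRing R
    module A where
      open _-Algebra A public using (ι)
      open CommutativeRing (_-Algebra.ring A) public
    module B where
      open _-Algebra B public using (ι)
      open CommutativeRing (_-Algebra.ring B) public

  FormalSum : Set
  FormalSum = List (A.Carrier × B.Carrier)

  pattern pure a b = (a , b) ∷ []

  infix 4 _≈_
  data _≈_ : FormalSum → FormalSum → Set where
    refl     : ∀ {s} → s ≈ s
    sym      : ∀ {s t} → s ≈ t → t ≈ s
    trans    : ∀ {s t u} → s ≈ t → t ≈ u → s ≈ u
    ++-cong  : ∀ {s s′ t t′} → s ≈ s′ → t ≈ t′ → s ++ t ≈ s′ ++ t′
    ++-comm  : ∀ s t → s ++ t ≈ t ++ s
    ⊗-cong   : ∀ {a a′ b b′} → a A.≈ a′ → b B.≈ b′ → pure a b ≈ pure a′ b′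
    distribˡ : ∀ a b b′ → pure a (b B.+ b′) ≈ pure a b ++ pure a b′
    distribʳ : ∀ a a′ b → pure (a A.+ a′) b ≈ pure a b ++ pure a′ b
    zeroˡ    : ∀ b → pure A.0# b ≈ []
    zeroʳ    : ∀ a → pure a B.0# ≈ []
    balanced : ∀ r a b → pure (A.ι r A.* a) b ≈ pure a (B.ι r B.* b)

  rawRing : RawRing 0ℓ 0ℓ
  rawRing = record
    { Carrier = FormalSum
    ; _≈_ = _≈_
    ; _+_ = _++_
    ; _*_ = cartesianProductWith (λ (a , b) (a′ , b′) → a A.* a′ , b B.* b′)
    ; -_  = map (λ (a , b) → A.- a , b)
    ; 0#  = []
    ; 1#  = pure A.1# B.1#
    }

  -- A ⊗_R B is a B-algebra through b ↦ 1 ⊗ b.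
  ιʳ : B.Carrier → FormalSum
  ιʳ b = pure A.1# b

record Ideal (R : Ring₀) : Set₁ where
  open CommutativeRing R
  field
    member : Pred Carrier 0ℓ
    resp   : ∀ {x y} → x ≈ y → member x → member y
    0∈     : member 0#
    +∈     : ∀ {x y} → member x → member y → member (x + y)
    *∈     : ∀ r {x} → member x → member (r * x)

open Ideal using (member)

module _ {R : Ring₀} where
  open CommutativeRing R hiding (zero)
  open Integers R

  principal : Carrier → Ideal R
  principal a = record
    { member = λ x → ∃[ r ] x ≈ r * a
    ; resp   = λ x≈y (r , p) → r , trans (sym x≈y) p
    ; 0∈     = 0# , sym (zeroˡ a)
    ; +∈     = λ (r , p) (s , q) → r + s , trans (+-cong p q) (sym (distribʳ a r s))
    ; *∈     = λ t (r , p) → t * r , trans (*-congˡ p) (sym (*-assoc t r a))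
    }

  data ProductMember (I J : Ideal R) : Pred Carrier 0ℓ where
    nil  : ∀ {x} → x ≈ 0# → ProductMember I J x
    cons : ∀ {a b s x} → member I a → member J b → ProductMember I J s →
           x ≈ a * b + s → ProductMember I J x

  _·_ : Ideal R → Ideal R → Ideal R
  I · J = record
    { member = ProductMember I J
    ; resp   = pm-resp
    ; 0∈     = nil refl
    ; +∈     = pm-+
    ; *∈     = pm-*
    }
    where
    pm-resp : ∀ {x y} → x ≈ y → ProductMember I J x → ProductMember I J y
    pm-resp x≈y (nil p)        = nil (trans (sym x≈y) p)
    pm-resp x≈y (cons a b s p) = cons a b s (trans (sym x≈y) p)
    pm-+ : ∀ {x y} → ProductMember I J x → ProductMember I J y → ProductMember I J (x + y)
    pm-+ (nil p)        t = pm-resp (sym (trans (+-congʳ p) (+-identityˡ _))) t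
    pm-+ (cons a b s p) t = cons a b (pm-+ s t) (trans (+-congʳ p) (+-assoc _ _ _))
    pm-* : ∀ r {x} → ProductMember I J x → ProductMember I J (r * x)
    pm-* r (nil p)        = nil (trans (*-congˡ p) (zeroʳ r))
    pm-* r (cons a b s p) = cons (Ideal.*∈ I r a) b (pm-* r s) (trans (*-congˡ p)
      (trans (distribˡ r _ _) (+-congʳ (sym (*-assoc r _ _)))))

  infixr 8 _^ᴵ_
  _^ᴵ_ : Ideal R → ℕ → Ideal R
  I ^ᴵ zero  = record
    { member = λ _ → ⊤
    ; resp   = λ _ _ → tt
    ; 0∈     = tt
    ; +∈     = λ _ _ → tt
    ; *∈     = λ _ _ → tt
    }
  I ^ᴵ suc n = I · (I ^ᴵ n)

  _≡_mod_ : Carrier → Carrier → Ideal R → Set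
  x ≡ y mod I = member I (x - y)

  module _ (I : Ideal R) where
    open Ideal I

    mod-reflexive : ∀ {x y} → x ≈ y → x ≡ y mod I
    mod-reflexive {x} {y} x≈y =
      resp (sym (trans (+-congʳ x≈y) (-‿inverseʳ y))) 0∈

    mod-sym : ∀ {x y} → x ≡ y mod I → y ≡ x mod I
    mod-sym {x} {y} p = resp
      (solve 2 (λ x y → con (ℤ.- + 1) :* (x :- y) := y :- x) refl x y)
      (*∈ (fromℤ (ℤ.- + 1)) p)

    mod-trans : ∀ {x y z} → x ≡ y mod I → y ≡ z mod I → x ≡ z mod I
    mod-trans {x} {y} {z} p q = resp
      (solve 3 (λ x y z → (x :- y) :+ (y :- z) := x :- z) refl x y z) (+∈ p q)

    mod-+ : ∀ {x x′ y y′} → x ≡ x′ mod I → y ≡ y′ mod I → (x + y) ≡ (x′ + y′) mod I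
    mod-+ {x} {x′} {y} {y′} p q = resp
      (solve 4 (λ x x′ y y′ → (x :- x′) :+ (y :- y′) := (x :+ y) :- (x′ :+ y′)) refl x x′ y y′)
      (+∈ p q)

    mod-* : ∀ {x x′ y y′} → x ≡ x′ mod I → y ≡ y′ mod I → (x * y) ≡ (x′ * y′) mod I
    mod-* {x} {x′} {y} {y′} p q = resp
      (solve 4 (λ x x′ y y′ → y :* (x :- x′) :+ x′ :* (y :- y′) := x :* y :- x′ :* y′)
        refl x x′ y y′)
      (+∈ (*∈ y p) (*∈ x′ q))

    mod-neg : ∀ {x x′} → x ≡ x′ mod I → (- x) ≡ (- x′) mod I
    mod-neg {x} {x′} p = resp
      (solve 2 (λ x x′ → con (ℤ.- + 1) :* (x :- x′) := (:- x) :- (:- x′)) refl x x′)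
      (*∈ (fromℤ (ℤ.- + 1)) p)

-- The inverse limit lim R/Iⁿ; residue n represents the image in R/Iⁿ.
record Adic {R : Ring₀} (I : Ideal R) : Set where
  open CommutativeRing R
  field
    residue  : ℕ → Carrier
    coherent : ∀ n → residue (suc n) ≡ residue n mod (I ^ᴵ n)

open Adic using (residue)

completion : {R : Ring₀} → Ideal R → Ring₀
completion {R} I = makeRing raw
  (record { refl = λ n → mod-reflexive (I ^ᴵ n) refl
          ; sym = λ p n → mod-sym (I ^ᴵ n) (p n)
          ; trans = λ p q n → mod-trans (I ^ᴵ n) (p n) (q n) })
  (λ p q n → mod-+ (I ^ᴵ n) (p n) (q n)) (λ p q n → mod-* (I ^ᴵ n) (p n) (q n))
  (λ p n → mod-neg (I ^ᴵ n) (p n))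
  (λ x y z n → mod-reflexive (I ^ᴵ n) (+-assoc _ _ _))
  (λ x y n → mod-reflexive (I ^ᴵ n) (+-comm _ _))
  (λ x n → mod-reflexive (I ^ᴵ n) (+-identityˡ _))
  (λ x n → mod-reflexive (I ^ᴵ n) (-‿inverseˡ _))
  (λ x y z n → mod-reflexive (I ^ᴵ n) (*-assoc _ _ _))
  (λ x y n → mod-reflexive (I ^ᴵ n) (*-comm _ _))
  (λ x n → mod-reflexive (I ^ᴵ n) (*-identityˡ _))
  (λ x y z n → mod-reflexive (I ^ᴵ n) (distribˡ _ _ _))
  where
  open CommutativeRing R
  open Adic using (coherent)
  raw : RawRing 0ℓ 0ℓ
  raw = record
    { Carrier = Adic I
    ; _≈_ = λ x y → ∀ n → residue x n ≡ residue y n mod (I ^ᴵ n)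
    ; _+_ = λ x y → record
      { residue  = λ n → residue x n + residue y n
      ; coherent = λ n → mod-+ (I ^ᴵ n) (coherent x n) (coherent y n) }
    ; _*_ = λ x y → record
      { residue  = λ n → residue x n * residue y n
      ; coherent = λ n → mod-* (I ^ᴵ n) (coherent x n) (coherent y n) }
    ; -_ = λ x → record
      { residue  = λ n → - residue x n
      ; coherent = λ n → mod-neg (I ^ᴵ n) (coherent x n) }
    ; 0# = record { residue = λ _ → 0# ; coherent = λ n → mod-reflexive (I ^ᴵ n) refl }
    ; 1# = record { residue = λ _ → 1# ; coherent = λ n → mod-reflexive (I ^ᴵ n) refl }
    }

toCompletion : {R : Ring₀} (I : Ideal R) → CommutativeRing.Carrier R → Adic I
toCompletion {R} I x = record
  { residue = λ _ → x ; coherent = λ n → mod-reflexive (I ^ᴵ n) refl }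
  where open CommutativeRing R

module _ {R S : Ring₀} {f : CommutativeRing.Carrier R → CommutativeRing.Carrier S}
         (f-homo : IsRingHomomorphism (CommutativeRing.rawRing R) (CommutativeRing.rawRing S) f)
         (I : Ideal R) (J : Ideal S) (I⊆J : ∀ {x} → member I x → member J (f x)) where
  private
    module S = CommutativeRing S
    open IsRingHomomorphism f-homo

    power : ∀ n {x} → member (I ^ᴵ n) x → member (J ^ᴵ n) (f x)
    power zero    _ = tt
    power (suc n) m = go m
      where
      go : ∀ {x} → ProductMember I (I ^ᴵ n) x → ProductMember J (J ^ᴵ n) (f x)
      go (nil p)        = nil (S.trans (⟦⟧-cong p) 0#-homo)
      go (cons a b s p) = cons (I⊆J a) (power n b) (go s)
        (S.trans (⟦⟧-cong p) (S.trans (+-homo _ _) (S.+-congʳ (*-homo _ _))))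

  completionMap : Adic I → Adic J
  completionMap x = record
    { residue  = λ n → f (residue x n)
    ; coherent = λ n → Ideal.resp (J ^ᴵ n)
        (S.trans (+-homo _ _) (S.+-congˡ (-‿homo _))) (power n (Adic.coherent x n))
    }

record MaximalIdeal (R : Ring₀) : Set₁ where
  open CommutativeRing R
  field
    ideal : Ideal R
  field
    proper  : ¬ member ideal 1#
    maximal : ∀ (J : Ideal R) → ¬ member J 1# → member ideal ⊆ member J → member J ⊆ member ideal

record Submonoid (R : Ring₀) : Set₁ where
  open CommutativeRing R
  field
    subset : Pred Carrier 0ℓ
    1∈     : subset 1#
    *∈     : ∀ {x y} → subset x → subset y → subset (x * y)

record Fraction {R : Ring₀} (S : Submonoid R) : Set where
  constructor fraction
  open CommutativeRing R
  field
    num   : Carrier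
    den   : Carrier
    den∈S : Submonoid.subset S den

localisation : {R : Ring₀} → Submonoid R → Ring₀
localisation {R} S = makeRing raw
  (record { refl = exact refl
          ; sym = λ (s , s∈ , p) → s , s∈ , sym p
          ; trans = λ {x} {y} {z} (s , s∈ , p) (t , t∈ , q) →
              _ , *∈ (*∈ s∈ t∈) (den∈S y) , trans-law x y z p q })
  (λ {x} {x′} {y} {y′} (s , s∈ , p) (t , t∈ , q) → _ , *∈ s∈ t∈ , +-law x x′ y y′ p q)
  (λ {x} {x′} {y} {y′} (s , s∈ , p) (t , t∈ , q) → _ , *∈ s∈ t∈ , *-law x x′ y y′ p q)
  (λ {x} {x′} (s , s∈ , p) → s , s∈ , neg-law x x′ p)
  (λ x y z → exact (solve 6 (λ a b c d e f →
    ((a :* d :+ c :* b) :* f :+ e :* (b :* d)) :* (b :* (d :* f)) :=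
    (a :* (d :* f) :+ (c :* f :+ e :* d) :* b) :* (b :* d :* f)) refl
    (num x) (den x) (num y) (den y) (num z) (den z)))
  (λ x y → exact (solve 4 (λ a b c d →
    (a :* d :+ c :* b) :* (d :* b) := (c :* b :+ a :* d) :* (b :* d)) refl
    (num x) (den x) (num y) (den y)))
  (λ x → exact (solve 3 (λ a b o →
    (con (+ 0) :* b :+ a :* o) :* b := a :* (o :* b)) refl (num x) (den x) 1#))
  (λ x → exact (solve 3 (λ a b o →
    ((:- a) :* b :+ a :* b) :* o := con (+ 0) :* (b :* b)) refl (num x) (den x) 1#))
  (λ x y z → exact (solve 6 (λ a b c d e f →
    (a :* c :* e) :* (b :* (d :* f)) := (a :* (c :* e)) :* (b :* d :* f)) refl
    (num x) (den x) (num y) (den y) (num z) (den z)))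
  (λ x y → exact (*-cong (*-comm _ _) (*-comm _ _)))
  (λ x → exact (solve 3 (λ a b o → (o :* a) :* b := a :* (o :* b)) refl (num x) (den x) 1#))
  (λ x y z → exact (solve 6 (λ a b c d e f →
    (a :* (c :* f :+ e :* d)) :* (b :* d :* (b :* f)) :=
    ((a :* c) :* (b :* f) :+ (a :* e) :* (b :* d)) :* (b :* (d :* f))) refl
    (num x) (den x) (num y) (den y) (num z) (den z)))
  where
  open CommutativeRing R
  open Integers R
  open Submonoid S
  open Fraction
  open import Relation.Binary.Reasoning.Setoid setoid

  raw : RawRing 0ℓ 0ℓ
  raw = record
    { Carrier = Fraction S
    ; _≈_ = λ x y → ∃[ s ] subset s × s * (num x * den y) ≈ s * (num y * den x)
    ; _+_ = λ x y → fraction (num x * den y + num y * den x) (den x * den y) (*∈ (den∈S x) (den∈S y))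
    ; _*_ = λ x y → fraction (num x * num y) (den x * den y) (*∈ (den∈S x) (den∈S y))
    ; -_  = λ x → fraction (- num x) (den x) (den∈S x)
    ; 0#  = fraction 0# 1# 1∈
    ; 1#  = fraction 1# 1# 1∈
    }

  exact : ∀ {a b c d} → a * d ≈ c * b → ∃[ s ] subset s × s * (a * d) ≈ s * (c * b)
  exact p = 1# , 1∈ , *-congˡ p

  trans-law : ∀ (x y z : Fraction S) {s t} →
    s * (num x * den y) ≈ s * (num y * den x) → t * (num y * den z) ≈ t * (num z * den y) →
    (s * t * den y) * (num x * den z) ≈ (s * t * den y) * (num z * den x)
  trans-law x y z {s} {t} p q = begin
    (s * t * d) * (a * f)     ≈⟨ solve 5 (λ s t d a f → (s :* t :* d) :* (a :* f) :=
                                   (t :* f) :* (s :* (a :* d))) refl s t d a f ⟩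
    (t * f) * (s * (a * d))   ≈⟨ *-congˡ p ⟩
    (t * f) * (s * (c * b))   ≈⟨ solve 5 (λ s t f c b → (t :* f) :* (s :* (c :* b)) :=
                                   (s :* b) :* (t :* (c :* f))) refl s t f c b ⟩
    (s * b) * (t * (c * f))   ≈⟨ *-congˡ q ⟩
    (s * b) * (t * (e * d))   ≈⟨ solve 5 (λ s t d b e → (s :* b) :* (t :* (e :* d)) :=
                                   (s :* t :* d) :* (e :* b)) refl s t d b e ⟩
    (s * t * d) * (e * b)     ∎
    where
    a = num x
    b = den x
    c = num y
    d = den y
    e = num z
    f = den z

  +-law : ∀ (x x′ y y′ : Fraction S) {s t} →
    s * (num x * den x′) ≈ s * (num x′ * den x) → t * (num y * den y′) ≈ t * (num y′ * den y) →
    (s * t) * ((num x * den y + num y * den x) * (den x′ * den y′)) ≈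
    (s * t) * ((num x′ * den y′ + num y′ * den x′) * (den x * den y))
  +-law x x′ y y′ {s} {t} p q = begin
    _ ≈⟨ solve 8 (λ s t a b d b′ c d′ →
           (s :* t) :* ((a :* d :+ c :* b) :* (b′ :* d′)) :=
           (t :* (d :* d′)) :* (s :* (a :* b′)) :+ (s :* (b :* b′)) :* (t :* (c :* d′)))
           refl s t (num x) (den x) (den y) (den x′) (num y) (den y′) ⟩
    (t * (den y * den y′)) * (s * (num x * den x′)) + (s * (den x * den x′)) * (t * (num y * den y′))
      ≈⟨ +-cong (*-congˡ p) (*-congˡ q) ⟩
    (t * (den y * den y′)) * (s * (num x′ * den x)) + (s * (den x * den x′)) * (t * (num y′ * den y))
      ≈⟨ solve 8 (λ s t a′ b d b′ c′ d′ →
           (t :* (d :* d′)) :* (s :* (a′ :* b)) :+ (s :* (b :* b′)) :* (t :* (c′ :* d)) :=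
           (s :* t) :* ((a′ :* d′ :+ c′ :* b′) :* (b :* d)))
           refl s t (num x′) (den x) (den y) (den x′) (num y′) (den y′) ⟩
    _ ∎

  *-law : ∀ (x x′ y y′ : Fraction S) {s t} →
    s * (num x * den x′) ≈ s * (num x′ * den x) → t * (num y * den y′) ≈ t * (num y′ * den y) →
    (s * t) * ((num x * num y) * (den x′ * den y′)) ≈ (s * t) * ((num x′ * num y′) * (den x * den y))
  *-law x x′ y y′ {s} {t} p q = begin
    _ ≈⟨ solve 6 (λ s t a c b′ d′ → (s :* t) :* ((a :* c) :* (b′ :* d′)) :=
           (s :* (a :* b′)) :* (t :* (c :* d′))) refl s t (num x) (num y) (den x′) (den y′) ⟩
    (s * (num x * den x′)) * (t * (num y * den y′))  ≈⟨ *-cong p q ⟩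
    (s * (num x′ * den x)) * (t * (num y′ * den y))
      ≈⟨ solve 6 (λ s t a′ c′ b d → (s :* (a′ :* b)) :* (t :* (c′ :* d)) :=
           (s :* t) :* ((a′ :* c′) :* (b :* d))) refl s t (num x′) (num y′) (den x) (den y) ⟩
    _ ∎

  neg-law : ∀ (x x′ : Fraction S) {s} →
    s * (num x * den x′) ≈ s * (num x′ * den x) → s * (- num x * den x′) ≈ s * (- num x′ * den x)
  neg-law x x′ {s} p = begin
    s * (- num x * den x′)   ≈⟨ solve 3 (λ s a b → s :* ((:- a) :* b) := :- (s :* (a :* b)))
                                  refl s (num x) (den x′) ⟩
    - (s * (num x * den x′)) ≈⟨ -‿cong p ⟩
    - (s * (num x′ * den x)) ≈⟨ solve 3 (λ s a b → s :* ((:- a) :* b) := :- (s :* (a :* b)))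
                                  refl s (num x′) (den x) ⟨
    s * (- num x′ * den x)   ∎

ℤ[_] : ℕ → Ring₀
ℤ[ p ] = completion {ℤ-ring} (principal (+ p))

fromℤₚ : {R : Ring₀} (p : ℕ) (J : Ideal R) → member J (Integers.fromℤ R (+ p)) →
         CommutativeRing.Carrier ℤ[ p ] → Adic J
fromℤₚ {R} p J p∈J = completionMap {ℤ-ring} {R} ι-homo (principal (+ p)) J ⟨p⟩⊆J
  where
  open CommutativeRing R using (sym)
  open _-Algebra (ℤ-algebra R) using (ι; ι-homo)
  ⟨p⟩⊆J : ∀ {x} → member (principal {ℤ-ring} (+ p)) x → member J (ι x)
  ⟨p⟩⊆J (r , ≡.refl) = Ideal.resp J
    (sym (IsRingHomomorphism.*-homo ι-homo r (+ p))) (Ideal.*∈ J (ι r) p∈J)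

-- ℚ_p is ℤ_p with the nonzero integers inverted: every nonzero p-adic integer
-- divides a power of p, so this is the fraction field of ℤ_p.
nonzeroIntegers : ∀ p → Submonoid ℤ[ p ]
nonzeroIntegers p = record
  { subset = λ x → Σ[ d ∈ ℤ ] d ≢ + 0 × x ≈ toCompletion (principal (+ p)) d
  ; 1∈     = + 1 , (λ ()) , refl {1#}
  ; *∈     = λ {x} {y} (d , d≢0 , p) (e , e≢0 , q) → d ℤ.* e ,
      [ d≢0 , e≢0 ]′ ∘ ℤ.i*j≡0⇒i≡0∨j≡0 d , *-cong {x} {toCompletion _ d} {y} {toCompletion _ e} p q
  }
  where open CommutativeRing ℤ[ p ]

ℚ[_] : ℕ → ℚ-ring -Algebra
ℚ[ p ] = record
  { ring = ℚₚ
  ; ι = ι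
  ; ι-homo = makeHomo (CommutativeRing.rawRing ℚ-ring) ℚₚ.rawRing ι
      (λ { {q} ≡.refl → ℚₚ.refl {ι q} })
      (λ { q@record{} r@record{} → exact (ι (q ℚ.+ r)) (ι q ℚₚ.+ ι r)
        (λ _ → cross (q ℚ.+ r) (ℚ.toℚᵘ-homo-+ q r)) })
      (λ { q@record{} r@record{} → exact (ι (q ℚ.* r)) (ι q ℚₚ.* ι r)
        (λ _ → cross (q ℚ.* r) (ℚ.toℚᵘ-homo-* q r)) })
      (λ { q@record{} → exact (ι (ℚ.- q)) (ℚₚ.- ι q)
        (λ _ → cross (ℚ.- q) (ℚ.toℚᵘ-homo‿- q)) })
      (exact (ι ℚ.0ℚ) ℚₚ.0# (λ _ → ≡.refl)) (exact (ι ℚ.1ℚ) ℚₚ.1# (λ _ → ≡.refl))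
  }
  where
  ℚₚ = localisation (nonzeroIntegers p)
  module ℚₚ = CommutativeRing ℚₚ
  module ℤₚ = CommutativeRing ℤ[ p ]
  ⟨p⟩ : Ideal ℤ-ring
  ⟨p⟩ = principal (+ p)
  ι : ℚ → Fraction (nonzeroIntegers p)
  ι q = fraction (toCompletion ⟨p⟩ (ℚ.numerator q)) (toCompletion ⟨p⟩ (ℚ.denominator q))
          (ℚ.denominator q , (λ ()) , ℤₚ.refl {toCompletion ⟨p⟩ (ℚ.denominator q)})
  exact : (x y : Fraction (nonzeroIntegers p)) → let open Fraction in
    (∀ n → residue (num x) n ℤ.* residue (den y) n ≡ residue (num y) n ℤ.* residue (den x) n) →
    x ℚₚ.≈ y
  exact x y e = ℤₚ.1# , Submonoid.1∈ (nonzeroIntegers p) ,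
    λ n → mod-reflexive (⟨p⟩ ^ᴵ n) (≡.cong (+ 1 ℤ.*_) (e n))
  cross : ∀ q {u : ℚᵘ} → ℚ.toℚᵘ q ≃ u → ℚ.↥ q ℤ.* ℚᵘ.↧ u ≡ ℚᵘ.↥ u ℤ.* ℚ.↧ q
  cross record{} q≃u = drop-*≡* q≃u

record NumberField : Set₁ where
  field
    algebra : ℚ-ring -Algebra
  open _-Algebra algebra public using (ring; ι)
  open CommutativeRing ring using (Carrier; _≈_; _*_; 0#; 1#; +-rawMonoid)
  open Algebra.Definitions.RawMonoid +-rawMonoid using (sum)
  field
    nontrivial  : ¬ 1# ≈ 0#
    inverse     : ∀ x → ¬ x ≈ 0# → ∃[ y ] x * y ≈ 1#
    degree      : ℕ
    basis       : Vector Carrier degree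
    spanning    : ∀ x → Σ[ c ∈ Vector ℚ degree ] x ≈ sum (λ i → ι (c i) * basis i)
    independent : ∀ (c : Vector ℚ degree) → sum (λ i → ι (c i) * basis i) ≈ 0# → ∀ i → c i ≡ ℚ.0ℚ

record EtaleAlgebra : Set₁ where
  field
    factors   : ℕ
    factors>0 : 0 ℕ.< factors
    factor    : Fin factors → NumberField

  ring : Ring₀
  ring = Π (λ i → NumberField.ring (factor i))

  𝒪 : Ring₀
  𝒪 = Π (λ i → integralClosure (NumberField.ring (factor i)))

  open CommutativeRing ring public using (Carrier)
  open CommutativeRing 𝒪 public using () renaming (Carrier to 𝒪-Carrier; _≈_ to _≈𝒪_; _*_ to _*𝒪_)

  incl : 𝒪-Carrier → Carrier
  incl x i = proj₁ (x i)

  dim : ℕ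
  dim = Algebra.Definitions.RawMonoid.sum ℕ.+-0-rawMonoid (λ i → NumberField.degree (factor i))

  algebra : ℚ-ring -Algebra
  algebra = record
    { ring = ring
    ; ι = λ q i → F.ι i q
    ; ι-homo = makeHomo (CommutativeRing.rawRing ℚ-ring) (CommutativeRing.rawRing ring) _
        (λ p i → F.⟦⟧-cong i p) (λ q r i → F.+-homo i q r) (λ q r i → F.*-homo i q r)
        (λ q i → F.-‿homo i q) (λ i → F.0#-homo i) (λ i → F.1#-homo i)
    }
    where
    module F (i : Fin factors) where
      open _-Algebra (NumberField.algebra (factor i)) public using (ι; ι-homo)
      open IsRingHomomorphism ι-homo public

open EtaleAlgebra using (𝒪; incl; dim)

IsAlgebraHom : {R : Ring₀} (A B : R -Algebra) →
  (_-Algebra.Carrier A → _-Algebra.Carrier B) → Set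
IsAlgebraHom A B f = IsRingHomomorphism A.rawRing B.rawRing f × (∀ r → f (A.ι r) ≈ B.ι r)
  where
  module A = _-Algebra A
  module B = _-Algebra B
  open CommutativeRing B.ring using (_≈_)

SplitsCompletely : ℕ → EtaleAlgebra → Set
SplitsCompletely p K =
  Σ[ φ ∈ (FormalSum → CommutativeRing.Carrier ℚₚⁿ) ]
    IsRingIsomorphism rawRing (CommutativeRing.rawRing ℚₚⁿ) φ
    × (∀ z → CommutativeRing._≈_ ℚₚⁿ (φ (ιʳ z)) (λ _ → z))
  where
  open Tensor (EtaleAlgebra.algebra K) ℚ[ p ] using (FormalSum; rawRing; ιʳ)
  ℚₚⁿ : Ring₀
  ℚₚⁿ = Π {Fin (dim K)} (λ _ → _-Algebra.ring ℚ[ p ])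

module _ {R : Ring₀} (I : Ideal R) where
  open CommutativeRing (completion I) using (_+_)

  Open : Pred (Adic I) 0ℓ → Set
  Open U = ∀ x → U x → ∃[ n ] (∀ y → residue y n ≡ residue x n mod (I ^ᴵ n) → U y)

  Compact : Pred (Adic I) 0ℓ → Set₁
  Compact U = (J : Set) (V : J → Pred (Adic I) 0ℓ) → (∀ j → Open (V j)) →
    (∀ x → U x → ∃[ j ] V j x) →
    Σ[ js ∈ List J ] (∀ x → U x → Any (λ j → V j x) js)

  record CompactOpen : Set₁ where
    field
      set       : Pred (Adic I) 0ℓ
      isOpen    : Open set
      isCompact : Compact set

  open CompactOpen using (set)

  -- The normalised Haar measure, restricted to compact open sets.  As the
  -- residue field is finite, these are finite unions of cosets of the
  -- (finite-index) powers of the ideal, so the values are rational; finite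
  -- additivity and translation invariance determine them.
  record HaarMeasure : Set₁ where
    field
      meas        : CompactOpen → ℚ
      nonNegative : ∀ U → ℚ.0ℚ ℚ.≤ meas U
      cong        : ∀ U V → set U ≐ set V → meas U ≡ meas V
      additive    : ∀ U V W → (∀ x → set U x → set V x → ⊥) → set W ≐ (set U ∪ set V) →
                    meas W ≡ meas U ℚ.+ meas V
      invariant   : ∀ a U V → (∀ x → set U x → set V (a + x)) →
                    (∀ x → set V (a + x) → set U x) → meas V ≡ meas U
      normalised  : ∀ U → (∀ x → set U x) → meas U ≡ ℚ.1ℚ

open CompactOpen using (set)
open HaarMeasure using (meas)

module _ (K : EtaleAlgebra) where
  open CommutativeRing (𝒪 K) using (Carrier; refl; rawRing)

  PrimeOf : Set₁
  PrimeOf = MaximalIdeal (𝒪 K)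

  open MaximalIdeal using (ideal)

  infix 4 _∣ᴾ_ _≐ᴾ_
  _∣ᴾ_ : PrimeOf → ℕ → Set
  𝔭 ∣ᴾ p = member (ideal 𝔭) (Integers.fromℤ (𝒪 K) (+ p))

  _≐ᴾ_ : PrimeOf → PrimeOf → Set
  𝔭 ≐ᴾ 𝔮 = member (ideal 𝔭) ≐ member (ideal 𝔮)

  -- Primes are represented by predicates, so a family indexed by them has to
  -- respect extensional equality of predicates.
  record Sieve : Set₁ where
    field
      at          : (𝔭 : PrimeOf) → CompactOpen (ideal 𝔭)
      extensional : ∀ 𝔭 𝔮 (e : 𝔭 ≐ᴾ 𝔮) x → set (at 𝔭) x →
        set (at 𝔮) (completionMap {𝒪 K} {𝒪 K} {id} (isRingHomomorphism rawRing (λ {x} → refl {x})) (ideal 𝔭) (ideal 𝔮) (proj₁ e) x)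

  record PrimesAbove (p : ℕ) : Set₁ where
    field
      count    : ℕ
      prime    : Fin count → PrimeOf
      above    : ∀ i → prime i ∣ᴾ p
      distinct : ∀ i j → prime i ≐ᴾ prime j → i ≡ j
      complete : ∀ 𝔮 → 𝔮 ∣ᴾ p → ∃[ i ] 𝔮 ≐ᴾ prime i

  -- Haar measures being unique, quantifying existentially over them and over the
  -- enumeration of the primes above p does not affect the sum of the meas (R_𝔭).
  MeasureSum<1 : Sieve → ℕ → Set₁
  MeasureSum<1 R p = Σ[ P ∈ PrimesAbove p ] let open PrimesAbove P in
    Σ[ μ ∈ (∀ i → HaarMeasure (ideal (prime i))) ]
      sum (λ i → meas (μ i) (Sieve.at R (prime i))) ℚ.< ℚ.1ℚ
    where open Algebra.Definitions.RawMonoid ℚ.+-0-rawMonoid using (sum)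

  -- 𝒪_{K,p} = 𝒪_K ⊗_ℤ ℤ_p
  𝒪[_] : ℕ → Set
  𝒪[ p ] = Tensor.FormalSum (ℤ-algebra (𝒪 K)) (ℤ-algebra ℤ[ p ])

  -- x ⊗ z ↦ x z; these are the components of 𝒪_{K,p} ≅ ∏_{𝔭∣p} 𝒪_{K,𝔭}.
  localise : ∀ p 𝔭 → 𝔭 ∣ᴾ p → 𝒪[ p ] → Adic (ideal 𝔭)
  localise p 𝔭 𝔭∣p = foldr (λ (x , z) s → toCompletion (ideal 𝔭) x * fromℤₚ p (ideal 𝔭) 𝔭∣p z + s) 0#
    where
    open CommutativeRing (completion (ideal 𝔭)) using (_+_; _*_; 0#)

  V : ∀ p → Sieve → Pred 𝒪[ p ] (Level.suc 0ℓ)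
  V p R t = ∀ 𝔭 (𝔭∣p : 𝔭 ∣ᴾ p) → ¬ set (Sieve.at R 𝔭) (localise p 𝔭 𝔭∣p t)

module _ (K L : EtaleAlgebra) where
  private
    module K = EtaleAlgebra K
    module L = EtaleAlgebra L

  -- Additive maps of abelian groups are automatically ℤ-linear.
  IsℤLinear : (K.𝒪-Carrier → L.𝒪-Carrier) → Set
  IsℤLinear = IsGroupHomomorphism
    (RawRing.+-rawGroup (CommutativeRing.rawRing K.𝒪))
    (RawRing.+-rawGroup (CommutativeRing.rawRing L.𝒪))

  -- A ⊗ ℤ_p
  induced : (K.𝒪-Carrier → L.𝒪-Carrier) → ∀ p → 𝒪[_] K p → 𝒪[_] L p
  induced A p = map (λ (x , z) → A x , z)

  IsRestriction : (K.Carrier → L.Carrier) → (K.𝒪-Carrier → L.𝒪-Carrier) → Set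
  IsRestriction τ τ₀ = ∀ x → CommutativeRing._≈_ L.ring (L.incl (τ₀ x)) (τ (K.incl x))

M : (L : EtaleAlgebra) → EtaleAlgebra.𝒪-Carrier L → EtaleAlgebra.𝒪-Carrier L → EtaleAlgebra.𝒪-Carrier L
M L ε x = EtaleAlgebra._*𝒪_ L ε x

-- Let p satisfy (a)–(d), so that 𝒪_{K,p} = ℤₚⁿ and 𝒪_{L,p} = ℤₚᵐ. A row f of the matrix A is f = Σ αᵢ φᵢ, where
-- φᵢ : 𝒪_K → ℤₚ are the homomorphisms belonging to the primes 𝔭ᵢ ∣ p of K. If two coefficients αᵢ, αₗ were units, one
-- could prescribe the value of f modulo a power of p and still choose the component xᵢ freely, xₗ being an affine
-- bijective function of it; as meas R_{𝔭ᵢ} + meas R_{𝔭ₗ} < 1, some choice avoids all R_𝔭, contradicting (a) and (b).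
-- So modulo each 𝔮 ∣ p the map A is a multiple of a ring homomorphism, and A x · A y ≡ A (x y) · A 1. This holds for
-- infinitely many p, hence A x · A y = A (x y) · A 1. A component of A cannot vanish, by (a) and (b) again, so
-- ε = A 1 is invertible in L and τ = A / ε is multiplicative.
--
-- Completeness of the splitting is used through lattice approximations: an element of K close to an idempotent of
-- K ⊗ ℚₚ is a root of T² − sT − λ with λ integral and p ∤ s, so that the idempotents of ℤₚⁿ are limits of
-- elements of 𝒪_K and no discriminants are needed.
--
-- Compactness of ℤₚ is not provable constructively. It is only needed when some R_𝔭 is inhabited, and then follows
-- from the given compactness of R_𝔭, which contains a ball.
module Submission where

open import Defs
open import Data.Nat using (ℕ; _<_)
open import Data.Nat.Primality using (Prime)
open import Data.Product using (Σ-syntax; _×_; ∃-syntax)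
import Algebra.Definitions.RawMonoid
import Algebra.Properties.Group as GroupProperties
import Algebra.Properties.Ring as RingProperties
import Algebra.Properties.Semiring.Exp as Exp
import Algebra.Properties.Semiring.Sum as Sum
import Data.Integer.Divisibility.Signed as ℤ∣
import Data.Integer.DivMod as ℤ
import Data.Integer.Properties as ℤ
import Data.Integer.Solver as ℤSolver
import Data.Nat.Coprimality as Coprimality
import Data.Nat.Divisibility as ℕ∣
import Data.Nat.GCD as GCD
import Data.Nat.Properties as ℕ
import Data.Rational.Properties as ℚ
import Data.Rational.Unnormalised.Base as ℚᵘ
import Data.Rational.Unnormalised.Properties as ℚᵘ
open import Algebra.Properties.Monoid.Mult ℚ.+-0-monoid
  using (×-congʳ; ×-assocˡ; ×-homo-+) renaming (_×_ to infixr 8 _·ℚ_)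
open import Algebra.Properties.CommutativeMonoid.Mult ℚ.+-0-commutativeMonoid using (×-distrib-+)
open import Algebra using (CommutativeRing; RawRing)
open import Algebra.Morphism.Structures
  using (IsRingHomomorphism; IsGroupHomomorphism; IsRingIsomorphism)
open import Data.Empty using (⊥)
open import Data.Fin.Base using (Fin; zero; suc; toℕ; punchIn; punchOut; fromℕ<)
open import Data.Fin.Properties using (toℕ<n; any?; all?; suc-injective; toℕ-injective; toℕ-fromℕ<; _≟_; punchIn-punchOut)
open import Data.Integer.Base as ℤ using (ℤ; +_; -[1+_])
open import Data.Integer.Divisibility.Signed using (_∣_; divides; ∣⇒∣ᵤ; ∣ᵤ⇒∣)
open import Data.List.Base using (List; []; _∷_; _++_; map; length; filter; catMaybes; allFin)
open import Data.List.Membership.Propositional using (_∈_)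
open import Data.List.Membership.Propositional.Properties using (∈-allFin; ∈-filter⁺; ∈-filter⁻)
open import Data.List.Properties using (length-tabulate; filter-none)
open import Data.List.Relation.Unary.All as All using (All; []; _∷_)
open import Data.List.Relation.Unary.AllPairs using ([]; _∷_)
open import Data.List.Relation.Unary.Any using (Any; here; there) renaming (any? to any?ᴸ)
open import Data.List.Relation.Unary.Any.Properties using (++⁺ˡ; ++⁺ʳ)
open import Data.List.Relation.Unary.Unique.Propositional using (Unique)
open import Data.List.Relation.Unary.Unique.Propositional.Properties using (filter⁺; allFin⁺)
open import Data.Maybe.Base using (Maybe; just; nothing)
open import Data.Nat.Base as ℕ using (zero; suc; z≤n; s≤s)
open import Data.Nat.Induction using (<-wellFounded)
open import Data.Nat.Primality using (euclidsLemma; prime⇒irreducible; prime⇒nonTrivial)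
open import Data.Product using (Σ; _,_; proj₁; proj₂)
open import Data.Rational.Base as ℚ using (ℚ)
open import Data.Sum.Base using (_⊎_; inj₁; inj₂)
open import Data.Unit.Base using (⊤; tt)
open import Data.Vec.Functional using (Vector)
open import Function.Base using (_∘_; id)
open import Induction.WellFounded using (Acc; acc)
open import Level using (0ℓ)
open import Relation.Binary.PropositionalEquality as ≡ using (_≡_; _≢_)
open import Relation.Nullary using (¬_; Dec; yes; no; contradiction)
open import Relation.Nullary.Decidable using (map′; ¬?; decidable-stable; _×-dec_)
open import Relation.Unary using (Pred; _⊆_)

-- Integers and primes

-- The valuation arguments see ℚₚ only through `Valued`: p-adic integers are replaced by integers
-- that approximate them, so that congruences become divisibilities in ℤ, which are decidable.
-- Likewise 𝒪 ⊗ ℤₚ ≅ ℤₚⁿ is never formed; `Splitting` expresses it by approximate idempotents in 𝒪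
-- and by division by pᵏ up to an integer prime to p. Membership in an arbitrary prime above p
-- cannot be decided, so that prime is identified with the kernel of some φᵢ modulo p only under a
-- double negation; this suffices for the negations in `V`. The final equations live in number
-- fields, where coordinates decide equality, and may be proved by contradiction. Congruences become
-- equations as follows: if a component of z = A x · A y - A (x y) · A 1 were nonzero, some multiple
-- of z would be D eⱼ with D a nonzero integer and eⱼ the idempotent of the j-th factor of L. The
-- integer D is fixed before p is chosen, and z cannot vanish modulo every prime above a split p
-- greater than |D|.

module _ {p : ℕ} (p-prime : Prime p) where
  private
    P : ℤ
    P = + p

  private instance
    p-nonZero : ℕ.NonZero p
    p-nonZero = ℕ.nonTrivial⇒nonZero p {{prime⇒nonTrivial p-prime}}

  pow≢0 : ∀ k → P ℤ.^ k ≢ + 0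
  pow≢0 k eq = ℕ.≢-nonZero⁻¹ p (ℤ.+-injective (ℤ.i^n≡0⇒i≡0 P k eq))

  ∣-*-split : ∀ a b → P ∣ a ℤ.* b → P ∣ a ⊎ P ∣ b
  ∣-*-split a b d with euclidsLemma ℤ.∣ a ∣ ℤ.∣ b ∣ p-prime
                        (≡.subst (p ℕ∣.∣_) (ℤ.∣i*j∣≡∣i∣*∣j∣ a b) (∣⇒∣ᵤ d))
  ... | inj₁ q = inj₁ (∣ᵤ⇒∣ q)
  ... | inj₂ q = inj₂ (∣ᵤ⇒∣ q)

  ∤-* : ∀ {a b} → ¬ P ∣ a → ¬ P ∣ b → ¬ P ∣ a ℤ.* b
  ∤-* {a} {b} ¬a ¬b d with ∣-*-split a b d
  ... | inj₁ q = ¬a q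
  ... | inj₂ q = ¬b q

  ∤1 : ¬ P ∣ + 1
  ∤1 d = ℕ.nonTrivial⇒≢1 {{prime⇒nonTrivial p-prime}} (ℕ∣.∣1⇒≡1 (∣⇒∣ᵤ d))

  ∣-^⇒∣ : ∀ a k → P ∣ a ℤ.^ k → P ∣ a
  ∣-^⇒∣ a zero    d = contradiction d ∤1
  ∣-^⇒∣ a (suc k) d with ∣-*-split a (a ℤ.^ k) d
  ... | inj₁ q = q
  ... | inj₂ q = ∣-^⇒∣ a k q

  private
    bezoutℕ : ∀ n → ¬ p ℕ∣.∣ n → Σ[ u ∈ ℤ ] Σ[ v ∈ ℤ ] u ℤ.* + n ℤ.+ v ℤ.* P ≡ + 1
    bezoutℕ n p∤n with Coprimality.coprime-Bézout {p} {n} coprime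
      where
      coprime : Coprimality.Coprime p n
      coprime (d∣p , d∣n) with prime⇒irreducible p-prime d∣p
      ... | inj₁ d≡1    = d≡1
      ... | inj₂ ≡.refl = contradiction d∣n p∤n
    ... | GCD.Bézout.+- x y eq = ℤ.- + y , + x , ≡.trans
      (≡.cong (λ t → ℤ.- + y ℤ.* + n ℤ.+ t)
        (≡.trans (≡.sym (ℤ.pos-* x p)) (≡.trans (≡.cong +_ (≡.sym eq))
          (≡.trans (ℤ.pos-+ 1 _) (≡.cong (ℤ._+_ (+ 1)) (ℤ.pos-* y n))))))
      (solve 2 (λ y n → (:- y) :* n :+ (con (+ 1) :+ y :* n) := con (+ 1)) ≡.refl (+ y) (+ n))
      where open ℤSolver.+-*-Solver
    ... | GCD.Bézout.-+ x y eq = + y , ℤ.- + x , ≡.trans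
      (≡.cong (λ t → t ℤ.+ ℤ.- + x ℤ.* P)
        (≡.trans (≡.sym (ℤ.pos-* y n)) (≡.trans (≡.cong +_ (≡.sym eq))
          (≡.trans (ℤ.pos-+ 1 _) (≡.cong (ℤ._+_ (+ 1)) (ℤ.pos-* x p))))))
      (solve 2 (λ x p → (con (+ 1) :+ x :* p) :+ (:- x) :* p := con (+ 1)) ≡.refl (+ x) P)
      where open ℤSolver.+-*-Solver

  bezout : ∀ s → ¬ P ∣ s → Σ[ u ∈ ℤ ] Σ[ v ∈ ℤ ] u ℤ.* s ℤ.+ v ℤ.* P ≡ + 1
  bezout (+ n) p∤s = bezoutℕ n (λ d → p∤s (∣ᵤ⇒∣ d))
  bezout (-[1+ n ]) p∤s with bezoutℕ (suc n) (λ d → p∤s (∣ᵤ⇒∣ d))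
  ... | u , v , eq = ℤ.- u , v , ≡.trans (≡.cong (ℤ._+ v ℤ.* P)
    (solve 2 (λ u m → (:- u) :* (:- m) := u :* m) ≡.refl u (+ suc n))) eq
    where open ℤSolver.+-*-Solver

  -- The identities for p and for pᵏ multiply to one for pᵏ⁺¹.
  bezout-^ : ∀ s → ¬ P ∣ s → ∀ k → Σ[ u ∈ ℤ ] Σ[ v ∈ ℤ ] u ℤ.* s ℤ.+ v ℤ.* P ℤ.^ k ≡ + 1
  bezout-^ s p∤s zero    = + 0 , + 1 , ≡.refl
  bezout-^ s p∤s (suc k) with bezout s p∤s | bezout-^ s p∤s k
  ... | u , v , eq | u′ , v′ , eq′ =
    u ℤ.* u′ ℤ.* s ℤ.+ u ℤ.* v′ ℤ.* P ℤ.^ k ℤ.+ v ℤ.* u′ ℤ.* P , v ℤ.* v′ ,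
    ≡.trans (solve 7 (λ u v u′ v′ s p q →
        (u :* u′ :* s :+ u :* v′ :* q :+ v :* u′ :* p) :* s :+ (v :* v′) :* (p :* q)
          := (u :* s :+ v :* p) :* (u′ :* s :+ v′ :* q)) ≡.refl u v u′ v′ s P (P ℤ.^ k))
      (≡.cong₂ ℤ._*_ eq eq′)
    where open ℤSolver.+-*-Solver

  ^-∣-cancel : ∀ s → ¬ P ∣ s → ∀ k z → P ℤ.^ k ∣ s ℤ.* z → P ℤ.^ k ∣ z
  ^-∣-cancel s p∤s k z (divides r eq) with bezout-^ s p∤s k
  ... | u , v , e = divides (u ℤ.* r ℤ.+ v ℤ.* z) (begin
      z                                          ≡⟨ ℤ.*-identityˡ z ⟨
      + 1 ℤ.* z                                  ≡⟨ ≡.cong (ℤ._* z) e ⟨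
      (u ℤ.* s ℤ.+ v ℤ.* q) ℤ.* z                ≡⟨ solve 5 (λ u v s q z →
        (u :* s :+ v :* q) :* z := u :* (s :* z) :+ v :* q :* z) ≡.refl u v s q z ⟩
      u ℤ.* (s ℤ.* z) ℤ.+ v ℤ.* q ℤ.* z          ≡⟨ ≡.cong (λ t → u ℤ.* t ℤ.+ v ℤ.* q ℤ.* z) eq ⟩
      u ℤ.* (r ℤ.* q) ℤ.+ v ℤ.* q ℤ.* z          ≡⟨ solve 5 (λ u v r q z →
        u :* (r :* q) :+ v :* q :* z := (u :* r :+ v :* z) :* q) ≡.refl u v r q z ⟩
      (u ℤ.* r ℤ.+ v ℤ.* z) ℤ.* q                ∎)
    where
    open ≡.≡-Reasoning
    open ℤSolver.+-*-Solver
    q = P ℤ.^ k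

  -- Splits a denominator into a power of p, which is tracked as a loss of precision, and a part
  -- prime to p, which acts as a unit.
  valuation : ∀ d → d ≢ + 0 → Σ[ c ∈ ℕ ] Σ[ d′ ∈ ℤ ] d ≡ P ℤ.^ c ℤ.* d′ × ¬ P ∣ d′
  valuation d d≢0 = go d d≢0 (<-wellFounded _)
    where
    go : ∀ d → d ≢ + 0 → Acc ℕ._<_ ℤ.∣ d ∣ →
         Σ[ c ∈ ℕ ] Σ[ d′ ∈ ℤ ] d ≡ P ℤ.^ c ℤ.* d′ × ¬ P ∣ d′
    go d d≢0 (acc rec) with P ℤ∣.∣? d
    ... | no p∤d = 0 , d , ≡.sym (ℤ.*-identityˡ d) , p∤d
    ... | yes (divides q eq) with go q q≢0 (rec smaller)
      where
      q≢0 : q ≢ + 0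
      q≢0 q≡0 = d≢0 (≡.trans eq (≡.cong (ℤ._* P) q≡0))
      smaller : ℤ.∣ q ∣ ℕ.< ℤ.∣ d ∣
      smaller = ≡.subst (ℤ.∣ q ∣ ℕ.<_)
        (≡.sym (≡.trans (≡.cong ℤ.∣_∣ eq) (ℤ.∣i*j∣≡∣i∣*∣j∣ q P)))
        (ℕ.m<m*n ℤ.∣ q ∣ p {{ℕ.≢-nonZero (λ e → q≢0 (ℤ.∣i∣≡0⇒i≡0 e))}}
          (ℕ.nonTrivial⇒n>1 p {{prime⇒nonTrivial p-prime}}))
    ...   | c , d′ , e , p∤d′ = suc c , d′ , ≡.trans eq (≡.trans (≡.cong (ℤ._* P) e)
      (solve 3 (λ q d p → q :* d :* p := p :* q :* d) ≡.refl (P ℤ.^ c) d′ P)) , p∤d′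
      where open ℤSolver.+-*-Solver

pos-^ : ∀ p k → + (p ℕ.^ k) ≡ (+ p) ℤ.^ k
pos-^ p zero    = ≡.refl
pos-^ p (suc k) = ≡.trans (ℤ.pos-* p (p ℕ.^ k)) (≡.cong (+ p ℤ.*_) (pos-^ p k))

^1-∣ : ∀ p z → (+ p) ℤ.^ 1 ∣ z → + p ∣ z
^1-∣ p z = ≡.subst (_∣ z) (ℤ.*-identityʳ (+ p))

∣-^1 : ∀ p z → + p ∣ z → (+ p) ℤ.^ 1 ∣ z
∣-^1 p z = ≡.subst (_∣ z) (≡.sym (ℤ.*-identityʳ (+ p)))

-- Rings, homomorphisms and p-adic filtrations

∣R∣ : Ring₀ → Set
∣R∣ = CommutativeRing.Carrier

IsHom : (R S : Ring₀) → (∣R∣ R → ∣R∣ S) → Set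
IsHom R S = IsRingHomomorphism (CommutativeRing.rawRing R) (CommutativeRing.rawRing S)

module RingOps (R : Ring₀) where
  open CommutativeRing R public hiding (zero)
  open Integers R public using (fromℤ; fromℤ-+; fromℤ-*; fromℤ-neg; solve; _:=_; _:+_; _:*_; _:-_; :-_; con)
  open Exp semiring public using (_^_; ^-congˡ; ^-homo-*)
  open Sum semiring public using (sum; sum-cong-≋; *-distribˡ-sum)
  open RingProperties ring public using (-0#≈0#)
  open import Relation.Binary.Reasoning.Setoid setoid public

  fromℤ-1 : fromℤ (+ 1) ≈ 1#
  fromℤ-1 = +-identityʳ 1#

  x-y≈0⇒x≈y : ∀ {x y} → x - y ≈ 0# → x ≈ y
  x-y≈0⇒x≈y {x} {y} e = trans (solve 2 (λ x y → x := (x :- y) :+ y) refl x y) (trans (+-congʳ e) (+-identityˡ y))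

  unit-cancel : ∀ {d} → Σ[ i ∈ Carrier ] d * i ≈ 1# → ∀ {x y} → d * x ≈ d * y → x ≈ y
  unit-cancel {d} (i , di≈1) {x} {y} e = begin
    x             ≈⟨ trans (*-congʳ di≈1) (*-identityˡ x) ⟨
    (d * i) * x   ≈⟨ solve 3 (λ d i x → (d :* i) :* x := i :* (d :* x)) refl d i x ⟩
    i * (d * x)   ≈⟨ *-congˡ e ⟩
    i * (d * y)   ≈⟨ solve 3 (λ d i x → i :* (d :* x) := (d :* i) :* x) refl d i y ⟩
    (d * i) * y   ≈⟨ trans (*-congʳ di≈1) (*-identityˡ y) ⟩
    y             ∎

  sum-zero : ∀ {n} (v : Vector Carrier n) → (∀ i → v i ≈ 0#) → sum v ≈ 0#
  sum-zero {zero}  v e = refl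
  sum-zero {suc n} v e = trans (+-cong (e zero) (sum-zero (v ∘ suc) (e ∘ suc))) (+-identityˡ 0#)

module Hom {R S : Ring₀} {h : ∣R∣ R → ∣R∣ S} (h-hom : IsHom R S h) where
  private
    module R = RingOps R
    module S = RingOps S
  open IsRingHomomorphism h-hom public
  open import Algebra.Properties.Monoid.Mult R.+-monoid using () renaming (_×_ to _·ᴿ_)
  open import Algebra.Properties.Monoid.Mult S.+-monoid using () renaming (_×_ to _·ˢ_)

  h-minus : ∀ x y → h (x R.- y) S.≈ h x S.- h y
  h-minus x y = S.trans (+-homo x (R.- y)) (S.+-congˡ (-‿homo y))

  private
    h-mult : ∀ n → h (n ·ᴿ R.1#) S.≈ n ·ˢ S.1#
    h-mult zero    = 0#-homo
    h-mult (suc n) = S.trans (+-homo _ _) (S.+-cong 1#-homo (h-mult n))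

  h-fromℤ : ∀ z → h (R.fromℤ z) S.≈ S.fromℤ z
  h-fromℤ (+ n)      = h-mult n
  h-fromℤ (-[1+ n ]) = S.trans (-‿homo _) (S.-‿cong (h-mult (suc n)))

  h-fromℤ-* : ∀ d x {y} → R.fromℤ d R.* x R.≈ y → S.fromℤ d S.* h x S.≈ h y
  h-fromℤ-* d x e = S.trans (S.*-congʳ (S.sym (h-fromℤ d))) (S.trans (S.sym (*-homo _ x)) (⟦⟧-cong e))

  h-sum : ∀ {n} (v : Vector R.Carrier n) → h (R.sum v) S.≈ S.sum (h ∘ v)
  h-sum {zero}  v = 0#-homo
  h-sum {suc n} v = S.trans (+-homo _ _) (S.+-congˡ (h-sum (v ∘ suc)))

  h-^ : ∀ x n → h (x R.^ n) S.≈ h x S.^ n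
  h-^ x zero    = 1#-homo
  h-^ x (suc n) = S.trans (*-homo _ _) (S.*-congˡ (h-^ x n))

fromℤ-ℤ : ∀ z → Integers.fromℤ ℤ-ring z ≡ z
fromℤ-ℤ (+ n) = go n
  where
  go : ∀ n → Integers.fromℤ ℤ-ring (+ n) ≡ + n
  go zero    = ≡.refl
  go (suc n) = ≡.trans (≡.cong (ℤ._+_ (+ 1)) (go n)) (≡.sym (ℤ.pos-+ 1 n))
fromℤ-ℤ (-[1+ n ]) = ≡.cong ℤ.-_ (fromℤ-ℤ (+ suc n))

ℤ-hom-unique : (S : Ring₀) {h : ℤ → ∣R∣ S} → IsHom ℤ-ring S h →
  ∀ z → CommutativeRing._≈_ S (h z) (Integers.fromℤ S z)
ℤ-hom-unique S {h} h-hom z = S.trans (S.reflexive (≡.cong h (≡.sym (fromℤ-ℤ z)))) (Hom.h-fromℤ {ℤ-ring} {S} h-hom z)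
  where module S = CommutativeRing S

-- F k stands for the subgroup pᵏℤₚ of Q = ℚₚ.
record Valued (p : ℕ) (Q : Ring₀) : Set₁ where
  open RingOps Q
  field
    F        : ℕ → Pred Carrier 0ℓ
    F-resp   : ∀ {k x y} → x ≈ y → F k x → F k y
    F-+      : ∀ {k x y} → F k x → F k y → F k (x + y)
    F-*      : ∀ {j k x y} → F j x → F k y → F (j ℕ.+ k) (x * y)
    F-p^     : ∀ k → F k (fromℤ ((+ p) ℤ.^ k))
    F-ℤ      : ∀ z → F 0 (fromℤ z)
    F-pred   : ∀ {k x} → F (suc k) x → F k x
    -- ℤ is dense in ℤₚ. Together with `F⇒∣` this reduces membership in `F k` to divisibility in ℤ.
    approx   : ∀ {x} → F 0 x → ∀ k → Σ[ r ∈ ℤ ] F k (x - fromℤ r)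
    F⇒∣      : ∀ {k z} → F k (fromℤ z) → (+ p) ℤ.^ k ∣ z
    bounded  : ∀ x → ∃[ c ] F 0 (fromℤ ((+ p) ℤ.^ c) * x)
    inverses : ∀ d → d ≢ + 0 → Σ[ y ∈ Carrier ] fromℤ d * y ≈ 1#
    F-p⁻     : ∀ {k x} → F (suc k) (fromℤ (+ p) * x) → F k x

module ValuedOps {p : ℕ} (p-prime : Prime p) {Q : Ring₀} (V : Valued p Q) where
  open Valued V public
  open RingOps Q public

  F-*ˡ : ∀ {k x y} → F 0 x → F k y → F k (x * y)
  F-*ˡ = F-* {0}

  F-*ʳ : ∀ {k x y} → F k x → F 0 y → F k (x * y)
  F-*ʳ {k} f g = F-resp (*-comm _ _) (F-*ˡ g f)

  F-neg : ∀ {k x} → F k x → F k (- x)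
  F-neg {x = x} f = F-resp (solve 1 (λ x → con (ℤ.- + 1) :* x := :- x) refl x) (F-*ˡ (F-ℤ (ℤ.- + 1)) f)

  F-minus : ∀ {k x y} → F k x → F k y → F k (x - y)
  F-minus f g = F-+ f (F-neg g)

  F-≤ : ∀ {j k x} → j ℕ.≤ k → F k x → F j x
  F-≤ {j} {k} {x} j≤k f = go (ℕ.≤⇒≤′ j≤k) f
    where
    go : ∀ {k} → j ℕ.≤′ k → F k x → F j x
    go ℕ.≤′-refl     f = f
    go (ℕ.≤′-step l) f = go l (F-pred f)

  F-0 : ∀ {k} → F k 0#
  F-0 {k} = F-resp (trans (*-congʳ refl) (zeroˡ _)) (F-*ˡ (F-ℤ (+ 0)) (F-p^ k))

  F-1 : F 0 1#
  F-1 = F-resp fromℤ-1 (F-ℤ (+ 1))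

  F-sum : ∀ {k n} (v : Vector Carrier n) → (∀ i → F k (v i)) → F k (sum v)
  F-sum {n = zero}  v f = F-0
  F-sum {n = suc n} v f = F-+ (f zero) (F-sum (v ∘ suc) (f ∘ suc))

  F-^ : ∀ {x} → F 0 x → ∀ n → F 0 (x ^ n)
  F-^ f zero    = F-1
  F-^ f (suc n) = F-*ˡ f (F-^ f n)

  ∣⇒F : ∀ {k z} → (+ p) ℤ.^ k ∣ z → F k (fromℤ z)
  ∣⇒F {k} (divides q ≡.refl) = F-resp (sym (fromℤ-* q _)) (F-*ˡ (F-ℤ q) (F-p^ k))

  F-p^⁻ : ∀ j {k x} → F (j ℕ.+ k) (fromℤ ((+ p) ℤ.^ j) * x) → F k x
  F-p^⁻ zero    f = F-resp (trans (*-congʳ fromℤ-1) (*-identityˡ _)) f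
  F-p^⁻ (suc j) f = F-p^⁻ j (F-p⁻ (F-resp (trans (*-congʳ (fromℤ-* (+ p) _)) (*-assoc _ _ _)) f))

  bounded-by : ∀ {c e x} → c ℕ.≤ e → F 0 (fromℤ ((+ p) ℤ.^ c) * x) → F 0 (fromℤ ((+ p) ℤ.^ e) * x)
  bounded-by {c} {e} {x} c≤e f = F-resp
    (trans (sym (*-assoc _ _ _)) (*-congʳ (trans (sym (fromℤ-* ((+ p) ℤ.^ (e ℕ.∸ c)) ((+ p) ℤ.^ c))) (reflexive (≡.cong fromℤ
      (≡.trans (≡.sym (ℤ.^-distribˡ-+-* (+ p) (e ℕ.∸ c) c)) (≡.cong ((+ p) ℤ.^_) (ℕ.m∸n+n≡m c≤e))))))))
    (F-*ˡ (F-ℤ ((+ p) ℤ.^ (e ℕ.∸ c))) f)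

  -- A negative power of p could hide in x, so x is first bounded: pᶜ x ∈ ℤₚ. With u s + v pᵏ⁺ᶜ = 1
  -- one has x = u (s x) + v pᵏ (pᶜ x), and both terms lie in pᵏℤₚ.
  F-unit : ∀ {s k x} → ¬ + p ∣ s → F k (fromℤ s * x) → F k x
  F-unit {s} {k} {x} p∤s f with bounded x
  ... | c , g with bezout-^ p-prime s p∤s (k ℕ.+ c)
  ...   | u , v , e = F-resp (begin
      fromℤ u * (fromℤ s * x) + fromℤ v * (fromℤ ((+ p) ℤ.^ k) * (fromℤ ((+ p) ℤ.^ c) * x))
        ≈⟨ solve 6 (λ u s x v a b → u :* (s :* x) :+ v :* (a :* (b :* x)) := (u :* s :+ v :* (a :* b)) :* x)
             refl _ _ x _ _ _ ⟩
      (fromℤ u * fromℤ s + fromℤ v * (fromℤ ((+ p) ℤ.^ k) * fromℤ ((+ p) ℤ.^ c))) * x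
        ≈⟨ *-congʳ (+-cong (fromℤ-* u s) (trans (fromℤ-* v _) (*-congˡ (trans
             (reflexive (≡.cong fromℤ (ℤ.^-distribˡ-+-* (+ p) k c))) (fromℤ-* ((+ p) ℤ.^ k) _))))) ⟨
      (fromℤ (u ℤ.* s) + fromℤ (v ℤ.* (+ p) ℤ.^ (k ℕ.+ c))) * x
        ≈⟨ *-congʳ (trans (sym (fromℤ-+ (u ℤ.* s) _)) (reflexive (≡.cong fromℤ e))) ⟩
      fromℤ (+ 1) * x  ≈⟨ trans (*-congʳ fromℤ-1) (*-identityˡ x) ⟩
      x ∎)
    (F-+ (F-*ˡ (F-ℤ u) f) (F-*ˡ (F-ℤ v) (≡.subst (λ i → F i (fromℤ ((+ p) ℤ.^ k) * (fromℤ ((+ p) ℤ.^ c) * x))) (ℕ.+-identityʳ k) (F-* (F-p^ k) g))))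

  -- For an integer r with x - r ∈ pᵏℤₚ, the question is whether pᵏ divides r.
  F? : ∀ {x} → F 0 x → ∀ k → Dec (F k x)
  F? {x} f k with approx f k
  ... | r , g = map′
    (λ d → F-resp (solve 2 (λ x r → (x :- r) :+ r := x) refl x (fromℤ r)) (F-+ g (∣⇒F d)))
    (λ h → F⇒∣ (F-resp (solve 2 (λ x r → x :- (x :- r) := r) refl x (fromℤ r)) (F-minus h g)))
    (((+ p) ℤ.^ k) ℤ∣.∣? r)

mkHom : (R S : Ring₀) {h : ∣R∣ R → ∣R∣ S} → let module R = CommutativeRing R; module S = CommutativeRing S in
  (∀ {x y} → x R.≈ y → h x S.≈ h y) → (∀ x y → h (x R.+ y) S.≈ h x S.+ h y) →
  (∀ x y → h (x R.* y) S.≈ h x S.* h y) → h R.1# S.≈ S.1# → IsHom R S h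
mkHom R S {h} h-cong h-+ h-* h-1 = record
  { isSemiringHomomorphism = record
    { isNearSemiringHomomorphism = record
      { +-isMonoidHomomorphism = record
        { isMagmaHomomorphism = record { isRelHomomorphism = record { cong = h-cong } ; homo = h-+ }
        ; ε-homo = h-0 }
      ; *-homo = h-* }
    ; 1#-homo = h-1 }
  ; -‿homo = h-neg }
  where
  module R = RingOps R
  open RingOps S
  open RingProperties ring using (-‿involutive)
  h-0 : h R.0# ≈ 0#
  h-0 = begin
    h R.0#                        ≈⟨ solve 1 (λ x → x := (x :+ x) :- x) refl (h R.0#) ⟩
    (h R.0# + h R.0#) - h R.0#    ≈⟨ +-congʳ (h-+ R.0# R.0#) ⟨
    h (R.0# R.+ R.0#) - h R.0#    ≈⟨ +-congʳ (h-cong (R.+-identityˡ R.0#)) ⟩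
    h R.0# - h R.0#               ≈⟨ -‿inverseʳ _ ⟩
    0#                            ∎
  h-neg : ∀ x → h (R.- x) ≈ - h x
  h-neg x = begin
    h (R.- x)                ≈⟨ solve 2 (λ x y → y := (y :+ x) :- x) refl (h x) (h (R.- x)) ⟩
    (h (R.- x) + h x) - h x  ≈⟨ +-congʳ (h-+ (R.- x) x) ⟨
    h (R.- x R.+ x) - h x    ≈⟨ +-congʳ (trans (h-cong (R.-‿inverseˡ x)) h-0) ⟩
    0# - h x                 ≈⟨ +-identityˡ _ ⟩
    - h x                    ∎

-- ℚₚ as the localisation of ℤₚ, with its valuation

module Localisation (R : Ring₀) (S : Submonoid R) where
  private
    module R = RingOps R
    module S = Submonoid S
    module Q = RingOps (localisation S)

  j : R.Carrier → Fraction S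
  j a = fraction a R.1# S.1∈

  private
    exact : ∀ x y → let open Fraction in num x R.* den y R.≈ num y R.* den x → x Q.≈ y
    exact x y e = R.1# , S.1∈ , R.*-congˡ e

  j-hom : IsHom R (localisation S) j
  j-hom = mkHom R (localisation S)
    (λ {x} {y} e → exact (j x) (j y) (R.*-congʳ e))
    (λ x y → exact (j (x R.+ y)) (j x Q.+ j y)
      (R.solve 3 (λ x y o → (x R.:+ y) R.:* (o R.:* o) R.:= (x R.:* o R.:+ y R.:* o) R.:* o) R.refl x y R.1#))
    (λ x y → exact (j (x R.* y)) (j x Q.* j y)
      (R.*-congˡ (R.*-identityˡ R.1#)))
    (Q.refl {Q.1#})

  j-cancel : ∀ {a b} → j a Q.≈ j b → Σ[ s ∈ R.Carrier ] S.subset s × s R.* a R.≈ s R.* b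
  j-cancel {a} {b} (s , s∈ , e) = s , s∈ ,
    R.trans (R.*-congˡ (R.sym (R.*-identityʳ a))) (R.trans e (R.*-congˡ (R.*-identityʳ b)))

  j-den : ∀ x → j (Fraction.den x) Q.* x Q.≈ j (Fraction.num x)
  j-den x = exact (j (Fraction.den x) Q.* x) (j (Fraction.num x))
    (R.solve 3 (λ n d o → (d R.:* n) R.:* o R.:= n R.:* (o R.:* d)) R.refl (Fraction.num x) (Fraction.den x) R.1#)

  j-inverse : ∀ s → S.subset s → Σ[ y ∈ Fraction S ] j s Q.* y Q.≈ Q.1#
  j-inverse s s∈ = fraction R.1# s s∈ , exact (j s Q.* fraction R.1# s s∈) Q.1#
    (R.solve 2 (λ s o → (s R.:* o) R.:* o R.:= o R.:* (o R.:* s)) R.refl s R.1#)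

-- The subring ℤₚ of ℚₚ, abstractly.
record IntegerRing (p : ℕ) (Z : Ring₀) : Set₁ where
  open CommutativeRing Z using (Carrier; _≈_; _*_; _-_; 1#)
  field
    c         : ℤ → Carrier
    c-hom     : IsHom ℤ-ring Z c
    cancel    : ∀ d → d ≢ + 0 → ∀ a b → c d * a ≈ c d * b → a ≈ b
    residue   : ∀ k a → Σ[ r ∈ ℤ ] Σ[ b ∈ Carrier ] a - c r ≈ c ((+ p) ℤ.^ k) * b
    reflect-∣ : ∀ {k z a} → c z ≈ c ((+ p) ℤ.^ k) * a → (+ p) ℤ.^ k ∣ z
    unit      : ∀ s → ¬ + p ∣ s → Σ[ u ∈ Carrier ] c s * u ≈ 1#

module ValuedFrom {p : ℕ} (p-prime : Prime p) {Z : Ring₀} (I : IntegerRing p Z)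
  {Q : Ring₀} {j : ∣R∣ Z → ∣R∣ Q} (j-hom : IsHom Z Q j)
  (j-inj : ∀ {a b} → CommutativeRing._≈_ Q (j a) (j b) → CommutativeRing._≈_ Z a b)
  (j-den : ∀ x → Σ[ d ∈ ℤ ] Σ[ s ∈ ∣R∣ Z ] Σ[ a ∈ ∣R∣ Z ] d ≢ + 0 ×
    CommutativeRing._≈_ Z s (IntegerRing.c I d) ×
    CommutativeRing._≈_ Q (CommutativeRing._*_ Q (j s) x) (j a))
  (j-inverse : ∀ d → d ≢ + 0 → Σ[ y ∈ ∣R∣ Q ]
    CommutativeRing._≈_ Q (CommutativeRing._*_ Q (j (IntegerRing.c I d)) y) (CommutativeRing.1# Q)) where
  open IntegerRing I hiding (cancel)
  private
    module Z = RingOps Z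
    module j = Hom {Z} {Q} {j} j-hom
    open RingOps Q

    P^ : ℕ → ℤ
    P^ k = (+ p) ℤ.^ k

    jc : ∀ z → j (c z) ≈ fromℤ z
    jc z = trans (j.⟦⟧-cong (ℤ-hom-unique Z c-hom z)) (j.h-fromℤ z)

    fractions : ∀ x → Σ[ d ∈ ℤ ] Σ[ a ∈ Z.Carrier ] d ≢ + 0 × fromℤ d * x ≈ j a
    fractions x with j-den x
    ... | d , s , a , d≢0 , s≈d , e = d , a , d≢0 ,
      trans (*-congʳ (sym (trans (j.⟦⟧-cong s≈d) (jc d)))) e

    inverses : ∀ d → d ≢ + 0 → Σ[ y ∈ Carrier ] fromℤ d * y ≈ 1#
    inverses d d≢0 with j-inverse d d≢0
    ... | y , e = y , trans (*-congʳ (sym (jc d))) e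

    F : ℕ → Pred (∣R∣ Q) 0ℓ
    F k x = Σ[ a ∈ Z.Carrier ] x ≈ fromℤ (P^ k) * j a

    j-p : ∀ k a → j (c (P^ k) Z.* a) ≈ fromℤ (P^ k) * j a
    j-p k a = trans (j.*-homo _ a) (*-congʳ (jc (P^ k)))

    F-0⁺ : ∀ a → F 0 (j a)
    F-0⁺ a = a , sym (trans (*-congʳ fromℤ-1) (*-identityˡ _))

    -- In a denominator d = pᶠ d′ with p ∤ d′ the factor d′ has an inverse u in ℤₚ, so pᶠ x = u a is
    -- integral.
    bounded : ∀ x → ∃[ f ] F 0 (fromℤ (P^ f) * x)
    bounded x with fractions x
    ... | d , a , d≢0 , e with valuation p-prime d d≢0
    ...   | f , d′ , ≡.refl , p∤d′ with unit d′ p∤d′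
    ...     | u , du≈1 = f , resp (sym (begin
        fromℤ (P^ f) * x
          ≈⟨ trans (*-congʳ (trans (sym (j.*-homo _ u)) (trans (j.⟦⟧-cong du≈1) j.1#-homo))) (*-identityˡ _) ⟨
        (j (c d′) * j u) * (fromℤ (P^ f) * x)
          ≈⟨ *-congʳ (*-congʳ (jc d′)) ⟩
        (fromℤ d′ * j u) * (fromℤ (P^ f) * x)
          ≈⟨ solve 4 (λ d u c x → (d :* u) :* (c :* x) := u :* ((c :* d) :* x)) refl _ (j u) _ x ⟩
        j u * ((fromℤ (P^ f) * fromℤ d′) * x)
          ≈⟨ *-congˡ (*-congʳ (fromℤ-* (P^ f) d′)) ⟨
        j u * (fromℤ (P^ f ℤ.* d′) * x)   ≈⟨ *-congˡ e ⟩
        j u * j a                         ≈⟨ j.*-homo u a ⟨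
        j (u Z.* a)                       ∎)) (F-0⁺ (u Z.* a))
      where
      resp : ∀ {x y} → x ≈ y → F 0 x → F 0 y
      resp x≈y (a , e) = a , trans (sym x≈y) e

  valued : Valued p Q
  valued = record
    { F        = F
    ; F-resp   = λ x≈y (a , e) → a , trans (sym x≈y) e
    ; F-+      = λ (a , e) (b , f) → a Z.+ b ,
        trans (+-cong e f) (trans (sym (distribˡ _ _ _)) (*-congˡ (sym (j.+-homo a b))))
    ; F-*      = λ {j} {k} (a , e) (b , f) → a Z.* b , trans (*-cong e f) (trans
        (solve 4 (λ p q a b → (p :* a) :* (q :* b) := (p :* q) :* (a :* b)) refl _ _ _ _)
        (*-cong (trans (sym (fromℤ-* (P^ j) (P^ k))) (reflexive (≡.cong fromℤ (≡.sym (ℤ.^-distribˡ-+-* (+ p) j k)))))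
                (sym (j.*-homo a b))))
    ; F-p^     = λ k → Z.1# , sym (trans (*-congˡ j.1#-homo) (*-identityʳ _))
    ; F-ℤ      = λ z → c z , trans (sym (jc z)) (proj₂ (F-0⁺ _))
    ; F-pred   = λ {k} (a , e) → c (+ p) Z.* a , trans e (trans (*-congʳ (fromℤ-* (+ p) (P^ k)))
        (trans (solve 3 (λ p q a → (p :* q) :* a := q :* (p :* a)) refl _ _ _)
          (*-congˡ (sym (trans (j.*-homo _ a) (*-congʳ (jc (+ p))))))))
    ; approx   = λ {x} (a , e) k → let r , b , f = residue k a in r , b ,
        trans (+-cong (trans e (sym (proj₂ (F-0⁺ a)))) (-‿cong (sym (jc r))))
          (trans (sym (j.h-minus a _)) (trans (j.⟦⟧-cong f) (j-p k b)))
    ; F⇒∣      = λ {k} {z} (a , e) → reflect-∣ {k} (j-inj (trans (jc z) (trans e (sym (j-p k a)))))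
    ; bounded  = bounded
    ; inverses = inverses
    ; F-p⁻     = λ {k} (a , e) → a , unit-cancel (inverses (+ p) (λ eq → pow≢0 p-prime 1 (≡.cong (ℤ._* + 1) eq)))
        (trans e (trans (*-congʳ (fromℤ-* (+ p) (P^ k))) (*-assoc _ _ _)))
    }

module IntegerLocalisation {p : ℕ} {Z : Ring₀} (I : IntegerRing p Z) (S : Submonoid Z)
  (S⇒ : ∀ {x} → Submonoid.subset S x →
    Σ[ d ∈ ℤ ] d ≢ + 0 × CommutativeRing._≈_ Z x (IntegerRing.c I d))
  (⇒S : ∀ d → d ≢ + 0 → Submonoid.subset S (IntegerRing.c I d)) where
  open Localisation Z S
  private
    module Z = RingOps Z
    module Q = CommutativeRing (localisation S)

  -- Only images of nonzero integers are inverted, and these cancel in ℤₚ.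
  j-inj : ∀ {a b} → j a Q.≈ j b → a Z.≈ b
  j-inj {a} {b} e with j-cancel {a} {b} e
  ... | s , s∈ , f with S⇒ s∈
  ...   | d , d≢0 , s≈d = IntegerRing.cancel I d d≢0 a b
    (Z.trans (Z.*-congʳ (Z.sym s≈d)) (Z.trans f (Z.*-congʳ s≈d)))

  denominators : ∀ x → Σ[ d ∈ ℤ ] Σ[ s ∈ Z.Carrier ] Σ[ a ∈ Z.Carrier ] d ≢ + 0 ×
    s Z.≈ IntegerRing.c I d × j s Q.* x Q.≈ j a
  denominators x with S⇒ (Fraction.den∈S x)
  ... | d , d≢0 , den≈d = d , Fraction.den x , Fraction.num x , d≢0 , den≈d , j-den x

  denominator-inverse : ∀ d → d ≢ + 0 → Σ[ y ∈ Fraction S ] j (IntegerRing.c I d) Q.* y Q.≈ Q.1#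
  denominator-inverse d d≢0 = j-inverse (IntegerRing.c I d) (⇒S d d≢0)

module PAdic {p : ℕ} (p-prime : Prime p) where
  private
    ℤₚ : Ring₀
    ℤₚ = ℤ[ p ]
    ⟨p⟩ : Ideal ℤ-ring
    ⟨p⟩ = principal (+ p)
    module Z = RingOps ℤₚ
  open Adic
  open Ideal using (member)

  private
    P^ : ℕ → ℤ
    P^ k = (+ p) ℤ.^ k

    P^-+ : ∀ j k → P^ (j ℕ.+ k) ≡ P^ j ℤ.* P^ k
    P^-+ = ℤ.^-distribˡ-+-* (+ p)

    instance
      P-nonZero : ∀ {k} → ℤ.NonZero (P^ k)
      P-nonZero {k} = ℤ.≢-nonZero (pow≢0 p-prime k)

  ⟨p⟩^⇒∣ : ∀ k {x} → member (⟨p⟩ ^ᴵ k) x → P^ k ∣ x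
  ⟨p⟩^⇒∣ zero    {x} _ = divides x (≡.sym (ℤ.*-identityʳ x))
  ⟨p⟩^⇒∣ (suc k) m = go m
    where
    go : ∀ {x} → ProductMember ⟨p⟩ (⟨p⟩ ^ᴵ k) x → P^ (suc k) ∣ x
    go (nil ≡.refl) = divides (+ 0) ≡.refl
    go (cons {a} {b} (r , ≡.refl) b∈ s ≡.refl) with ⟨p⟩^⇒∣ k b∈
    ... | divides q ≡.refl = ℤ∣.∣m∣n⇒∣m+n (divides (r ℤ.* q)
      (solve 4 (λ r p q t → (r :* p) :* (q :* t) := (r :* q) :* (p :* t)) ≡.refl r (+ p) q (P^ k))) (go s)
      where open ℤSolver.+-*-Solver

  ∣⇒⟨p⟩^ : ∀ k {x} → P^ k ∣ x → member (⟨p⟩ ^ᴵ k) x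
  ∣⇒⟨p⟩^ zero    _ = _
  ∣⇒⟨p⟩^ (suc k) (divides q ≡.refl) = cons {a = + p} {b = q ℤ.* P^ k}
    (+ 1 , ≡.sym (ℤ.*-identityˡ _)) (∣⇒⟨p⟩^ k (divides q ≡.refl)) (nil ≡.refl)
    (solve 3 (λ q p t → q :* (p :* t) := p :* (q :* t) :+ con (+ 0)) ≡.refl q (+ p) (P^ k))
    where open ℤSolver.+-*-Solver

  coherent-+ : ∀ (a : Adic ⟨p⟩) n k → P^ n ∣ residue a (k ℕ.+ n) ℤ.- residue a n
  coherent-+ a n zero    = divides (+ 0) (ℤ.+-inverseʳ (residue a n))
  coherent-+ a n (suc k) = ≡.subst (P^ n ∣_)
    (solve 3 (λ x y z → (x :- y) :+ (y :- z) := x :- z) ≡.refl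
      (residue a (suc k ℕ.+ n)) (residue a (k ℕ.+ n)) (residue a n))
    (ℤ∣.∣m∣n⇒∣m+n (ℤ∣.∣-trans (divides (P^ k) (P^-+ k n)) (⟨p⟩^⇒∣ (k ℕ.+ n) (coherent a (k ℕ.+ n))))
      (coherent-+ a n k))
    where open ℤSolver.+-*-Solver

  private
    c : ℤ → Adic ⟨p⟩
    c = toCompletion ⟨p⟩

    c-cong : ∀ {x y} → x ≡ y → c x Z.≈ c y
    c-cong e n = mod-reflexive (⟨p⟩ ^ᴵ n) e

    c-hom : IsHom ℤ-ring ℤₚ c
    c-hom = mkHom ℤ-ring ℤₚ (λ {x} {y} → c-cong {x} {y}) (λ x y → Z.refl {c (x ℤ.+ y)})
      (λ x y → Z.refl {c (x ℤ.* y)}) (Z.refl {Z.1#})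

  private
    -- Dividing by pᵏ costs k digits: residue n of the quotient comes from residue k + n of `a`.
    quotient-adic : ∀ k (a : Adic ⟨p⟩) (q : ℕ → ℤ) → (∀ n → residue a (k ℕ.+ n) ≡ q n ℤ.* P^ k) →
      Σ[ b ∈ Adic ⟨p⟩ ] a Z.≈ c (P^ k) Z.* b
    quotient-adic k a q e = b , λ n → ∣⇒⟨p⟩^ n (≡.subst (P^ n ∣_) (eq n) (ℤ∣.∣m⇒∣-m (coherent-+ a n k)))
      where
      open ℤSolver.+-*-Solver
      b : Adic ⟨p⟩
      b .residue n  = q n
      b .coherent n = ∣⇒⟨p⟩^ n (ℤ∣.*-cancelˡ-∣ (P^ k) {P^ n} {{P-nonZero {k}}} (≡.subst₂ _∣_ (P^-+ k n)
        (≡.trans (≡.cong₂ ℤ._-_ (≡.trans (≡.cong (residue a) (≡.sym (ℕ.+-suc k n))) (e (suc n))) (e n))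
          (solve 3 (λ x y t → x :* t :- y :* t := t :* (x :- y)) ≡.refl (q (suc n)) (q n) (P^ k)))
        (⟨p⟩^⇒∣ (k ℕ.+ n) (coherent a (k ℕ.+ n)))))
      eq : ∀ n → ℤ.- (residue a (k ℕ.+ n) ℤ.- residue a n) ≡ residue a n ℤ.- P^ k ℤ.* q n
      eq n = ≡.trans (solve 2 (λ x y → :- (x :- y) := y :- x) ≡.refl (residue a (k ℕ.+ n)) (residue a n))
        (≡.cong (λ t → residue a n ℤ.- t) (≡.trans (e n) (ℤ.*-comm (q n) (P^ k))))

  divide-^ : ∀ k (a : Adic ⟨p⟩) → P^ k ∣ residue a k → Σ[ b ∈ Adic ⟨p⟩ ] a Z.≈ c (P^ k) Z.* b
  divide-^ k a d = quotient-adic k a (λ n → _∣_.quotient (quot n)) (λ n → _∣_.equality (quot n))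
    where
    open ℤSolver.+-*-Solver
    quot : ∀ n → P^ k ∣ residue a (k ℕ.+ n)
    quot n = ≡.subst (P^ k ∣_)
      (solve 2 (λ x y → (x :- y) :+ y := x) ≡.refl (residue a (k ℕ.+ n)) (residue a k))
      (ℤ∣.∣m∣n⇒∣m+n (≡.subst (λ i → P^ k ∣ residue a i ℤ.- residue a k) (ℕ.+-comm n k) (coherent-+ a k n)) d)

  private
    -- The inverses of s modulo the various pⁿ are found independently of each other; they are
    -- coherent because s cancels modulo pⁿ.
    inverse-adic : ∀ s → ¬ + p ∣ s → (u : ℕ → ℤ) → (∀ n → P^ n ∣ s ℤ.* u n ℤ.- + 1) →
      Σ[ u ∈ Adic ⟨p⟩ ] c s Z.* u Z.≈ Z.1#
    inverse-adic s p∤s u inv = record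
      { residue  = u
      ; coherent = λ n → ∣⇒⟨p⟩^ n (^-∣-cancel p-prime s p∤s n (u (suc n) ℤ.- u n) (≡.subst (P^ n ∣_)
          (solve 3 (λ s x y → (s :* x :- con (+ 1)) :- (s :* y :- con (+ 1)) := s :* (x :- y)) ≡.refl s (u (suc n)) (u n))
          (ℤ∣.∣m∣n⇒∣m-n (ℤ∣.∣-trans (divides (+ p) ≡.refl) (inv (suc n))) (inv n))))
      } , λ n → ∣⇒⟨p⟩^ n (inv n)
      where open ℤSolver.+-*-Solver

  unit-inverse : ∀ s → ¬ + p ∣ s → Σ[ u ∈ Adic ⟨p⟩ ] c s Z.* u Z.≈ Z.1#
  unit-inverse s p∤s = inverse-adic s p∤s (λ n → proj₁ (bezout-^ p-prime s p∤s n)) inv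
    where
    open ℤSolver.+-*-Solver
    inv : ∀ n → P^ n ∣ s ℤ.* proj₁ (bezout-^ p-prime s p∤s n) ℤ.- + 1
    inv n with bezout-^ p-prime s p∤s n
    ... | u , v , e = divides (ℤ.- v) (≡.trans (≡.cong (λ t → s ℤ.* u ℤ.- t) (≡.sym e))
      (solve 4 (λ s u v t → s :* u :- (u :* s :+ v :* t) := (:- v) :* t) ≡.refl s u v (P^ n)))

  -- Modulo pᵏ⁺ⁿ the factor pᵏ of d can be cancelled and a congruence modulo pⁿ remains; so residue
  -- n is compared by way of residue k + n.
  ℤₚ-cancel : ∀ d → d ≢ + 0 → ∀ a b → c d Z.* a Z.≈ c d Z.* b → a Z.≈ b
  ℤₚ-cancel d d≢0 a b e with valuation p-prime d d≢0
  ... | k , d′ , ≡.refl , p∤d′ = λ n → ∣⇒⟨p⟩^ n (≡.subst (P^ n ∣_)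
      (solve 4 (λ x y x′ y′ → (x :- y) :- (x :- x′) :+ (y :- y′) := x′ :- y′) ≡.refl
        (residue a (k ℕ.+ n)) (residue b (k ℕ.+ n)) (residue a n) (residue b n))
      (ℤ∣.∣m∣n⇒∣m+n (ℤ∣.∣m∣n⇒∣m-n (main n) (coherent-+ a n k)) (coherent-+ b n k)))
    where
    open ℤSolver.+-*-Solver
    main : ∀ n → P^ n ∣ residue a (k ℕ.+ n) ℤ.- residue b (k ℕ.+ n)
    main n = ^-∣-cancel p-prime d′ p∤d′ n (residue a (k ℕ.+ n) ℤ.- residue b (k ℕ.+ n)) (ℤ∣.*-cancelˡ-∣ (P^ k) {P^ n} {{P-nonZero {k}}} (≡.subst₂ _∣_ (P^-+ k n)
      (solve 4 (λ t d x y → (t :* d) :* x :- (t :* d) :* y := t :* (d :* (x :- y))) ≡.refl (P^ k) d′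
        (residue a (k ℕ.+ n)) (residue b (k ℕ.+ n)))
      (⟨p⟩^⇒∣ (k ℕ.+ n) (e (k ℕ.+ n)))))

  private
    residue-c : ∀ k a → Σ[ r ∈ ℤ ] Σ[ b ∈ Adic ⟨p⟩ ] a Z.- c r Z.≈ c (P^ k) Z.* b
    residue-c k a = residue a k , divide-^ k (a Z.- c (residue a k)) (divides (+ 0) (ℤ.+-inverseʳ (residue a k)))

    reflect : ∀ {k z} a → c z Z.≈ c (P^ k) Z.* a → P^ k ∣ z
    reflect {k} {z} a e = ≡.subst (P^ k ∣_)
      (solve 2 (λ z t → (z :- t) :+ t := z) ≡.refl z (P^ k ℤ.* residue a k))
      (ℤ∣.∣m∣n⇒∣m+n (⟨p⟩^⇒∣ k (e k)) (divides (residue a k) (ℤ.*-comm (P^ k) (residue a k))))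
      where open ℤSolver.+-*-Solver

    integerRing : IntegerRing p ℤₚ
    integerRing = record
      { c         = c
      ; c-hom     = c-hom
      ; cancel    = ℤₚ-cancel
      ; residue   = residue-c
      ; reflect-∣ = λ {k} {z} {a} → reflect {k} {z} a
      ; unit      = unit-inverse
      }

    module L = IntegerLocalisation integerRing (nonzeroIntegers p) id (λ d d≢0 → d , d≢0 , Z.refl {c d})
    open Localisation ℤₚ (nonzeroIntegers p) using (j; j-hom)

  ℚₚ-valued : Valued p (_-Algebra.ring ℚ[ p ])
  ℚₚ-valued = ValuedFrom.valued p-prime integerRing {_-Algebra.ring ℚ[ p ]} {j} j-hom
    (λ {a} {b} → L.j-inj {a} {b}) L.denominators L.denominator-inverse

-- Integral elements

module _ (R : Ring₀) where
  open RingOps R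

  -- Elements of the form eᵢ = cᵢ + x eᵢ₊₁: integer polynomials in x of degree less than d.
  data Low (x : Carrier) : ℕ → Carrier → Set where
    nil  : ∀ {e} → e ≈ 0# → Low x zero e
    cons : ∀ {d e l} c → Low x d l → e ≈ fromℤ c + x * l → Low x (suc d) e

  module _ {x : Carrier} where

    low-resp : ∀ {d e f} → e ≈ f → Low x d e → Low x d f
    low-resp e≈f (nil p)      = nil (trans (sym e≈f) p)
    low-resp e≈f (cons c l p) = cons c l (trans (sym e≈f) p)

    low-0 : ∀ d → Low x d 0#
    low-0 zero    = nil refl
    low-0 (suc d) = cons (+ 0) (low-0 d) (sym (trans (+-identityˡ _) (zeroʳ x)))

    low-+ : ∀ {d e f} → Low x d e → Low x d f → Low x d (e + f)
    low-+ (nil p) (nil q) = nil (trans (+-cong p q) (+-identityˡ 0#))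
    low-+ (cons {l = l} c low p) (cons {l = m} k low′ q) = cons (c ℤ.+ k) (low-+ low low′)
      (trans (+-cong p q) (trans
        (solve 5 (λ c k x l m → (c :+ x :* l) :+ (k :+ x :* m) := (c :+ k) :+ x :* (l :+ m)) refl _ _ x l m)
        (+-congʳ (sym (fromℤ-+ c k)))))

    low-scale : ∀ {d e} k → Low x d e → Low x d (fromℤ k * e)
    low-scale k (nil p) = nil (trans (*-congˡ p) (zeroʳ _))
    low-scale k (cons {l = l} c low p) = cons (k ℤ.* c) (low-scale k low)
      (trans (*-congˡ p) (trans
        (solve 4 (λ k c x l → k :* (c :+ x :* l) := k :* c :+ x :* (k :* l)) refl _ _ x l)
        (+-congʳ (sym (fromℤ-* k c)))))

    low-shift : ∀ {d e} → Low x d e → Low x (suc d) (x * e)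
    low-shift l = cons (+ 0) l (sym (+-identityˡ _))

    low-suc : ∀ {d e} → Low x d e → Low x (suc d) e
    low-suc (nil p)      = low-resp (sym p) (low-0 1)
    low-suc (cons c l p) = cons c (low-suc l) p

    low-≤ : ∀ {c d e} → c ℕ.≤ d → Low x c e → Low x d e
    low-≤ {c} {d} {e} c≤d l = go (ℕ.≤⇒≤′ c≤d)
      where
      go : ∀ {d} → c ℕ.≤′ d → Low x d e
      go ℕ.≤′-refl      = l
      go (ℕ.≤′-step le) = low-suc (go le)

    low-x^ : ∀ k → Low x (suc k) (x ^ k)
    low-x^ zero    = cons (+ 1) (nil refl) (sym (trans (+-cong fromℤ-1 (zeroʳ x)) (+-identityʳ 1#)))
    low-x^ (suc k) = low-shift (low-x^ k)

    low-sum : ∀ {d n} (v : Vector Carrier n) → (∀ i → Low x d (v i)) → Low x d (sum v)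
    low-sum {d} {zero}  v l = low-0 d
    low-sum {d} {suc n} v l = low-+ (l zero) (low-sum (v ∘ suc) (l ∘ suc))

    low⇒integral : ∀ {d l} → Low x d l → x ^ d + l ≈ 0# → Integral R x
    low⇒integral {d} {l} low e = d , proj₁ (coefficients low) , trans (+-congˡ (sym (proj₂ (coefficients low)))) e
      where
      coefficients : ∀ {d l} → Low x d l → Σ[ c ∈ Vector ℤ d ] l ≈ sum (λ i → fromℤ (c i) * x ^ toℕ i)
      coefficients (nil p) = (λ ()) , p
      coefficients (cons c low p) with coefficients low
      ... | cs , q = (λ { zero → c ; (suc i) → cs i }) ,
        trans p (+-cong (sym (*-identityʳ _)) (trans (*-congˡ q) (trans (*-distribˡ-sum x (λ i → fromℤ (cs i) * x ^ toℕ i))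
          (sum-cong-≋ (λ i → solve 3 (λ x c y → x :* (c :* y) := c :* (x :* y)) refl x (fromℤ (cs i)) (x ^ toℕ i))))))

  -- Substituting y = x² - s x into a monic equation of degree d for y gives one of degree 2 d for
  -- x; `power` separates the leading term of yᵏ.
  integral-quadratic : ∀ x s {y} → Integral R y → x * x - fromℤ s * x ≈ y → Integral R x
  integral-quadratic x s {y} (d , c , p) eq = low⇒integral {x} {d ℕ.+ d} (low-+ (proj₁ (proj₂ (power d))) low-rest)
    (trans (sym (+-assoc _ _ _)) (trans (+-congʳ (sym (proj₂ (proj₂ (power d))))) p))
    where
    power : ∀ k → Σ[ l ∈ Carrier ] Low x (k ℕ.+ k) l × y ^ k ≈ x ^ (k ℕ.+ k) + l
    power zero = 0# , nil refl , sym (+-identityʳ 1#)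
    power (suc k) with power k
    ... | l , low , e = x * (x * l) + (fromℤ (ℤ.- s) * (x * x ^ (k ℕ.+ k)) + fromℤ (ℤ.- s) * (x * l)) ,
      ≡.subst (λ m → Low x (suc m) (x * (x * l) + (fromℤ (ℤ.- s) * (x * x ^ (k ℕ.+ k)) + fromℤ (ℤ.- s) * (x * l)))) (≡.sym (ℕ.+-suc k k))
        (low-+ (low-shift (low-shift low))
          (low-+ (low-scale (ℤ.- s) (low-shift (low-x^ (k ℕ.+ k)))) (low-scale (ℤ.- s) (low-suc (low-shift low))))) ,
      (begin
        y * y ^ k                                         ≈⟨ *-cong (sym eq) e ⟩
        (x * x - fromℤ s * x) * (x ^ (k ℕ.+ k) + l)
          ≈⟨ solve 4 (λ x s z l → (x :* x :- s :* x) :* (z :+ l) :=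
               x :* (x :* z) :+ (x :* (x :* l) :+ ((:- s) :* (x :* z) :+ (:- s) :* (x :* l)))) refl x _ _ l ⟩
        x * (x * x ^ (k ℕ.+ k)) + (x * (x * l) + (- fromℤ s * (x * x ^ (k ℕ.+ k)) + - fromℤ s * (x * l)))
          ≈⟨ +-cong (reflexive (≡.cong (λ m → x * x ^ m) (ℕ.+-suc k k)))
               (+-congˡ (+-cong (*-congʳ (fromℤ-neg s)) (*-congʳ (fromℤ-neg s)))) ⟨
        x * x ^ (k ℕ.+ suc k) + (x * (x * l) + (fromℤ (ℤ.- s) * (x * x ^ (k ℕ.+ k)) + fromℤ (ℤ.- s) * (x * l))) ∎)
    low-rest : Low x (d ℕ.+ d) (sum (λ i → fromℤ (c i) * y ^ toℕ i))
    low-rest = low-sum _ λ i → low-scale (c i) (low-term i)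
      where
      low-term : ∀ i → Low x (d ℕ.+ d) (y ^ toℕ i)
      low-term i with power (toℕ i)
      ... | l , low , e = low-resp (sym e) (low-+ (low-≤ (ℕ.+-mono-≤ (toℕ<n i) (ℕ.<⇒≤ (toℕ<n i))) (low-x^ _))
        (low-≤ (ℕ.+-mono-≤ (ℕ.<⇒≤ (toℕ<n i)) (ℕ.<⇒≤ (toℕ<n i))) low))

  -- The equation is multiplied by tᵈ. The coefficient tᵈ⁻ⁱ aᵢ is kept as (t aᵢ) tᵈ⁻ⁱ⁻¹: the single
  -- factor t either clears the denominator of aᵢ (`integral-scaled`) or is pulled out of the sum
  -- (`integral-multiple`).
  scale-equation : ∀ {d} (a : Vector Carrier d) t x → x ^ d + sum (λ i → a i * x ^ toℕ i) ≈ 0# →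
    (t * x) ^ d + sum (λ i → (t * a i) * (t ^ (d ℕ.∸ suc (toℕ i)) * (t * x) ^ toℕ i)) ≈ 0#
  scale-equation {d} a t x e = begin
    (t * x) ^ d + sum (λ i → (t * a i) * (t ^ (d ℕ.∸ suc (toℕ i)) * (t * x) ^ toℕ i))
      ≈⟨ +-cong (^-distrib-* t x d) (trans (sum-cong-≋ term) (sym (*-distribˡ-sum (t ^ d) (λ i → a i * x ^ toℕ i)))) ⟩
    t ^ d * x ^ d + t ^ d * sum (λ i → a i * x ^ toℕ i)  ≈⟨ distribˡ _ _ _ ⟨
    t ^ d * (x ^ d + sum (λ i → a i * x ^ toℕ i))        ≈⟨ trans (*-congˡ e) (zeroʳ _) ⟩
    0# ∎
    where
    open import Algebra.Properties.CommutativeSemiring.Exp commutativeSemiring using (^-distrib-*)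
    term : ∀ i → (t * a i) * (t ^ (d ℕ.∸ suc (toℕ i)) * (t * x) ^ toℕ i) ≈ t ^ d * (a i * x ^ toℕ i)
    term i = begin
      (t * a i) * (t ^ m * (t * x) ^ k)        ≈⟨ *-congˡ (*-congˡ (^-distrib-* t x k)) ⟩
      (t * a i) * (t ^ m * (t ^ k * x ^ k))
        ≈⟨ solve 5 (λ t a u v w → (t :* a) :* (u :* (v :* w)) := (u :* (t :* v)) :* (a :* w)) refl t (a i) _ _ _ ⟩
      (t ^ m * t ^ suc k) * (a i * x ^ k)
        ≈⟨ *-congʳ (trans (reflexive (≡.cong (t ^_) (≡.sym (ℕ.m∸n+n≡m (toℕ<n i))))) (^-homo-* t m (suc k))) ⟨
      t ^ d * (a i * x ^ k)                    ∎
      where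
      k = toℕ i
      m = d ℕ.∸ suc k

  fromℤ-^ : ∀ a k → fromℤ (a ℤ.^ k) ≈ fromℤ a ^ k
  fromℤ-^ a zero    = fromℤ-1
  fromℤ-^ a (suc k) = trans (fromℤ-* a _) (*-congˡ (fromℤ-^ a k))

  integral-scaled : ∀ {d} (a : Vector Carrier d) (t : ℤ) (z : Vector ℤ d) x →
    (∀ i → fromℤ t * a i ≈ fromℤ (z i)) → x ^ d + sum (λ i → a i * x ^ toℕ i) ≈ 0# → Integral R (fromℤ t * x)
  integral-scaled {d} a t z x ta≈z e = d , (λ i → z i ℤ.* t ℤ.^ (d ℕ.∸ suc (toℕ i))) ,
    trans (+-congˡ (sum-cong-≋ (λ i → trans (*-congʳ (trans (fromℤ-* (z i) _) (*-cong (sym (ta≈z i)) (fromℤ-^ t (d ℕ.∸ suc (toℕ i))))))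
      (*-assoc _ _ _)))) (scale-equation a (fromℤ t) x e)

  integral-multiple : ∀ {x} (t : ℤ) → ((d , _) : Integral R x) →
    Σ[ c ∈ Vector ℤ d ] (fromℤ t * x) ^ d + fromℤ t * sum (λ i → fromℤ (c i) * (fromℤ t * x) ^ toℕ i) ≈ 0#
  integral-multiple {x} t (d , a , e) = (λ i → a i ℤ.* t ℤ.^ (d ℕ.∸ suc (toℕ i))) ,
    trans (+-congˡ (trans (*-distribˡ-sum (fromℤ t) (λ i → fromℤ (a i ℤ.* t ℤ.^ (d ℕ.∸ suc (toℕ i))) * (fromℤ t * x) ^ toℕ i))
      (sum-cong-≋ (λ i → trans (*-congˡ (*-congʳ (trans (fromℤ-* (a i) _) (*-congˡ (fromℤ-^ t (d ℕ.∸ suc (toℕ i)))))))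
        (solve 4 (λ t a b y → t :* ((a :* b) :* y) := (t :* a) :* (b :* y)) refl
          (fromℤ t) (fromℤ (a i)) (fromℤ t ^ (d ℕ.∸ suc (toℕ i))) ((fromℤ t * x) ^ toℕ i))))))
      (scale-equation (fromℤ ∘ a) (fromℤ t) x e)

-- `M` will consist of the nonzero integers or of the integers prime to p; `T i s` will say that s
-- clears the i-th denominator.
common-multiple : (M : Pred ℤ 0ℓ) → M (+ 1) → (∀ {s t} → M s → M t → M (s ℤ.* t)) →
  ∀ {n} (T : Fin n → ℤ → Set) → (∀ i {s} t → T i s → T i (t ℤ.* s)) →
  (∀ i → Σ[ s ∈ ℤ ] M s × T i s) → Σ[ s ∈ ℤ ] M s × ∀ i → T i s
common-multiple M M1 M* {zero}  T T* f = + 1 , M1 , λ ()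
common-multiple M M1 M* {suc n} T T* f
  with f zero | common-multiple M M1 M* (T ∘ suc) (λ i → T* (suc i)) (f ∘ suc)
... | s , Ms , Ts | t , Mt , Tt = t ℤ.* s , M* Mt Ms ,
  λ { zero → T* zero t Ts ; (suc i) → ≡.subst (T (suc i)) (ℤ.*-comm s t) (T* (suc i) s (Tt i)) }

≢0-* : ∀ {s t} → s ≢ + 0 → t ≢ + 0 → s ℤ.* t ≢ + 0
≢0-* {s} {t} s≢0 t≢0 e with ℤ.i*j≡0⇒i≡0∨j≡0 s e
... | inj₁ s≡0 = s≢0 s≡0
... | inj₂ t≡0 = t≢0 t≡0

-- Number fields

module _ (R : Ring₀) (≈0? : ∀ x → Dec (CommutativeRing._≈_ R x (CommutativeRing.0# R)))
  (inverse : ∀ x → ¬ CommutativeRing._≈_ R x (CommutativeRing.0# R) →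
    Σ[ y ∈ ∣R∣ R ] CommutativeRing._≈_ R (CommutativeRing._*_ R x y) (CommutativeRing.1# R)) where
  open RingOps R

  -- In a sequence of vectors of Rⁿ some term depends on the earlier ones: pivot on v₀.
  dependence : ∀ n (v : ℕ → Vector Carrier n) → Σ[ r ∈ ℕ ] Σ[ c ∈ Vector Carrier r ]
    ∀ a → v r a ≈ sum (λ i → c i * v (toℕ i) a)
  dependence zero    v = 0 , (λ ()) , λ ()
  dependence (suc n) v with any? (λ a → ¬? (≈0? (v 0 a)))
  ... | no v₀≈0 = 0 , (λ ()) , λ a → decidable-stable (≈0? (v 0 a)) (λ ≉0 → v₀≈0 (a , ≉0))
  ... | yes (a , ≉0) with inverse (v 0 a) ≉0
  ...   | w , va*w≈1 = suc r , (λ { zero → q r - sum (λ i → c i * q (toℕ i)) ; (suc i) → c i }) , λ x → begin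
      v (suc r) x
        ≈⟨ solve 3 (λ v q t → v := (v :- q :* t) :+ q :* t) refl (v (suc r) x) (q r) (v 0 x) ⟩
      u r x + q r * v 0 x
        ≈⟨ +-congʳ (relation x) ⟩
      sum (λ i → c i * u (toℕ i) x) + q r * v 0 x
        ≈⟨ +-congʳ (sum-u c (λ i → v (suc (toℕ i)) x) (λ i → q (toℕ i)) (v 0 x)) ⟩
      (sum (λ i → c i * v (suc (toℕ i)) x) - sum (λ i → c i * q (toℕ i)) * v 0 x) + q r * v 0 x
        ≈⟨ solve 4 (λ s t q v → (s :- t :* v) :+ q :* v := (q :- t) :* v :+ s) refl
             (sum (λ i → c i * v (suc (toℕ i)) x)) (sum (λ i → c i * q (toℕ i))) (q r) (v 0 x) ⟩
      (q r - sum (λ i → c i * q (toℕ i))) * v 0 x + sum (λ i → c i * v (suc (toℕ i)) x) ∎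
    where
    q : ℕ → Carrier
    q i = v (suc i) a * w
    u : ℕ → Fin (suc n) → Carrier
    u i x = v (suc i) x - q i * v 0 x
    ih = dependence n (λ i b → u i (punchIn a b))
    r = proj₁ ih
    c = proj₁ (proj₂ ih)
    u-pivot : ∀ i → u i a ≈ 0#
    u-pivot i = trans
      (solve 3 (λ v w t → v :- (v :* w) :* t := v :- v :* (t :* w)) refl (v (suc i) a) w (v 0 a))
      (trans (+-congˡ (-‿cong (trans (*-congˡ va*w≈1) (*-identityʳ _)))) (-‿inverseʳ _))
    relation : ∀ x → u r x ≈ sum (λ i → c i * u (toℕ i) x)
    relation x with a ≟ x
    ... | yes ≡.refl = trans (u-pivot r) (sym (sum-zero (λ i → c i * u (toℕ i) a)
      (λ i → trans (*-congˡ (u-pivot (toℕ i))) (zeroʳ (c i)))))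
    ... | no a≢x = ≡.subst (λ x → u r x ≈ sum (λ i → c i * u (toℕ i) x)) (punchIn-punchOut a≢x)
      (proj₂ (proj₂ ih) (punchOut a≢x))
    sum-u : ∀ {k} (c y z : Vector Carrier k) t →
      sum (λ i → c i * (y i - z i * t)) ≈ sum (λ i → c i * y i) - sum (λ i → c i * z i) * t
    sum-u {zero}  c y z t = solve 1 (λ t → con (+ 0) := con (+ 0) :- con (+ 0) :* t) refl t
    sum-u {suc k} c y z t = trans (+-congˡ (sum-u (c ∘ suc) (y ∘ suc) (z ∘ suc) t))
      (solve 6 (λ c y z t s r → c :* (y :- z :* t) :+ (s :- r :* t) := (c :* y :+ s) :- (c :* z :+ r) :* t) refl
        (c zero) (y zero) (z zero) t
        (sum (λ i → c (suc i) * y (suc i))) (sum (λ i → c (suc i) * z (suc i))))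

module ℚOps = RingOps ℚ-ring

ℚ-inverse : ∀ q → q ≢ ℚ.0ℚ → Σ[ r ∈ ℚ ] q ℚ.* r ≡ ℚ.1ℚ
ℚ-inverse q q≢0 = ℚ.1/ q , ℚ.*-inverseʳ q
  where instance q-nonZero = ℚ.≢-nonZero q≢0

private
  -- Here numerator and denominator compute, in contrast to the iterated sum `fromℤ`.
  int : ℤ → ℚ
  int z = ℚ.mkℚ z 0 (Coprimality.sym (Coprimality.1-coprimeTo _))

  int-hom : IsHom ℤ-ring ℚ-ring int
  int-hom = mkHom ℤ-ring ℚ-ring (≡.cong int)
    (λ x y → ℚ.toℚᵘ-injective (ℚᵘ.≃-trans (ℚᵘ.*≡* (solve 2 (λ x y →
      (x :+ y) :* con (+ 1) := (x :* con (+ 1) :+ y :* con (+ 1)) :* con (+ 1)) ≡.refl x y)) (ℚᵘ.≃-sym (ℚ.toℚᵘ-homo-+ (int x) (int y)))))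
    (λ x y → ℚ.toℚᵘ-injective (ℚᵘ.≃-trans (ℚᵘ.*≡* ≡.refl) (ℚᵘ.≃-sym (ℚ.toℚᵘ-homo-* (int x) (int y)))))
    ≡.refl
    where open ℤSolver.+-*-Solver

  int≡ : ∀ z → int z ≡ ℚOps.fromℤ z
  int≡ = ℤ-hom-unique ℚ-ring int-hom

fromℤ-fraction : ∀ q {d z} → ℚ.↧ q ≡ d → ℚ.↥ q ≡ z → ℚOps.fromℤ d ℚ.* q ≡ ℚOps.fromℤ z
fromℤ-fraction q {d} {z} ≡.refl ≡.refl = ≡.trans (≡.cong (ℚ._* q) (≡.sym (int≡ d))) (≡.trans (cross q) (int≡ z))
  where
  cross : ∀ q → int (ℚ.↧ q) ℚ.* q ≡ int (ℚ.↥ q)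
  cross q@record{} = ℚ.toℚᵘ-injective (ℚᵘ.≃-trans (ℚ.toℚᵘ-homo-* (int (ℚ.↧ q)) q) (ℚᵘ.*≡*
    (≡.trans (ℤ.*-identityʳ _) (≡.trans (ℤ.*-comm (ℚ.↧ q) (ℚ.↥ q))
      (≡.cong (ℚ.↥ q ℤ.*_) (≡.sym (≡.cong (λ n → + suc n) (ℕ.+-identityʳ _))))))))

ℚ-fromℤ≢0 : ∀ {z} → z ≢ + 0 → ℚOps.fromℤ z ≢ ℚ.0ℚ
ℚ-fromℤ≢0 {z} z≢0 e = z≢0 (≡.cong ℚ.↥_ (≡.trans (int≡ z) e))

module ℚAlgebra (A : ℚ-ring -Algebra) where
  open _-Algebra A using (ι; ι-homo) public
  open RingOps (_-Algebra.ring A)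
  open Hom {ℚ-ring} {_-Algebra.ring A} ι-homo

  ι-fraction : ∀ q {d z} → ℚ.↧ q ≡ d → ℚ.↥ q ≡ z → fromℤ d * ι q ≈ fromℤ z
  ι-fraction q {d} {z} d≡ z≡ = trans (h-fromℤ-* d q (fromℤ-fraction q d≡ z≡)) (h-fromℤ z)

  integer-inverse : ∀ d → d ≢ + 0 → Σ[ y ∈ Carrier ] fromℤ d * y ≈ 1#
  integer-inverse d d≢0 = image (ℚ-inverse (ℚOps.fromℤ d) (ℚ-fromℤ≢0 d≢0))
    where
    image : Σ[ r ∈ ℚ ] ℚOps.fromℤ d ℚ.* r ≡ ℚ.1ℚ → Σ[ y ∈ Carrier ] fromℤ d * y ≈ 1#
    image (r , e) = ι r , trans (h-fromℤ-* d r e) 1#-homo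

  integer-cancel : ∀ d → d ≢ + 0 → ∀ {x y} → fromℤ d * x ≈ fromℤ d * y → x ≈ y
  integer-cancel d d≢0 = unit-cancel (integer-inverse d d≢0)

module Coordinates (F K : Ring₀) {ι : ∣R∣ F → ∣R∣ K} (ι-hom : IsHom F K ι) {n : ℕ} (b : Vector (∣R∣ K) n)
  (spanning : ∀ x → Σ[ c ∈ Vector (∣R∣ F) n ]
    CommutativeRing._≈_ K x (RingOps.sum K (λ i → CommutativeRing._*_ K (ι (c i)) (b i))))
  (independent : ∀ (c : Vector (∣R∣ F) n) →
    CommutativeRing._≈_ K (RingOps.sum K (λ i → CommutativeRing._*_ K (ι (c i)) (b i))) (CommutativeRing.0# K) →
    ∀ i → CommutativeRing._≈_ F (c i) (CommutativeRing.0# F)) where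
  private
    module F = RingOps F
  open RingOps K
  open Hom {F} {K} ι-hom

  combination : ∀ {m} → Vector F.Carrier m → Vector Carrier m → Carrier
  combination c v = sum (λ i → ι (c i) * v i)

  coord : Carrier → Vector F.Carrier n
  coord x = proj₁ (spanning x)

  combination-+ : ∀ {m} (c d : Vector F.Carrier m) (v : Vector Carrier m) →
    combination (λ i → c i F.+ d i) v ≈ combination c v + combination d v
  combination-+ {zero}  c d v = sym (+-identityˡ 0#)
  combination-+ {suc m} c d v = trans (+-cong (*-congʳ (+-homo _ _)) (combination-+ (c ∘ suc) (d ∘ suc) (v ∘ suc)))
    (solve 5 (λ c d v s t → (c :+ d) :* v :+ (s :+ t) := (c :* v :+ s) :+ (d :* v :+ t)) refl _ _ (v zero)
      (combination (c ∘ suc) (v ∘ suc)) (combination (d ∘ suc) (v ∘ suc)))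

  combination-* : ∀ {m} r (c : Vector F.Carrier m) (v : Vector Carrier m) →
    combination (λ i → r F.* c i) v ≈ ι r * combination c v
  combination-* {zero}  r c v = sym (zeroʳ _)
  combination-* {suc m} r c v = trans (+-cong (*-congʳ (*-homo _ _)) (combination-* r (c ∘ suc) (v ∘ suc)))
    (solve 4 (λ r c v s → (r :* c) :* v :+ r :* s := r :* (c :* v :+ s)) refl _ _ (v zero)
      (combination (c ∘ suc) (v ∘ suc)))

  combination-sum : ∀ {m k} (c : Vector F.Carrier k) (d : Fin k → Vector F.Carrier m) (v : Vector Carrier m) →
    combination (λ a → F.sum (λ i → c i F.* d i a)) v ≈ combination c (λ i → combination (d i) v)
  combination-sum {k = zero}  c d v = sum-zero _ (λ a → trans (*-congʳ 0#-homo) (zeroˡ (v a)))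
  combination-sum {k = suc k} c d v = trans
    (combination-+ (λ a → c zero F.* d zero a) (λ a → F.sum (λ i → c (suc i) F.* d (suc i) a)) v)
    (+-cong (combination-* (c zero) (d zero) v) (combination-sum (c ∘ suc) (d ∘ suc) v))

  combination-cong : ∀ {m} {c d : Vector F.Carrier m} (v : Vector Carrier m) → (∀ i → c i F.≈ d i) →
    combination c v ≈ combination d v
  combination-cong v e = sum-cong-≋ (λ i → *-congʳ (⟦⟧-cong (e i)))

  coord-unique : ∀ {x} (d : Vector F.Carrier n) → x ≈ combination d b → ∀ i → coord x i F.≈ d i
  coord-unique {x} d e i = F.x-y≈0⇒x≈y (F.trans
    (F.+-congˡ (F.solve 1 (λ x → F.:- x F.:= F.con (ℤ.- + 1) F.:* x) F.refl (d i)))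
    (independent (λ i → coord x i F.+ F.fromℤ (ℤ.- + 1) F.* d i) (begin
      combination (λ i → coord x i F.+ F.fromℤ (ℤ.- + 1) F.* d i) b
        ≈⟨ combination-+ (coord x) (λ i → F.fromℤ (ℤ.- + 1) F.* d i) b ⟩
      combination (coord x) b + combination (λ i → F.fromℤ (ℤ.- + 1) F.* d i) b
        ≈⟨ +-cong (sym (proj₂ (spanning x))) (combination-* (F.fromℤ (ℤ.- + 1)) d b) ⟩
      x + ι (F.fromℤ (ℤ.- + 1)) * combination d b
        ≈⟨ +-cong e (*-congʳ (h-fromℤ (ℤ.- + 1))) ⟩
      combination d b + fromℤ (ℤ.- + 1) * combination d b
        ≈⟨ solve 1 (λ x → x :+ con (ℤ.- + 1) :* x := con (+ 0)) refl (combination d b) ⟩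
      0# ∎) i))

  coord-cong : ∀ {x y} → x ≈ y → ∀ i → coord x i F.≈ coord y i
  coord-cong {x} {y} x≈y = coord-unique (coord y) (trans x≈y (proj₂ (spanning y)))

  coord-+ : ∀ x y i → coord (x + y) i F.≈ coord x i F.+ coord y i
  coord-+ x y = coord-unique (λ i → coord x i F.+ coord y i)
    (trans (+-cong (proj₂ (spanning x)) (proj₂ (spanning y))) (sym (combination-+ (coord x) (coord y) b)))

  coord-* : ∀ r x i → coord (ι r * x) i F.≈ r F.* coord x i
  coord-* r x = coord-unique (λ i → r F.* coord x i)
    (trans (*-congˡ (proj₂ (spanning x))) (sym (combination-* r (coord x) b)))

  coord-0 : ∀ i → coord 0# i F.≈ F.0#
  coord-0 = coord-unique (λ _ → F.0#) (sym (sum-zero _ (λ i → trans (*-congʳ 0#-homo) (zeroˡ (b i)))))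

  coord≈0 : ∀ {x} → (∀ i → coord x i F.≈ F.0#) → x ≈ 0#
  coord≈0 {x} e = trans (proj₂ (spanning x)) (trans (combination-cong b e)
    (sum-zero _ (λ i → trans (*-congʳ 0#-homo) (zeroˡ (b i)))))

  module _ (≈0? : ∀ x → Dec (x F.≈ F.0#)) (inverse : ∀ x → ¬ x F.≈ F.0# → Σ[ y ∈ F.Carrier ] x F.* y F.≈ F.1#) where

    -- Proofs by contradiction of equations in a number field rest on this test of the coordinates.
    vanishes? : ∀ x → Dec (x ≈ 0#)
    vanishes? x = map′ coord≈0 (λ e i → F.trans (coord-cong e i) (coord-0 i)) (all? (λ i → ≈0? (coord x i)))

    -- The coordinate vectors of 1, x, x², ... lie in Fⁿ, so one of them depends on the earlier
    -- ones. The relation is monic because it expresses the last power by the preceding ones.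
    power-relation : ∀ x → Σ[ r ∈ ℕ ] Σ[ c ∈ Vector F.Carrier r ] x ^ r + sum (λ i → ι (c i) * x ^ toℕ i) ≈ 0#
    power-relation x with dependence F ≈0? inverse n (λ i → coord (x ^ i))
    ... | r , c , e = r , (λ i → F.fromℤ (ℤ.- + 1) F.* c i) , (begin
        x ^ r + combination (λ i → F.fromℤ (ℤ.- + 1) F.* c i) (λ i → x ^ toℕ i)
          ≈⟨ +-cong relation (trans (combination-* (F.fromℤ (ℤ.- + 1)) c (λ i → x ^ toℕ i)) (*-congʳ (h-fromℤ (ℤ.- + 1)))) ⟩
        combination c (λ i → x ^ toℕ i) + fromℤ (ℤ.- + 1) * combination c (λ i → x ^ toℕ i)
          ≈⟨ solve 1 (λ x → x :+ con (ℤ.- + 1) :* x := con (+ 0)) refl (combination c (λ i → x ^ toℕ i)) ⟩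
        0# ∎)
      where
      relation : x ^ r ≈ combination c (λ i → x ^ toℕ i)
      relation = begin
        x ^ r                                                        ≈⟨ proj₂ (spanning (x ^ r)) ⟩
        combination (coord (x ^ r)) b                                ≈⟨ combination-cong b e ⟩
        combination (λ a → F.sum (λ i → c i F.* coord (x ^ toℕ i) a)) b
          ≈⟨ combination-sum c (λ i → coord (x ^ toℕ i)) b ⟩
        combination c (λ i → combination (coord (x ^ toℕ i)) b)
          ≈⟨ sum-cong-≋ (λ i → *-congˡ {ι (c i)} (proj₂ (spanning (x ^ toℕ i)))) ⟨
        combination c (λ i → x ^ toℕ i) ∎

∣-from-sum : ∀ {p} a t → a ℤ.+ p ℤ.* t ≡ + 0 → p ∣ a
∣-from-sum {p} a t e = divides (ℤ.- t) (≡.trans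
  (solve 3 (λ a p t → a := (a :+ p :* t) :- p :* t) ≡.refl a p t)
  (≡.trans (≡.cong (ℤ._- p ℤ.* t) e) (solve 2 (λ p t → con (+ 0) :- p :* t := (:- t) :* p) ≡.refl p t)))
  where open ℤSolver.+-*-Solver

module _ {p} (p-prime : Prime p) (R : Ring₀) where
  open RingOps R

  -- Scaling a monic equation of w by p and inserting p w = s gives sᵈ + p t = 0 with an integer t,
  -- so p divides sᵈ.
  integral-fraction : (∀ {z} → fromℤ z ≈ 0# → z ≡ + 0) →
    ∀ {w s} → Integral R w → fromℤ (+ p) * w ≈ fromℤ s → + p ∣ s
  integral-fraction fromℤ-inj {w} {s} w-int pw≈s = go (proj₁ w-int) (integral-multiple R (+ p) w-int)
    where
    value : ∀ {k} (c : Vector ℤ k) (f : Fin k → ℕ) → Σ[ t ∈ ℤ ] fromℤ t ≈ sum (λ i → fromℤ (c i) * fromℤ s ^ f i)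
    value {zero}  c f = + 0 , refl
    value {suc k} c f with value (c ∘ suc) (f ∘ suc)
    ... | t , e = c zero ℤ.* s ℤ.^ f zero ℤ.+ t , trans (fromℤ-+ (c zero ℤ.* s ℤ.^ f zero) t)
      (+-cong (trans (fromℤ-* (c zero) (s ℤ.^ f zero)) (*-congˡ (fromℤ-^ R s (f zero)))) e)
    finish : ∀ d t → fromℤ s ^ d + fromℤ (+ p) * fromℤ t ≈ 0# → + p ∣ s
    finish d t e = ∣-^⇒∣ p-prime s d (∣-from-sum {+ p} (s ℤ.^ d) t (fromℤ-inj {s ℤ.^ d ℤ.+ + p ℤ.* t}
      (trans (fromℤ-+ (s ℤ.^ d) (+ p ℤ.* t)) (trans (+-cong (fromℤ-^ R s d) (fromℤ-* (+ p) t)) e))))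
    go : ∀ d → Σ[ c ∈ Vector ℤ d ]
      (fromℤ (+ p) * w) ^ d + fromℤ (+ p) * sum (λ i → fromℤ (c i) * (fromℤ (+ p) * w) ^ toℕ i) ≈ 0# → + p ∣ s
    go d (c , e) with value c toℕ
    ... | t , v = finish d t (trans (+-cong (^-congˡ d (sym pw≈s)) (*-congˡ (trans v
      (sum-cong-≋ (λ i → *-congˡ {fromℤ (c i)} (^-congˡ (toℕ i) (sym pw≈s))))))) e)

module NumberFieldOps (N : NumberField) where
  open NumberField N public using (degree; basis; nontrivial; inverse)
  field-ring : Ring₀
  field-ring = NumberField.ring N
  open RingOps field-ring public
  open ℚAlgebra (NumberField.algebra N) public
  open Coordinates ℚ-ring field-ring {ι} ι-homo basis (NumberField.spanning N) (NumberField.independent N) public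
    using (coord; coord-cong; coord-+; coord-*; coord-0; coord≈0)
  private
    module C = Coordinates ℚ-ring field-ring {ι} ι-homo basis (NumberField.spanning N) (NumberField.independent N)

  ≈0? : ∀ x → Dec (x ≈ 0#)
  ≈0? = C.vanishes? (ℚ._≟ ℚ.0ℚ) ℚ-inverse

  fromℤ-inj : ∀ {z} → fromℤ z ≈ 0# → z ≡ + 0
  fromℤ-inj {z} e = decidable-stable (z ℤ.≟ + 0) (λ z≢0 → nontrivial (trans (sym (proj₂ (integer-inverse z z≢0)))
    (trans (*-congʳ e) (zeroˡ _))))

  integral-denominator : ∀ x → Σ[ D ∈ ℤ ] D ≢ + 0 × Integral field-ring (fromℤ D * x)
  integral-denominator x = go (C.power-relation (ℚ._≟ ℚ.0ℚ) ℚ-inverse x)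
    where
    go : Σ[ r ∈ ℕ ] Σ[ c ∈ Vector ℚ r ] x ^ r + sum (λ i → ι (c i) * x ^ toℕ i) ≈ 0# →
         Σ[ D ∈ ℤ ] D ≢ + 0 × Integral field-ring (fromℤ D * x)
    go (r , c , e) = scaled (common-multiple (_≢ + 0) (λ ()) ≢0-* (λ i s → Σ[ z ∈ ℤ ] fromℤ s * ι (c i) ≈ fromℤ z)
        (λ i {s} t (z , p) → t ℤ.* z , trans (*-congʳ (fromℤ-* t s)) (trans (*-assoc _ _ _) (trans (*-congˡ p) (sym (fromℤ-* t z)))))
        (λ i → ℚ.↧ c i , (λ ()) , ℚ.↥ c i , ι-fraction (c i) ≡.refl ≡.refl))
      where
      scaled : Σ[ D ∈ ℤ ] D ≢ + 0 × (∀ i → Σ[ z ∈ ℤ ] fromℤ D * ι (c i) ≈ fromℤ z) →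
        Σ[ D ∈ ℤ ] D ≢ + 0 × Integral field-ring (fromℤ D * x)
      scaled (D , D≢0 , z) = D , D≢0 , integral-scaled field-ring (ι ∘ c) D (proj₁ ∘ z) x (proj₂ ∘ z) e

module _ (R : Ring₀) where
  open RingOps R

  sum-single : ∀ {n} (v : Vector Carrier n) i → (∀ j → j ≢ i → v j ≈ 0#) → sum v ≈ v i
  sum-single v zero    e = trans (+-congˡ (sum-zero (v ∘ suc) (λ j → e (suc j) λ ()))) (+-identityʳ _)
  sum-single v (suc i) e = trans (+-cong (e zero λ ()) (sum-single (v ∘ suc) i (λ j j≢i → e (suc j) (j≢i ∘ suc-injective))))
    (+-identityˡ _)

  integral-0 : Integral R 0#
  integral-0 = integral-fromℤ R (+ 0)

  integral-sum : ∀ {n} (v : Vector Carrier n) → (∀ i → Integral R (v i)) → Integral R (sum v)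
  integral-sum {zero}  v f = integral-0
  integral-sum {suc n} v f = integral-+ R (f zero) (integral-sum (v ∘ suc) (f ∘ suc))

  -- X need not be integral: f cuts out the part where the equation holds, and
  -- the factor T of T · (Tᵈ + Σ cₖ Tᵏ) vanishes on the rest.
  integral-part : ∀ X f {d} (c : Vector ℤ d) → f * f ≈ f →
    f * (X ^ d + sum (λ i → fromℤ (c i) * X ^ toℕ i)) ≈ 0# → Integral R (X * f)
  integral-part X f {d} c ff e = low⇒integral R {X * f} {suc d}
    (low-sum R _ (λ i → low-scale R (c i) (low-≤ R (s≤s (toℕ<n i)) (low-x^ R (suc (toℕ i))))))
    (begin
      (X * f) ^ suc d + sum (λ i → fromℤ (c i) * (X * f) ^ suc (toℕ i))
        ≈⟨ +-cong (power d) (trans (sum-cong-≋ (λ i → trans (*-congˡ {fromℤ (c i)} (power (toℕ i)))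
             (solve 3 (λ c y z → c :* (y :* z) := y :* (c :* z)) refl (fromℤ (c i)) (X * f) (X ^ toℕ i))))
             (sym (*-distribˡ-sum (X * f) (λ i → fromℤ (c i) * X ^ toℕ i)))) ⟩
      (X * f) * X ^ d + (X * f) * sum (λ i → fromℤ (c i) * X ^ toℕ i)
        ≈⟨ solve 4 (λ x f y s → (x :* f) :* y :+ (x :* f) :* s := x :* (f :* (y :+ s))) refl X f _ _ ⟩
      X * (f * (X ^ d + sum (λ i → fromℤ (c i) * X ^ toℕ i)))  ≈⟨ trans (*-congˡ e) (zeroʳ X) ⟩
      0# ∎)
    where
    power : ∀ k → (X * f) ^ suc k ≈ (X * f) * X ^ k
    power zero    = refl
    power (suc k) = trans (*-congˡ (power k)) (trans
      (solve 3 (λ x f y → (x :* f) :* ((x :* f) :* y) := (x :* (f :* f)) :* (x :* y)) refl X f (X ^ k))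
      (*-congʳ (*-congˡ ff)))

-- Products of rings and étale algebras

module ProductOps {n : ℕ} (R : Fin n → Ring₀) where
  private
    module R i = RingOps (R i)
    module P = RingOps (Π R)

  π-hom : ∀ i → IsHom (Π R) (R i) (λ x → x i)
  π-hom i = mkHom (Π R) (R i) (λ e → e i) (λ _ _ → R.refl i) (λ _ _ → R.refl i) (R.refl i)

  place : ∀ i → ∣R∣ (R i) → ∣R∣ (Π R)
  place i x j with i ≟ j
  ... | yes ≡.refl = x
  ... | no  _      = R.0# j

  place-≡ : ∀ i x → place i x i ≡ x
  place-≡ i x with i ≟ i
  ... | yes ≡.refl = ≡.refl
  ... | no  i≢i    = contradiction ≡.refl i≢i

  place-≢ : ∀ {i j} x → i ≢ j → place i x j ≡ R.0# j
  place-≢ {i} {j} x i≢j with i ≟ j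
  ... | yes i≡j = contradiction i≡j i≢j
  ... | no  _   = ≡.refl

  idem : Fin n → ∣R∣ (Π R)
  idem i = place i (R.1# i)

  idem-* : ∀ i {x} → R._≈_ i (x i) (R.0# i) → idem i P.* x P.≈ P.0#
  idem-* i {x} e j with i ≟ j
  ... | yes ≡.refl = R.trans j (R.*-identityˡ j _) e
  ... | no  _      = R.zeroˡ j _

  idem-idem : ∀ i → idem i P.* idem i P.≈ idem i
  idem-idem i j with i ≟ j
  ... | yes ≡.refl = R.*-identityˡ j _
  ... | no  _      = R.zeroˡ j _

  idem-sum : P.sum idem P.≈ P.1#
  idem-sum j = R.trans j (Hom.h-sum {Π R} {R j} (π-hom j) idem) (R.trans j
    (sum-single (R j) (λ i → idem i j) j (λ i i≢j → R.reflexive j (place-≢ (R.1# i) i≢j)))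
    (R.reflexive j (place-≡ j (R.1# j))))

module EtaleOps (K : EtaleAlgebra) where
  open EtaleAlgebra K public using (factors; 𝒪-Carrier; incl)
  open EtaleAlgebra K using (factor; 𝒪; ring)
  module N i = NumberFieldOps (factor i)
  module KP = ProductOps (λ i → NumberField.ring (factor i))
  module OP = ProductOps (λ i → integralClosure (NumberField.ring (factor i)))
  private
    module K = RingOps ring

  comp : ∀ i → 𝒪-Carrier → N.Carrier i
  comp i x = proj₁ (x i)

  comp-hom : ∀ i → IsHom 𝒪 (NumberField.ring (factor i)) (comp i)
  comp-hom i = mkHom 𝒪 (NumberField.ring (factor i)) (λ e → e i) (λ _ _ → N.refl i) (λ _ _ → N.refl i) (N.refl i)

  incl-hom : IsHom 𝒪 ring incl
  incl-hom = mkHom 𝒪 ring (λ e → e) (λ x y i → N.refl i) (λ x y i → N.refl i) (λ i → N.refl i)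

  module _ (S : Ring₀) {h : ∣R∣ ring → ∣R∣ S} (h-hom : IsHom ring S h) where
    private
      module S = RingOps S
      module h = Hom {ring} {S} h-hom

    -- An element of 𝒪 comes with one monic equation for each factor, not with a common one. So h x
    -- is split as the sum of the h x · h eᵢ, where h eᵢ times the i-th equation, evaluated at h x,
    -- vanishes.
    hom-integral : ∀ x → Integral S (h (incl x))
    hom-integral x = integral-resp S eq (integral-sum S (λ i → X S.* h (KP.idem i)) part)
      where
      X = h (incl x)
      eq : S.sum (λ i → X S.* h (KP.idem i)) S.≈ X
      eq = S.trans (S.sym (S.*-distribˡ-sum X (h ∘ KP.idem))) (S.trans
        (S.*-congˡ (S.trans (S.sym (h.h-sum KP.idem)) (S.trans (h.⟦⟧-cong KP.idem-sum) h.1#-homo))) (S.*-identityʳ X))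
      part : ∀ i → Integral S (X S.* h (KP.idem i))
      part i = go (proj₂ (x i))
        where
        f = h (KP.idem i)
        go : Integral (NumberField.ring (factor i)) (comp i x) → Integral S (X S.* f)
        go (d , c , e) = integral-part S X f c
          (S.trans (S.sym (h.*-homo _ _)) (h.⟦⟧-cong (KP.idem-idem i)))
          (S.trans (S.*-congˡ (S.sym (polynomial ring S h-hom))) (S.trans (S.sym (h.*-homo _ _))
            (S.trans (h.⟦⟧-cong {_} {K.0#} (KP.idem-* i {x = poly ring (incl x)} (N.trans i (polynomial ring (NumberField.ring (factor i)) (KP.π-hom i)) e))) h.0#-homo)))
          where
          poly : (R : Ring₀) → ∣R∣ R → ∣R∣ R
          poly R y = y ^ d + sum (λ k → fromℤ (c k) * y ^ toℕ k)
            where open RingOps R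
          polynomial : (R T : Ring₀) {g : ∣R∣ R → ∣R∣ T} → IsHom R T g → ∀ {y} →
            CommutativeRing._≈_ T (g (poly R y)) (poly T (g y))
          polynomial R T {g} g-hom {y} = trans (+-homo _ _) (+-cong (h-^ y d) (trans
            (h-sum (λ k → R.fromℤ (c k) R.* y R.^ toℕ k))
            (sum-cong-≋ (λ k → trans (*-homo _ _) (*-cong (h-fromℤ (c k)) (h-^ y (toℕ k)))))))
            where
            module R = RingOps R
            open RingOps T
            open Hom {R} {T} g-hom

  denominator : ∀ x → Σ[ D ∈ ℤ ] Σ[ o ∈ 𝒪-Carrier ] D ≢ + 0 × K._≈_ (incl o) (K.fromℤ D K.* x)
  denominator x = go (common-multiple (_≢ + 0) (λ ()) ≢0-*
      (λ j s → Integral (NumberField.ring (factor j)) (N._*_ j (N.fromℤ j s) (x j)))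
      (λ j {s} t i → integral-resp (NumberField.ring (factor j))
        (N.trans j (N.sym j (N.*-assoc j _ _ _)) (N.*-congʳ j (N.sym j (N.fromℤ-* j t s))))
        (integral-* (NumberField.ring (factor j)) (integral-fromℤ (NumberField.ring (factor j)) t) i))
      (λ j → N.integral-denominator j (x j)))
    where
    go : Σ[ D ∈ ℤ ] D ≢ + 0 × (∀ j → Integral (NumberField.ring (factor j)) (N._*_ j (N.fromℤ j D) (x j))) →
      Σ[ D ∈ ℤ ] Σ[ o ∈ 𝒪-Carrier ] D ≢ + 0 × K._≈_ (incl o) (K.fromℤ D K.* x)
    go (D , D≢0 , i) = D , (λ j → N._*_ j (N.fromℤ j D) (x j) , i j) , D≢0 , λ j → N.*-congʳ j (N.sym j (Hom.h-fromℤ {ring} {NumberField.ring (factor j)} (KP.π-hom j) D))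

-- Completely split primes

module _ (R : Ring₀) {A : Set} where
  open RingOps R

  pairing : (A → Carrier) → List (A × Carrier) → Carrier
  pairing f []            = 0#
  pairing f ((x , z) ∷ t) = f x * z + pairing f t

module TensorForms {F : Ring₀} (A B : F -Algebra) where
  open Tensor A B
  private
    module F = RingOps F
    module A where
      open _-Algebra A using (ι; ι-homo) public
      open RingOps (_-Algebra.ring A) public
    open _-Algebra B using () renaming (ι to ιᴮ; ι-homo to ιᴮ-homo)
    open RingOps (_-Algebra.ring B) hiding (_≈_; refl; sym; trans; zeroˡ; zeroʳ; distribˡ; distribʳ; rawRing)
    module B = RingOps (_-Algebra.ring B)
    module ιᴮ = Hom {F} {_-Algebra.ring B} ιᴮ-homo

  evaluate : (A.Carrier → Carrier) → FormalSum → Carrier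
  evaluate = pairing (_-Algebra.ring B)

  scale : Carrier → FormalSum → FormalSum
  scale w = map (λ (x , z) → x , w * z)

  evaluate-scale : ∀ f w t → evaluate f (scale w t) B.≈ w * evaluate f t
  evaluate-scale f w []            = B.sym (B.zeroʳ w)
  evaluate-scale f w ((x , z) ∷ t) = B.trans (+-congˡ (evaluate-scale f w t))
    (solve 4 (λ x w z s → x :* (w :* z) :+ w :* s := w :* (x :* z :+ s)) B.refl (f x) w z (evaluate f t))

  evaluate-++ : ∀ f s t → evaluate f (s ++ t) B.≈ evaluate f s + evaluate f t
  evaluate-++ f []            t = B.sym (+-identityˡ _)
  evaluate-++ f ((x , z) ∷ s) t = B.trans (+-congˡ (evaluate-++ f s t)) (B.sym (+-assoc _ _ _))

  combine : ∀ {n} → Vector Carrier n → Vector FormalSum n → FormalSum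
  combine {zero}  w t = []
  combine {suc n} w t = scale (w zero) (t zero) ++ combine (w ∘ suc) (t ∘ suc)

  evaluate-combine : ∀ f {n} (w : Vector Carrier n) t → evaluate f (combine w t) B.≈ sum (λ i → w i * evaluate f (t i))
  evaluate-combine f {zero}  w t = B.refl
  evaluate-combine f {suc n} w t = B.trans (evaluate-++ f (scale (w zero) (t zero)) _)
    (+-cong (evaluate-scale f (w zero) (t zero)) (evaluate-combine f (w ∘ suc) (t ∘ suc)))

  module _ (κ : A.Carrier → F.Carrier) (κ-cong : ∀ {x y} → x A.≈ y → κ x F.≈ κ y)
    (κ-+ : ∀ x y → κ (x A.+ y) F.≈ κ x F.+ κ y) (κ-0 : κ A.0# F.≈ F.0#) (κ-* : ∀ r x → κ (A.ι r A.* x) F.≈ r F.* κ x) where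
    private
      f : A.Carrier → Carrier
      f x = ιᴮ (κ x)

      single : ∀ x z → evaluate f (pure x z) B.≈ f x * z
      single x z = +-identityʳ _

    -- Linearity of κ over F enters through `balanced`; the other relations rest on additivity.
    evaluate-cong : ∀ {s t} → s ≈ t → evaluate f s B.≈ evaluate f t
    evaluate-cong refl          = B.refl
    evaluate-cong (sym e)       = B.sym (evaluate-cong e)
    evaluate-cong (trans e e′)  = B.trans (evaluate-cong e) (evaluate-cong e′)
    evaluate-cong (++-cong {s} {s′} {t} {t′} e e′) = B.trans (evaluate-++ f s t)
      (B.trans (+-cong (evaluate-cong e) (evaluate-cong e′)) (B.sym (evaluate-++ f s′ t′)))
    evaluate-cong (++-comm s t) = B.trans (evaluate-++ f s t) (B.trans (+-comm _ _) (B.sym (evaluate-++ f t s)))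
    evaluate-cong (⊗-cong e e′) = +-congʳ (*-cong (ιᴮ.⟦⟧-cong (κ-cong e)) e′)
    evaluate-cong (distribˡ x z z′) = B.trans (single x (z + z′)) (B.trans (B.distribˡ _ _ _)
      (+-congˡ (B.sym (single x z′))))
    evaluate-cong (distribʳ x x′ z) = B.trans (single (x A.+ x′) z)
      (B.trans (*-congʳ (B.trans (ιᴮ.⟦⟧-cong (κ-+ x x′)) (ιᴮ.+-homo _ _))) (B.trans (B.distribʳ _ _ _)
        (+-congˡ (B.sym (single x′ z)))))
    evaluate-cong (zeroˡ z) = B.trans (single A.0# z)
      (B.trans (*-congʳ (B.trans (ιᴮ.⟦⟧-cong κ-0) ιᴮ.0#-homo)) (B.zeroˡ z))
    evaluate-cong (zeroʳ x) = B.trans (single x 0#) (B.zeroʳ _)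
    evaluate-cong (balanced r x z) = +-congʳ (B.trans (*-congʳ (B.trans (ιᴮ.⟦⟧-cong (κ-* r x)) (ιᴮ.*-homo _ _)))
      (solve 3 (λ r k z → (r :* k) :* z := k :* (r :* z)) B.refl (ιᴮ r) (f x) z))

  module Split {n : ℕ} (φ : FormalSum → Fin n → Carrier)
    (iso : IsRingIsomorphism rawRing (CommutativeRing.rawRing (Π {Fin n} (λ _ → _-Algebra.ring B))) φ)
    (φ-ιʳ : ∀ z i → φ (ιʳ z) i B.≈ z) where
    private
      module φ = IsRingIsomorphism iso
      module P = ProductOps {n} (λ _ → _-Algebra.ring B)

    component : Fin n → A.Carrier → Carrier
    component i x = φ (pure x 1#) i

    component-hom : ∀ i → IsHom (_-Algebra.ring A) (_-Algebra.ring B) (component i)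
    component-hom i = mkHom (_-Algebra.ring A) (_-Algebra.ring B)
      (λ e → φ.⟦⟧-cong (⊗-cong e B.refl) i)
      (λ x y → B.trans (φ.⟦⟧-cong (distribʳ x y 1#) i) (φ.+-homo (pure x 1#) (pure y 1#) i))
      (λ x y → B.trans (φ.⟦⟧-cong (⊗-cong A.refl (B.sym (*-identityˡ 1#))) i) (φ.*-homo (pure x 1#) (pure y 1#) i))
      (φ.1#-homo i)

    -- Since x ⊗ z = (x ⊗ 1)(1 ⊗ z) and φ is the identity on each component of 1 ⊗ z, it is
    -- determined by its values on the x ⊗ 1.
    φ-evaluate : ∀ t i → φ t i B.≈ evaluate (component i) t
    φ-evaluate []            i = φ.0#-homo i
    φ-evaluate ((x , z) ∷ t) i = B.trans (φ.+-homo (pure x z) t i) (+-cong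
      (B.trans (φ.⟦⟧-cong (⊗-cong (A.sym (A.*-identityʳ x)) (B.sym (*-identityˡ z))) i)
        (B.trans (φ.*-homo (pure x 1#) (ιʳ z) i) (*-congˡ (φ-ιʳ z i))))
      (φ-evaluate t i))

    unit-vector : ∀ i → Σ[ t ∈ FormalSum ] ∀ l → evaluate (component l) t B.≈ P.idem i l
    unit-vector i with φ.surjective (P.idem i)
    ... | t , e = t , λ l → B.trans (B.sym (φ-evaluate t l)) (e refl l)

    module _ (κ : A.Carrier → F.Carrier) (κ-cong : ∀ {x y} → x A.≈ y → κ x F.≈ κ y)
      (κ-+ : ∀ x y → κ (x A.+ y) F.≈ κ x F.+ κ y) (κ-0 : κ A.0# F.≈ F.0#) (κ-* : ∀ r x → κ (A.ι r A.* x) F.≈ r F.* κ x) where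

      -- By injectivity of φ, x ⊗ 1 = Σ φᵢ(x) tᵢ with tᵢ dual to the φᵢ; the extension of κ to the
      -- tensor product is applied to both sides.
      form-expansion : Σ[ Z ∈ Vector Carrier n ] ∀ x → ιᴮ (κ x) B.≈ sum (λ i → component i x * Z i)
      form-expansion = (λ i → evaluate (ιᴮ ∘ κ) (proj₁ (unit-vector i))) , λ x →
        B.trans (B.sym (B.trans (+-identityʳ _) (*-identityʳ _)))
          (B.trans (evaluate-cong κ κ-cong κ-+ κ-0 κ-* (φ.injective (expand x)))
            (evaluate-combine (ιᴮ ∘ κ) (λ i → component i x) (proj₁ ∘ unit-vector)))
        where
        expand : ∀ x l → φ (pure x 1#) l B.≈ φ (combine (λ i → component i x) (proj₁ ∘ unit-vector)) l
        expand x l = B.sym (B.trans (φ-evaluate (combine (λ i → component i x) (proj₁ ∘ unit-vector)) l)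
          (B.trans (evaluate-combine (component l) (λ i → component i x) (proj₁ ∘ unit-vector))
          (B.trans (sum-single (_-Algebra.ring B) _ l (λ i i≢l → B.trans (*-congˡ (B.trans (proj₂ (unit-vector i) l)
              (B.reflexive (P.place-≢ 1# i≢l)))) (B.zeroʳ _)))
            (B.trans (*-congˡ (B.trans (proj₂ (unit-vector l) l) (B.reflexive (P.place-≡ l 1#)))) (*-identityʳ _)))))

-- The consequences of splitting that are used: `dual` is the source of approximate idempotents, and
-- `coordinates` makes the rational coordinates of x small when all φᵢ x are small. A coordinate
-- enters through its denominator and numerator, so that the formula speaks of integers only.
record Embeddings (Q : Ring₀) (K : EtaleAlgebra) : Set where
  open RingOps Q
  open EtaleOps K using (module N)
  field
    n     : ℕ
    φ     : Fin n → EtaleAlgebra.Carrier K → Carrier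
    φ-hom : ∀ i → IsHom (EtaleAlgebra.ring K) Q (φ i)
    dual  : ∀ i → Σ[ t ∈ List (EtaleAlgebra.Carrier K × Carrier) ]
      ∀ l → pairing Q (φ l) t ≈ ProductOps.idem {n} (λ _ → Q) i l
    coordinates : ∀ j a → Σ[ Z ∈ Vector Carrier n ] ∀ x {d z} →
      ℚ.↧ (N.coord j (x j) a) ≡ d → ℚ.↥ (N.coord j (x j) a) ≡ z → fromℤ d * sum (λ i → φ i x * Z i) ≈ fromℤ z

module _ (B : ℚ-ring -Algebra) (K : EtaleAlgebra) where
  private
    A : ℚ-ring -Algebra
    A = EtaleAlgebra.algebra K

    open _-Algebra B using () renaming (ring to Q; ι to ιᵛ)
    open TensorForms A B
    open RingOps Q
    open EtaleOps K using (module N)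

  embeddings : ∀ {n} (φ : Tensor.FormalSum A B → Fin n → Carrier) →
    IsRingIsomorphism (Tensor.rawRing A B) (CommutativeRing.rawRing (Π {Fin n} (λ _ → Q))) φ →
    (∀ z i → φ (Tensor.ιʳ A B z) i ≈ z) → Embeddings Q K
  embeddings {n} φ iso φ-ιʳ = record
    { n           = n
    ; φ           = S.component
    ; φ-hom       = S.component-hom
    ; dual        = S.unit-vector
    ; coordinates = λ j a → expansion j a (S.form-expansion (λ x → N.coord j (x j) a) (λ e → N.coord-cong j (e j) a)
        (λ x y → N.coord-+ j (x j) (y j) a) (N.coord-0 j a) (λ r x → N.coord-* j r (x j) a))
    }
    where
    module S = Split φ iso φ-ιʳ
    expansion : ∀ j a → Σ[ Z ∈ Vector Carrier n ] (∀ x → ιᵛ (N.coord j (x j) a) ≈ sum (λ i → S.component i x * Z i)) →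
      Σ[ Z ∈ Vector Carrier n ] ∀ x {d z} →
      ℚ.↧ (N.coord j (x j) a) ≡ d → ℚ.↥ (N.coord j (x j) a) ≡ z → fromℤ d * sum (λ i → S.component i x * Z i) ≈ fromℤ z
    expansion j a (Z , e) = Z , λ x d≡ z≡ → trans (*-congˡ (sym (e x))) (ℚAlgebra.ι-fraction B _ d≡ z≡)

splits⇒embeddings : ∀ {p} (K : EtaleAlgebra) → SplitsCompletely p K → Embeddings (_-Algebra.ring ℚ[ p ]) K
splits⇒embeddings {p} K (φ , iso , φ-ιʳ) = embeddings ℚ[ p ] K φ iso φ-ιʳ

-- From the splitting of K ⊗ ℚₚ to that of 𝒪 ⊗ ℤₚ

module IntegralValuation {p : ℕ} (p-prime : Prime p) {Q : Ring₀} (V : Valued p Q) where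
  open ValuedOps p-prime V

  F-^-cong : ∀ {k x y} → F 0 x → F 0 y → F k (x - y) → ∀ m → F k (x ^ m - y ^ m)
  F-^-cong {k} {x} {y} fx fy f zero = F-resp (solve 1 (λ o → con (+ 0) := o :- o) refl 1#) F-0
  F-^-cong {k} {x} {y} fx fy f (suc m) = F-resp
    (solve 4 (λ x y a b → x :* (a :- b) :+ b :* (x :- y) := x :* a :- y :* b) refl x y (x ^ m) (y ^ m))
    (F-+ (F-*ˡ fx (F-^-cong fx fy f m)) (F-*ˡ (F-^ fy m) f))

  private
    F¹⇒∣ : ∀ z → F 1 (fromℤ z) → + p ∣ z
    F¹⇒∣ z f = ^1-∣ p z (F⇒∣ f)

    -- Tested on an integer r close to y: p ∣ rᵈ gives p ∣ r.
    F-1-power : ∀ {y} d → F 0 y → F 1 (y ^ d) → F 1 y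
    F-1-power {y} d fy f = go (approx fy 1)
      where
      go : Σ[ r ∈ ℤ ] F 1 (y - fromℤ r) → F 1 y
      go (r , g) = F-resp (solve 2 (λ y r → (y :- r) :+ r := y) refl y (fromℤ r)) (F-+ g (∣⇒F (∣-^1 p r p∣r)))
        where
        p∣r : + p ∣ r
        p∣r = ∣-^⇒∣ p-prime r d (F¹⇒∣ (r ℤ.^ d) (F-resp
          (trans (solve 2 (λ a b → a :- (a :- b) := b) refl (y ^ d) (fromℤ r ^ d)) (sym (fromℤ-^ Q r d)))
          (F-minus f (F-^-cong fy (F-ℤ r) g d))))

    F-1-root : ∀ {t y d} (a : Vector ℤ d) → F 1 t → F 0 y → y ^ d + t * sum (λ i → fromℤ (a i) * y ^ toℕ i) ≈ 0# → F 1 y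
    F-1-root {t} {y} {d} a ft fy e = F-1-power d fy (F-resp
      (trans (+-congʳ (sym e)) (solve 2 (λ y s → (y :+ s) :- s := y) refl (y ^ d) (t * sum (λ i → fromℤ (a i) * y ^ toℕ i))))
      (F-minus F-0 (F-*ʳ ft (F-sum (λ i → fromℤ (a i) * y ^ toℕ i) (λ i → F-*ˡ (F-ℤ (a i)) (F-^ fy (toℕ i)))))))

    -- For t = pᶜ⁺¹ the element t q of ℤₚ satisfies (t q)ᵈ + t (...) = 0, so it is divisible by p
    -- and the bound on the denominator of q improves by one power.
    descend : ∀ {q} → Integral Q q → ∀ c → F 0 (fromℤ ((+ p) ℤ.^ suc c) * q) → F 0 (fromℤ ((+ p) ℤ.^ c) * q)
    descend {q} q-int c f = F-p⁻ (F-resp (trans (*-congʳ (fromℤ-* (+ p) ((+ p) ℤ.^ c))) (*-assoc _ _ _))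
      (root (integral-multiple Q ((+ p) ℤ.^ suc c) q-int)))
      where
      t = fromℤ ((+ p) ℤ.^ suc c)
      d = proj₁ q-int
      root : Σ[ a ∈ Vector ℤ d ] (t * q) ^ d + t * sum (λ i → fromℤ (a i) * (t * q) ^ toℕ i) ≈ 0# → F 1 (t * q)
      root (a , e) = F-1-root a (F-≤ (s≤s z≤n) (F-p^ (suc c))) f e

  integral⇒F : ∀ {q} → Integral Q q → F 0 q
  integral⇒F {q} q-int with bounded q
  ... | c , f = go c f
    where
    go : ∀ c → F 0 (fromℤ ((+ p) ℤ.^ c) * q) → F 0 q
    go zero    f = F-resp (trans (*-congʳ fromℤ-1) (*-identityˡ q)) f
    go (suc c) f = go c (descend q-int c f)

δ : ∀ (Q : Ring₀) {n} → Fin n → Fin n → ∣R∣ Q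
δ Q {n} = ProductOps.idem {n} (λ _ → Q)

module _ {p : ℕ} (p-prime : Prime p) {Q : Ring₀} (V : Valued p Q) {O : Ring₀} where
  open ValuedOps p-prime V
  private
    module O = RingOps O

  -- Chinese remaindering with approximate idempotents xᵢ.
  interpolate : ∀ {n} (φ : Fin n → O.Carrier → Carrier) → (∀ i → IsHom O Q (φ i)) →
    ∀ {k} (x : Fin n → O.Carrier) → (∀ i l → F k (φ l (x i) - δ Q i l)) →
    ∀ (r : Fin n → ℤ) l → F k (φ l (O.sum (λ i → O.fromℤ (r i) O.* x i)) - fromℤ (r l))
  interpolate {n} φ φ-hom x x≈δ r l = F-resp (trans (sum-minus (λ i → fromℤ (r i)) (λ i → φ l (x i)) (λ i → δ Q i l))
      (+-cong (sym (trans (φ.h-sum (λ i → O.fromℤ (r i) O.* x i)) (sum-cong-≋ (λ i → trans (φ.*-homo _ (x i)) (*-congʳ (φ.h-fromℤ (r i)))))))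
        (-‿cong (trans
          (sum-single Q (λ i → fromℤ (r i) * δ Q i l) l (λ i i≢l → trans (*-congˡ (reflexive (ProductOps.place-≢ {n} (λ _ → Q) 1# i≢l))) (zeroʳ _)))
          (trans (*-congˡ (reflexive (ProductOps.place-≡ {n} (λ _ → Q) l 1#))) (*-identityʳ _))))))
    (F-sum _ (λ i → F-*ˡ (F-ℤ (r i)) (x≈δ i l)))
    where
    module φ = Hom {O} {Q} (φ-hom l)
    sum-minus : ∀ {k} (a b c : Vector Carrier k) →
      sum (λ i → a i * (b i - c i)) ≈ sum (λ i → a i * b i) - sum (λ i → a i * c i)
    sum-minus {zero}  a b c = solve 0 (con (+ 0) := con (+ 0) :- con (+ 0)) refl
    sum-minus {suc k} a b c = trans (+-congˡ (sum-minus (a ∘ suc) (b ∘ suc) (c ∘ suc)))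
      (solve 5 (λ a b c s t → a :* (b :- c) :+ (s :- t) := (a :* b :+ s) :- (a :* c :+ t)) refl
        (a zero) (b zero) (c zero) (sum (λ i → a (suc i) * b (suc i))) (sum (λ i → a (suc i) * c (suc i))))

-- The primes above a completely split p, each given by the resulting
-- homomorphism O → ℤₚ; φ identifies O ⊗ ℤₚ with ℤₚⁿ.
record Splitting {p : ℕ} {Q : Ring₀} (V : Valued p Q) (O : Ring₀) : Set where
  open RingOps Q
  open Valued V using (F)
  private module O = RingOps O
  field
    n     : ℕ
    φ     : Fin n → O.Carrier → Carrier
    φ-hom : ∀ i → IsHom O Q (φ i)
    φ-int : ∀ i x → F 0 (φ i x)
    idem  : ∀ k i → Σ[ x ∈ O.Carrier ] ∀ l → F k (φ l x - δ Q i l)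
    -- Injectivity of O ⊗ ℤₚ → ℤₚⁿ modulo pᵏ, stated inside O: the factor s prime to p takes the
    -- place of a localisation.
    div   : ∀ k z → (∀ l → F k (φ l z)) →
      Σ[ s ∈ ℤ ] Σ[ w ∈ O.Carrier ] ¬ + p ∣ s × O.fromℤ s O.* z O.≈ O.fromℤ ((+ p) ℤ.^ k) O.* w

-- The isomorphism K ⊗ ℚₚ ≅ ℚₚⁿ compares the lattices 𝒪 ⊗ ℤₚ and ℤₚⁿ only up to bounded powers of p:
-- pᶜ in `idem` and pᵉ in `div`. That 𝒪 is integrally closed, in the form of `saturate`, removes
-- both losses.
record PreSplitting {p : ℕ} {Q : Ring₀} (V : Valued p Q) (O : Ring₀) : Set where
  open RingOps Q
  open Valued V using (F)
  private
    module O = RingOps O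
    P^ : ℕ → ℤ
    P^ k = (+ p) ℤ.^ k
  field
    n        : ℕ
    φ        : Fin n → O.Carrier → Carrier
    φ-hom    : ∀ i → IsHom O Q (φ i)
    φ-int    : ∀ i x → F 0 (φ i x)
    idem     : ∀ i → ∃[ c ] ∀ N → Σ[ y ∈ O.Carrier ] ∀ l → F N (φ l y - fromℤ (P^ c) * δ Q i l)
    div      : ∃[ e ] ∀ k z → (∀ l → F (e ℕ.+ k) (φ l z)) →
      Σ[ s ∈ ℤ ] Σ[ w ∈ O.Carrier ] ¬ + p ∣ s × O.fromℤ s O.* z O.≈ O.fromℤ (P^ k) O.* w
    -- p⁻ᶜ s y is integral, being a root of T² − sT − sw.
    saturate : ∀ c s y w → O.fromℤ s O.* (y O.* y O.- O.fromℤ (P^ c) O.* y) O.≈ O.fromℤ (P^ (c ℕ.+ c)) O.* w →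
      Σ[ x ∈ O.Carrier ] O.fromℤ (P^ c) O.* x O.≈ O.fromℤ s O.* y

module _ {p : ℕ} (p-prime : Prime p) {Q : Ring₀} (V : Valued p Q) {O : Ring₀} (S : PreSplitting V O) where
  private
    module S = PreSplitting S
    module O = RingOps O
    module φ i = Hom {O} {Q} (S.φ-hom i)
    open S using (n; φ; φ-int)
    open ValuedOps p-prime V

    P^ : ℕ → ℤ
    P^ k = (+ p) ℤ.^ k

    φ-fromℤ-* : ∀ l z x → φ l (O.fromℤ z O.* x) ≈ fromℤ z * φ l x
    φ-fromℤ-* l z x = trans (φ.*-homo l _ x) (*-congʳ (φ.h-fromℤ l z))

    δ-int : ∀ i l → F 0 (δ Q i l)
    δ-int i l = helper (i ≟ l)
      where
      helper : Dec (i ≡ l) → F 0 (δ Q i l)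
      helper (yes ≡.refl) = F-resp (reflexive (≡.sym (ProductOps.place-≡ {n} (λ _ → Q) i 1#))) F-1
      helper (no  i≢l)    = F-resp (reflexive (≡.sym (ProductOps.place-≢ {n} (λ _ → Q) 1# i≢l))) F-0

    δ-square : ∀ i l → δ Q i l * δ Q i l ≈ δ Q i l
    δ-square i l = ProductOps.idem-idem {n} (λ _ → Q) i l

    e = proj₁ S.div

    -- As y approximates pᶜ δᵢ, y² - pᶜ y is small and hence, up to a factor s, divisible by p²ᶜ;
    -- `saturate` then divides s y by pᶜ inside O. A factor u inverse to s modulo pᵏ turns s δᵢ into
    -- δᵢ.
    idempotent : ∀ k i → Σ[ x ∈ O.Carrier ] ∀ l → F k (φ l x - δ Q i l)
    idempotent k i = lift (proj₂ (S.idem i) (c ℕ.+ m))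
      where
      c = proj₁ (S.idem i)
      -- The precision c + m covers the e + 2 c that `S.div` consumes on y² - pᶜ y, and leaves at
      -- least k after the division by pᶜ.
      m = (e ℕ.+ c) ℕ.+ k
      Pc = fromℤ (P^ c)
      lift : Σ[ y ∈ O.Carrier ] (∀ l → F (c ℕ.+ m) (φ l y - Pc * δ Q i l)) →
             Σ[ x ∈ O.Carrier ] ∀ l → F k (φ l x - δ Q i l)
      lift (y , approximates) = scale (proj₂ S.div (c ℕ.+ c) q q-small)
        where
        q = y O.* y O.- O.fromℤ (P^ c) O.* y
        q-small : ∀ l → F (e ℕ.+ (c ℕ.+ c)) (φ l q)
        q-small l = F-≤ (ℕ.≤-trans (ℕ.≤-reflexive (≡.trans (≡.sym (ℕ.+-assoc e c c)) (ℕ.+-comm (e ℕ.+ c) c)))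
            (ℕ.+-monoʳ-≤ c (ℕ.m≤m+n (e ℕ.+ c) k)))
          (F-resp (trans
            (trans (solve 3 (λ y t d → (y :- t :* d) :* (y :- t :+ t :* d) :+ (t :* t) :* (d :* d :- d) := y :* y :- t :* y)
              refl (φ l y) Pc (δ Q i l))
              (sym (+-cong (φ.*-homo l y y) (-‿cong (φ-fromℤ-* l (P^ c) y)))))
            (sym (φ.h-minus l _ _)))
            (F-+ (F-*ʳ (approximates l) (F-+ (F-minus (φ-int l y) (F-ℤ (P^ c))) (F-*ˡ (F-ℤ (P^ c)) (δ-int i l))))
              (F-resp (sym (trans (*-congˡ (trans (+-congʳ (δ-square i l)) (-‿inverseʳ _))) (zeroʳ _))) F-0)))
        scale : Σ[ s ∈ ℤ ] Σ[ w ∈ O.Carrier ] ¬ + p ∣ s × O.fromℤ s O.* q O.≈ O.fromℤ (P^ (c ℕ.+ c)) O.* w →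
                Σ[ x ∈ O.Carrier ] ∀ l → F k (φ l x - δ Q i l)
        scale (s , w , p∤s , eq) = unit (S.saturate c s y w eq) (bezout-^ p-prime s p∤s k)
          where
          unit : Σ[ x ∈ O.Carrier ] O.fromℤ (P^ c) O.* x O.≈ O.fromℤ s O.* y →
            Σ[ u ∈ ℤ ] Σ[ v ∈ ℤ ] u ℤ.* s ℤ.+ v ℤ.* P^ k ≡ + 1 →
            Σ[ x ∈ O.Carrier ] ∀ l → F k (φ l x - δ Q i l)
          unit (x , eq′) (u , v , us≡1) = O.fromℤ u O.* x , λ l → F-resp
            (trans (solve 6 (λ u x s d v t → u :* (x :- s :* d) :- v :* t :* d := u :* x :- (u :* s :+ v :* t) :* d) refl
                (fromℤ u) (φ l x) (fromℤ s) (δ Q i l) (fromℤ v) (fromℤ (P^ k)))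
              (+-cong (sym (φ-fromℤ-* l u x)) (-‿cong (trans (*-congʳ one) (*-identityˡ _)))))
            (F-minus (F-*ˡ (F-ℤ u) (F-≤ (ℕ.m≤n+m k (e ℕ.+ c)) (close l))) (F-*ʳ (F-*ˡ (F-ℤ v) (F-p^ k)) (δ-int i l)))
            where
            one : fromℤ u * fromℤ s + fromℤ v * fromℤ (P^ k) ≈ 1#
            one = trans (sym (trans (fromℤ-+ (u ℤ.* s) (v ℤ.* P^ k)) (+-cong (fromℤ-* u s) (fromℤ-* v (P^ k)))))
              (trans (reflexive (≡.cong fromℤ us≡1)) fromℤ-1)
            close : ∀ l → F m (φ l x - fromℤ s * δ Q i l)
            close l = F-p^⁻ c (F-resp (trans
              (solve 4 (λ s y t d → s :* (y :- t :* d) := s :* y :- t :* (s :* d)) refl (fromℤ s) (φ l y) Pc (δ Q i l))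
              (trans (+-congʳ (trans (sym (φ-fromℤ-* l s y)) (trans (φ.⟦⟧-cong l (O.sym eq′)) (φ-fromℤ-* l (P^ c) x))))
                (solve 3 (λ t x d → t :* x :- t :* d := t :* (x :- d)) refl Pc (φ l x) (fromℤ s * δ Q i l))))
              (F-*ˡ (F-ℤ s) (approximates l)))

    -- The loss of pᵉ disappears if pᵏ v is subtracted beforehand, where v ∈ O approximates φₗ z /
    -- pᵏ modulo pᵉ at every l: the remainder is small of order e + k.
    divide : (∀ i → Σ[ x ∈ O.Carrier ] ∀ l → F e (φ l x - δ Q i l)) → ∀ k z → (∀ l → F k (φ l z)) →
      Σ[ s ∈ ℤ ] Σ[ w ∈ O.Carrier ] ¬ + p ∣ s × O.fromℤ s O.* z O.≈ O.fromℤ (P^ k) O.* w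
    divide idempotents k z small = finish (proj₂ S.div k z′ z′-small)
      where
      quotient : ∀ l → Σ[ m ∈ ℤ ] F (e ℕ.+ k) (φ l z - fromℤ (P^ k) * fromℤ m)
      quotient l = go (approx (φ-int l z) (e ℕ.+ k))
        where
        go : Σ[ r ∈ ℤ ] F (e ℕ.+ k) (φ l z - fromℤ r) → Σ[ m ∈ ℤ ] F (e ℕ.+ k) (φ l z - fromℤ (P^ k) * fromℤ m)
        go (r , f) = factor (F⇒∣ (F-resp (solve 2 (λ z r → z :- (z :- r) := r) refl (φ l z) (fromℤ r))
          (F-minus (small l) (F-≤ (ℕ.m≤n+m k e) f))))
          where
          factor : P^ k ∣ r → Σ[ m ∈ ℤ ] F (e ℕ.+ k) (φ l z - fromℤ (P^ k) * fromℤ m)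
          factor (divides m r≡) = m , F-resp (+-congˡ (-‿cong (trans (reflexive (≡.cong fromℤ r≡))
            (trans (fromℤ-* m (P^ k)) (*-comm _ _))))) f
      m : Fin n → ℤ
      m l = proj₁ (quotient l)
      x : Fin n → O.Carrier
      x l = proj₁ (idempotents l)
      v : O.Carrier
      v = O.sum (λ l → O.fromℤ (m l) O.* x l)
      z′ = z O.- O.fromℤ (P^ k) O.* v
      z′-small : ∀ l → F (e ℕ.+ k) (φ l z′)
      z′-small l = F-resp (trans
          (solve 4 (λ z m t s → (z :- t :* m) :+ t :* (m :- s) := z :- t :* s) refl (φ l z) (fromℤ (m l)) (fromℤ (P^ k)) (φ l v))
          (sym (trans (φ.h-minus l z _) (+-congˡ (-‿cong (φ-fromℤ-* l (P^ k) v))))))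
        (F-+ (proj₂ (quotient l))
          (≡.subst (λ i → F i (fromℤ (P^ k) * (fromℤ (m l) - φ l v))) (ℕ.+-comm k e) (F-* (F-p^ k) v-close)))
        where
        v-close : F e (fromℤ (m l) - φ l v)
        v-close = F-resp (solve 2 (λ v m → :- (v :- m) := m :- v) refl (φ l v) (fromℤ (m l)))
          (F-neg (interpolate p-prime V φ S.φ-hom x (λ i → proj₂ (idempotents i)) m l))
      finish : Σ[ s ∈ ℤ ] Σ[ w ∈ O.Carrier ] ¬ + p ∣ s × O.fromℤ s O.* z′ O.≈ O.fromℤ (P^ k) O.* w →
        Σ[ s ∈ ℤ ] Σ[ w ∈ O.Carrier ] ¬ + p ∣ s × O.fromℤ s O.* z O.≈ O.fromℤ (P^ k) O.* w
      finish (s , w , p∤s , eq) = s , w O.+ O.fromℤ s O.* v , p∤s , O.trans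
        (O.solve 4 (λ s z t v → s O.:* z O.:= s O.:* (z O.:- t O.:* v) O.:+ t O.:* (s O.:* v)) O.refl _ z _ v)
        (O.trans (O.+-congʳ eq) (O.sym (O.distribˡ _ _ _)))

  splitting : Splitting V O
  splitting = record
    { n     = n
    ; φ     = φ
    ; φ-hom = S.φ-hom
    ; φ-int = φ-int
    ; idem  = idempotent
    ; div   = divide (idempotent e)
    }

*-left-swap : ∀ a b c → a ℤ.* (b ℤ.* c) ≡ b ℤ.* (a ℤ.* c)
*-left-swap = solve 3 (λ a b c → a :* (b :* c) := b :* (a :* c)) ≡.refl
  where open ℤSolver.+-*-Solver

*-rotate : ∀ a b c → a ℤ.* (b ℤ.* c) ≡ b ℤ.* (c ℤ.* a)
*-rotate = solve 3 (λ a b c → a :* (b :* c) := b :* (c :* a)) ≡.refl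
  where open ℤSolver.+-*-Solver

max-bound : ∀ {n} (T : Fin n → ℕ → Set) → (∀ i {c e} → c ℕ.≤ e → T i c → T i e) →
  (∀ i → ∃[ c ] T i c) → ∃[ c ] ∀ i → T i c
max-bound {zero}  T mono f = 0 , λ ()
max-bound {suc n} T mono f with f zero | max-bound (T ∘ suc) (mono ∘ suc) (f ∘ suc)
... | c , t | e , ts = c ℕ.⊔ e , λ { zero → mono zero (ℕ.m≤m⊔n c e) t ; (suc i) → mono (suc i) (ℕ.m≤n⊔m c e) (ts i) }

module _ (R : Ring₀) where
  open RingOps R

  saturate-integral : ∀ P {u} s y {w} → P * u ≈ 1# → fromℤ s * (y * y - P * y) ≈ (P * P) * w → Integral R w →
    Σ[ x ∈ Carrier ] Integral R x × P * x ≈ fromℤ s * y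
  saturate-integral P {u} s y {w} Pu≈1 e w-int = x ,
    integral-quadratic R x s (integral-* R (integral-fromℤ R s) w-int) (begin
      (S * y * u) * (S * y * u) - S * (S * y * u)
        ≈⟨ solve 4 (λ s y u P → (s :* y :* u) :* (s :* y :* u) :- s :* (s :* y :* u) :=
             (s :* (u :* u)) :* (s :* (y :* y :- P :* y)) :+ (s :* s :* y :* u) :* (P :* u :- con (+ 1))) refl S y u P ⟩
      (S * (u * u)) * (S * (y * y - P * y)) + (S * S * y * u) * (P * u - fromℤ (+ 1))
        ≈⟨ +-cong (*-congˡ e) (trans (*-congˡ (trans (+-cong Pu≈1 (-‿cong fromℤ-1)) (-‿inverseʳ 1#))) (zeroʳ _)) ⟩
      (S * (u * u)) * ((P * P) * w) + 0#
        ≈⟨ solve 4 (λ s u P w → (s :* (u :* u)) :* ((P :* P) :* w) :+ con (+ 0) := (P :* u) :* (P :* u) :* (s :* w)) refl S u P w ⟩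
      (P * u) * (P * u) * (S * w)
        ≈⟨ trans (*-congʳ (trans (*-cong Pu≈1 Pu≈1) (*-identityˡ 1#))) (*-identityˡ _) ⟩
      S * w ∎) ,
    trans (solve 4 (λ P s y u → P :* (s :* y :* u) := (P :* u) :* (s :* y)) refl P S y u) (trans (*-congʳ Pu≈1) (*-identityˡ _))
    where
    S = fromℤ s
    x = S * y * u

module _ (R : Ring₀) where
  private module R = RingOps R

  multiple-≈ : ∀ t a b {x} → R.fromℤ a R.* x R.≈ R.fromℤ b → R.fromℤ (t ℤ.* a) R.* x R.≈ R.fromℤ (t ℤ.* b)
  multiple-≈ t a b e = R.trans (R.*-congʳ (R.fromℤ-* t a)) (R.trans (R.*-assoc _ _ _)
    (R.trans (R.*-congˡ e) (R.sym (R.fromℤ-* t b))))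

  multiple-cancel : (∀ {x y} a → a ≢ + 0 → R.fromℤ a R.* x R.≈ R.fromℤ a R.* y → x R.≈ y) →
    ∀ c a b {x} → c ≢ + 0 → R.fromℤ (c ℤ.* a) R.* x R.≈ R.fromℤ (c ℤ.* b) → R.fromℤ a R.* x R.≈ R.fromℤ b
  multiple-cancel cancel c a b c≢0 e = cancel c c≢0 (R.trans (R.sym (R.*-assoc _ _ _))
    (R.trans (R.*-congʳ (R.sym (R.fromℤ-* c a))) (R.trans e (R.fromℤ-* c b))))

  combine-fractions : ∀ s E D P {k} (c b : Vector R.Carrier k) (r : Vector ℤ k) →
    (∀ a → R.fromℤ (s ℤ.* E) R.* c a R.≈ R.fromℤ (P ℤ.* r a)) →
    R.fromℤ s R.* (R.fromℤ (D ℤ.* E) R.* R.sum (λ a → c a R.* b a)) R.≈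
      R.fromℤ P R.* R.sum (λ a → R.fromℤ (r a) R.* (R.fromℤ D R.* b a))
  combine-fractions s E D P c b r e = R.trans (R.*-congˡ (R.*-congʳ (R.fromℤ-* D E))) (R.trans (go c b r e)
    (R.*-congˡ R.refl))
    where
    go : ∀ {k} (c b : Vector R.Carrier k) (r : Vector ℤ k) → (∀ a → R.fromℤ (s ℤ.* E) R.* c a R.≈ R.fromℤ (P ℤ.* r a)) →
      R.fromℤ s R.* ((R.fromℤ D R.* R.fromℤ E) R.* R.sum (λ a → c a R.* b a)) R.≈
        R.fromℤ P R.* R.sum (λ a → R.fromℤ (r a) R.* (R.fromℤ D R.* b a))
    go {zero}  c b r e = R.solve 4 (λ s d e p → s R.:* ((d R.:* e) R.:* R.con (+ 0)) R.:= p R.:* R.con (+ 0)) R.refl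
      (R.fromℤ s) (R.fromℤ D) (R.fromℤ E) (R.fromℤ P)
    go {suc k} c b r e = R.trans
      (R.solve 6 (λ s d e c b t → s R.:* ((d R.:* e) R.:* (c R.:* b R.:+ t)) R.:= (d R.:* b) R.:* ((s R.:* e) R.:* c) R.:+ s R.:* ((d R.:* e) R.:* t))
        R.refl (R.fromℤ s) (R.fromℤ D) (R.fromℤ E) (c zero) (b zero) (R.sum (λ a → c (suc a) R.* b (suc a))))
      (R.trans (R.+-cong (R.*-congˡ (R.trans (R.*-congʳ (R.sym (R.fromℤ-* s E))) (R.trans (e zero) (R.fromℤ-* P (r zero)))))
          (go (c ∘ suc) (b ∘ suc) (r ∘ suc) (e ∘ suc)))
        (R.solve 5 (λ d b p r t → (d R.:* b) R.:* (p R.:* r) R.:+ p R.:* t R.:= p R.:* (r R.:* (d R.:* b) R.:+ t))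
          R.refl (R.fromℤ D) (b zero) (R.fromℤ P) (R.fromℤ (r zero)) (R.sum (λ a → R.fromℤ (r (suc a)) R.* (R.fromℤ D R.* b (suc a))))))

  scaled-relation : ∀ t s P {x w} → R.fromℤ s R.* x R.≈ P R.* w → R.fromℤ (t ℤ.* s) R.* x R.≈ P R.* (R.fromℤ t R.* w)
  scaled-relation t s P {x} {w} e = R.trans (R.*-congʳ (R.fromℤ-* t s)) (R.trans (R.*-assoc _ _ _) (R.trans (R.*-congˡ e)
    (R.solve 3 (λ t p w → t R.:* (p R.:* w) R.:= p R.:* (t R.:* w)) R.refl (R.fromℤ t) P w)))

  cancel-relation : (∀ {x y} a → a ≢ + 0 → R.fromℤ a R.* x R.≈ R.fromℤ a R.* y → x R.≈ y) →
    ∀ c s E P {F} {x w} → c ≢ + 0 → F ≡ c ℤ.* E →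
    R.fromℤ s R.* (R.fromℤ F R.* x) R.≈ R.fromℤ (c ℤ.* P) R.* w → R.fromℤ (s ℤ.* E) R.* x R.≈ R.fromℤ P R.* w
  cancel-relation cancel c s E P {x = x} {w} c≢0 ≡.refl e = cancel c c≢0 (R.trans
    (R.trans (R.*-congˡ (R.*-congʳ (R.fromℤ-* s E))) (R.trans
      (R.solve 4 (λ c s e x → c R.:* ((s R.:* e) R.:* x) R.:= s R.:* ((c R.:* e) R.:* x)) R.refl (R.fromℤ c) (R.fromℤ s) (R.fromℤ E) x)
      (R.*-congˡ (R.*-congʳ (R.sym (R.fromℤ-* c E))))))
    (R.trans e (R.trans (R.*-congʳ (R.fromℤ-* c P)) (R.*-assoc _ _ _))))

  integral-multiple-of : ∀ t {s x} → Integral R (R.fromℤ s R.* x) → Integral R (R.fromℤ (t ℤ.* s) R.* x)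
  integral-multiple-of t {s} i = integral-resp R (R.trans (R.sym (R.*-assoc _ _ _)) (R.*-congʳ (R.sym (R.fromℤ-* t s))))
    (integral-* R (integral-fromℤ R t) i)

module _ {p : ℕ} (p-prime : Prime p) {Q : Ring₀} (V : Valued p Q) (K : EtaleAlgebra) (E : Embeddings Q K) where
  private
    module E = Embeddings E
    module K = RingOps (EtaleAlgebra.ring K)
    module O = RingOps (EtaleAlgebra.𝒪 K)
    open E using (n; φ)
    module φ i = Hom {EtaleAlgebra.ring K} {Q} (E.φ-hom i)
    open EtaleOps K
    Nᴿ : ∀ j → Ring₀
    Nᴿ j = NumberField.ring (EtaleAlgebra.factor K j)
    module comp i = Hom {EtaleAlgebra.𝒪 K} {Nᴿ i} (comp-hom i)
    module incl′ = Hom {EtaleAlgebra.𝒪 K} {EtaleAlgebra.ring K} incl-hom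
    open ValuedOps p-prime V
    open IntegralValuation p-prime V

    P^ : ℕ → ℤ
    P^ k = (+ p) ℤ.^ k

    P^-+ : ∀ j k → P^ (j ℕ.+ k) ≡ P^ j ℤ.* P^ k
    P^-+ = ℤ.^-distribˡ-+-* (+ p)

    φ′ : Fin n → 𝒪-Carrier → Carrier
    φ′ i x = φ i (incl x)

    φ′-hom : ∀ i → IsHom (EtaleAlgebra.𝒪 K) Q (φ′ i)
    φ′-hom i = mkHom (EtaleAlgebra.𝒪 K) Q (λ e → φ.⟦⟧-cong i e)
      (λ x y → trans (φ.⟦⟧-cong i (incl′.+-homo x y)) (φ.+-homo i (incl x) (incl y)))
      (λ x y → trans (φ.⟦⟧-cong i (incl′.*-homo x y)) (φ.*-homo i (incl x) (incl y)))
      (trans (φ.⟦⟧-cong i incl′.1#-homo) (φ.1#-homo i))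
    module φ′ i = Hom {EtaleAlgebra.𝒪 K} {Q} (φ′-hom i)

    comp-fromℤ-* : ∀ j z x → N._≈_ j (comp j (O.fromℤ z O.* x)) (N._*_ j (N.fromℤ j z) (comp j x))
    comp-fromℤ-* j z x = N.*-congʳ j (comp.h-fromℤ j z)

    φ′-fromℤ-* : ∀ l z x → φ′ l (O.fromℤ z O.* x) ≈ fromℤ z * φ′ l x
    φ′-fromℤ-* l z x = trans (φ′.*-homo l (O.fromℤ z) x) (*-congʳ (φ′.h-fromℤ l z))

  private
    Approximable : List (K.Carrier × Carrier) → Set
    Approximable t = ∃[ c ] ∀ m → Σ[ y ∈ 𝒪-Carrier ] ∀ l → F m (φ′ l y - fromℤ (P^ c) * pairing Q (φ l) t)

    -- A term x ⊗ z equals D x ⊗ z / D with D x ∈ 𝒪, and pᵇ z / D is a p-adic integer, hence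
    -- approximated by integers r. The exponent c is fixed before the precision m, so sharper
    -- approximations cost no larger powers of p.
    approximate : ∀ t → Approximable t
    approximate []            = 0 , λ m → O.0# , λ l → F-resp
      (trans (solve 1 (λ u → con (+ 0) := con (+ 0) :- u :* con (+ 0)) refl (fromℤ (P^ 0))) (+-congʳ (sym (φ′.0#-homo l)))) F-0
    approximate ((x , z) ∷ t) = go (denominator x) (approximate t)
      where
      go : Σ[ D ∈ ℤ ] Σ[ o ∈ 𝒪-Carrier ] D ≢ + 0 × K._≈_ (incl o) (K.fromℤ D K.* x) →
        Approximable t →
        Approximable ((x , z) ∷ t)
      go (D , o , D≢0 , o≈Dx) (c , ys) = invert (inverses D D≢0)
        where
        invert : Σ[ i ∈ Carrier ] fromℤ D * i ≈ 1# →
          Approximable ((x , z) ∷ t)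
        invert (i , Di≈1) = bound (bounded (i * z))
          where
          bound : ∃[ b ] F 0 (fromℤ (P^ b) * (i * z)) →
            Approximable ((x , z) ∷ t)
          bound (b , f) = b ℕ.+ c , λ m → build (approx f m) (ys m)
            where
            build : ∀ {m} → Σ[ r ∈ ℤ ] F m (fromℤ (P^ b) * (i * z) - fromℤ r) →
              (Σ[ y ∈ 𝒪-Carrier ] ∀ l → F m (φ′ l y - fromℤ (P^ c) * pairing Q (φ l) t)) →
              Σ[ y ∈ 𝒪-Carrier ] ∀ l → F m (φ′ l y - fromℤ (P^ (b ℕ.+ c)) * pairing Q (φ l) ((x , z) ∷ t))
            build (r , g) (y , h) = O.fromℤ (P^ c) O.* (O.fromℤ r O.* o) O.+ O.fromℤ (P^ b) O.* y , λ l → F-resp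
              (begin
                - (fromℤ (P^ c) * φ′ l o * (fromℤ (P^ b) * (i * z) - fromℤ r)) + fromℤ (P^ b) * (φ′ l y - fromℤ (P^ c) * s l)
                  ≈⟨ solve 8 (λ c o b i z r y s → :- (c :* o :* (b :* (i :* z) :- r)) :+ b :* (y :- c :* s) :=
                       (c :* (r :* o) :+ b :* y) :- (b :* c) :* ((o :* i) :* z :+ s)) refl
                       (fromℤ (P^ c)) (φ′ l o) (fromℤ (P^ b)) i z (fromℤ r) (φ′ l y) (s l) ⟩
                (fromℤ (P^ c) * (fromℤ r * φ′ l o) + fromℤ (P^ b) * φ′ l y) - (fromℤ (P^ b) * fromℤ (P^ c)) * ((φ′ l o * i) * z + s l)
                  ≈⟨ +-cong
                       (trans (+-cong (trans (*-congˡ (sym (φ′-fromℤ-* l r o))) (sym (φ′-fromℤ-* l (P^ c) (O.fromℤ r O.* o)))) (sym (φ′-fromℤ-* l (P^ b) y)))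
                         (sym (φ′.+-homo l (O.fromℤ (P^ c) O.* (O.fromℤ r O.* o)) (O.fromℤ (P^ b) O.* y))))
                       (-‿cong (*-cong (trans (sym (fromℤ-* (P^ b) (P^ c))) (reflexive (≡.cong fromℤ (≡.sym (P^-+ b c)))))
                         (+-congʳ (*-congʳ (value l))))) ⟩
                φ′ l (O.fromℤ (P^ c) O.* (O.fromℤ r O.* o) O.+ O.fromℤ (P^ b) O.* y) - fromℤ (P^ (b ℕ.+ c)) * (φ l x * z + s l) ∎)
              (F-+ (F-neg (F-*ˡ (F-*ˡ (F-ℤ (P^ c)) (integral⇒F (hom-integral Q (E.φ-hom l) o))) g)) (F-*ˡ (F-ℤ (P^ b)) (h l)))
              where
              s : ∀ l → Carrier
              s l = pairing Q (φ l) t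
              value : ∀ l → φ′ l o * i ≈ φ l x
              value l = trans (*-congʳ (trans (φ.⟦⟧-cong l o≈Dx) (trans (φ.*-homo l _ x) (*-congʳ (φ.h-fromℤ l D)))))
                (trans (solve 3 (λ d x i → (d :* x) :* i := (d :* i) :* x) refl (fromℤ D) (φ l x) i)
                  (trans (*-congʳ Di≈1) (*-identityˡ _)))

    saturate : ∀ c s y w → O._≈_ (O.fromℤ s O.* (y O.* y O.- O.fromℤ (P^ c) O.* y)) (O.fromℤ (P^ (c ℕ.+ c)) O.* w) →
      Σ[ x ∈ 𝒪-Carrier ] O._≈_ (O.fromℤ (P^ c) O.* x) (O.fromℤ s O.* y)
    saturate c s y w e = x , λ j →
      N.trans j (comp-fromℤ-* j (P^ c) x) (N.trans j (proj₂ (proj₂ (X j))) (N.sym j (comp-fromℤ-* j s y)))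
      where
      X : ∀ j → Σ[ x ∈ N.Carrier j ] Integral (Nᴿ j) x ×
        N._≈_ j (N._*_ j (N.fromℤ j (P^ c)) x) (N._*_ j (N.fromℤ j s) (comp j y))
      X j = saturate-integral (Nᴿ j) (N.fromℤ j (P^ c)) s (comp j y) {comp j w}
        (proj₂ (N.integer-inverse j (P^ c) (pow≢0 p-prime c)))
        (N.trans j (N.*-congˡ j (N.+-congˡ j (N.-‿cong j (N.sym j (comp-fromℤ-* j (P^ c) y)))))
          (N.trans j (N.sym j (comp-fromℤ-* j s (y O.* y O.- O.fromℤ (P^ c) O.* y))) (N.trans j (e j)
            (N.trans j (comp-fromℤ-* j (P^ (c ℕ.+ c)) w)
              (N.*-congʳ j (N.trans j (N.reflexive j (≡.cong (N.fromℤ j) (P^-+ c c))) (N.fromℤ-* j (P^ c) (P^ c))))))))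
        (proj₂ (w j))
      x : 𝒪-Carrier
      x j = proj₁ (X j) , proj₁ (proj₂ (X j))

    SmallCoordinate : ∀ j → Fin (N.degree j) → ℤ → ℕ → 𝒪-Carrier → Set
    SmallCoordinate j a E m z = Σ[ s ∈ ℤ ] ¬ + p ∣ s × Σ[ r ∈ ℤ ]
      N._≈_ j (N._*_ j (N.fromℤ j (s ℤ.* E)) (N.ι j (N.coord j (comp j z) a))) (N.fromℤ j (P^ m ℤ.* r))

    -- Coordinates of z ∈ 𝒪 are p-adically small up to the factor E if all φ′ l z are small.
    Good : ∀ j → Fin (N.degree j) → ℤ → Set
    Good j a E = ∀ m z → (∀ l → F m (φ′ l z)) → SmallCoordinate j a E m z

  private
    good-* : ∀ j a {E} t → Good j a E → Good j a (t ℤ.* E)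
    good-* j a {E} t g m z small = go (g m z small)
      where
      go : SmallCoordinate j a E m z → SmallCoordinate j a (t ℤ.* E) m z
      go (s , p∤s , r , e) = s , p∤s , t ℤ.* r , ≡.subst₂
        (λ u v → N._≈_ j (N._*_ j (N.fromℤ j u) (N.ι j (N.coord j (comp j z) a))) (N.fromℤ j v))
        (*-left-swap t s E) (*-left-swap t (P^ m) r) (multiple-≈ (Nᴿ j) t (s ℤ.* E) (P^ m ℤ.* r) e)

    -- The coordinate is Σ φᵢ(z) Zᵢ, and E = pᶜ makes all Zᵢ integral. Of its denominator d = pᶠ d′
    -- the factor d′ becomes s, while pᶠ is cancelled.
    good : ∀ j a → Σ[ E ∈ ℤ ] E ≢ + 0 × Good j a E
    good j a = go (E.coordinates j a)
      where
      go : (Σ[ Z ∈ Vector Carrier n ] ∀ x {d z} → ℚ.↧ (N.coord j (x j) a) ≡ d → ℚ.↥ (N.coord j (x j) a) ≡ z →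
        fromℤ d * sum (λ i → φ i x * Z i) ≈ fromℤ z) → Σ[ E ∈ ℤ ] E ≢ + 0 × Good j a E
      go (Z , expansion) = bound (max-bound (λ i c → F 0 (fromℤ (P^ c) * Z i)) (λ i → bounded-by) (λ i → bounded (Z i)))
        where
        bound : (∃[ c ] ∀ i → F 0 (fromℤ (P^ c) * Z i)) → Σ[ E ∈ ℤ ] E ≢ + 0 × Good j a E
        bound (c , f) = P^ c , pow≢0 p-prime c , λ m z small →
          coordinate m z small (ℚ.↧ q z) (ℚ.↥ q z) (λ ()) ≡.refl ≡.refl
          where
          q : 𝒪-Carrier → ℚ
          q z = N.coord j (comp j z) a
          coordinate : ∀ m z → (∀ l → F m (φ′ l z)) → ∀ d u → d ≢ + 0 → ℚ.↧ q z ≡ d → ℚ.↥ q z ≡ u →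
            SmallCoordinate j a (P^ c) m z
          coordinate m z small d u d≢0 d≡ u≡ = split (valuation p-prime d d≢0)
            where
            T = sum (λ i → φ′ i z * Z i)
            dT≈u : fromℤ d * T ≈ fromℤ u
            dT≈u = expansion (incl z) d≡ u≡
            dq≈u : N._≈_ j (N._*_ j (N.fromℤ j d) (N.ι j (q z))) (N.fromℤ j u)
            dq≈u = N.ι-fraction j (q z) d≡ u≡
            cT-small : F m (fromℤ (P^ c) * T)
            cT-small = F-resp (sym (trans (*-distribˡ-sum (fromℤ (P^ c)) (λ i → φ′ i z * Z i))
                (sum-cong-≋ (λ i → solve 3 (λ c φ z → c :* (φ :* z) := φ :* (c :* z)) refl (fromℤ (P^ c)) (φ′ i z) (Z i)))))
              (F-sum (λ i → φ′ i z * (fromℤ (P^ c) * Z i)) (λ i → F-*ʳ (small i) (f i)))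
            split : (Σ[ f ∈ ℕ ] Σ[ d′ ∈ ℤ ] d ≡ P^ f ℤ.* d′ × ¬ + p ∣ d′) →
              SmallCoordinate j a (P^ c) m z
            split (f , d′ , d≡fd′ , p∤d′) = factor (F⇒∣ {f ℕ.+ m} (F-resp
                (trans (*-congˡ (trans (solve 3 (λ d c t → d :* (c :* t) := c :* (d :* t)) refl (fromℤ d′) (fromℤ (P^ c)) T) refl))
                  (trans (solve 4 (λ f c d t → f :* (c :* (d :* t)) := c :* ((f :* d) :* t)) refl (fromℤ (P^ f)) (fromℤ (P^ c)) (fromℤ d′) T)
                    (trans (*-congˡ (trans (*-congʳ (trans (sym (fromℤ-* (P^ f) d′)) (reflexive (≡.cong fromℤ (≡.sym d≡fd′))))) dT≈u))
                      (sym (fromℤ-* (P^ c) u)))))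
                (F-* (F-p^ f) (F-*ˡ (F-ℤ d′) cT-small))))
              where
              factor : P^ (f ℕ.+ m) ∣ P^ c ℤ.* u → SmallCoordinate j a (P^ c) m z
              factor (divides r e) = d′ , p∤d′ , r , multiple-cancel (Nᴿ j)
                (λ a a≢0 → N.integer-cancel j a a≢0) (P^ f) (d′ ℤ.* P^ c) (P^ m ℤ.* r) (pow≢0 p-prime f)
                (≡.subst₂ (λ a b → N._≈_ j (N._*_ j (N.fromℤ j a) (N.ι j (q z))) (N.fromℤ j b))
                  (≡.trans (≡.cong (P^ c ℤ.*_) d≡fd′) (*-rotate (P^ c) (P^ f) d′))
                  (≡.trans e (≡.trans (≡.cong (r ℤ.*_) (P^-+ f m)) (*-rotate r (P^ f) (P^ m))))
                  (multiple-≈ (Nᴿ j) (P^ c) d u dq≈u))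

    all-good : Σ[ E ∈ ℤ ] E ≢ + 0 × ∀ j a → Good j a E
    all-good = common-multiple (_≢ + 0) (λ ()) ≢0-* (λ j E → ∀ a → Good j a E) (λ j t g a → good-* j a t (g a))
      (λ j → common-multiple (_≢ + 0) (λ ()) ≢0-* (Good j) (λ a t → good-* j a t) (good j))

    integral-basis : Σ[ D ∈ ℤ ] D ≢ + 0 × ∀ j a → Integral (Nᴿ j) (N._*_ j (N.fromℤ j D) (N.basis j a))
    integral-basis = common-multiple (_≢ + 0) (λ ()) ≢0-*
      (λ j D → ∀ a → Integral (Nᴿ j) (N._*_ j (N.fromℤ j D) (N.basis j a))) (λ j t i a → integral-multiple-of (Nᴿ j) t (i a))
      (λ j → common-multiple (_≢ + 0) (λ ()) ≢0-* (λ a D → Integral (Nᴿ j) (N._*_ j (N.fromℤ j D) (N.basis j a)))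
        (λ a t → integral-multiple-of (Nᴿ j) t) (λ a → N.integral-denominator j (N.basis j a)))

  private
    Divides : ℤ → ∀ m (z : 𝒪-Carrier) j → ℤ → Set
    Divides E m z j s = Σ[ w ∈ N.Carrier j ] Integral (Nᴿ j) w ×
      N._≈_ j (N._*_ j (N.fromℤ j s) (N._*_ j (N.fromℤ j E) (comp j z))) (N._*_ j (N.fromℤ j (P^ m)) w)

    WeakDiv : Set
    WeakDiv = Σ[ E ∈ ℤ ] E ≢ + 0 × ∀ m z → (∀ l → F m (φ′ l z)) → Σ[ s ∈ ℤ ] ¬ + p ∣ s × (∀ j → Divides E m z j s)

    -- Expand z in the basis: one factor makes the coordinates divisible by pᵐ up to an integer
    -- prime to p, another makes the basis elements integral.
    weak-div : WeakDiv
    weak-div = go all-good integral-basis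
      where
      go : (Σ[ E ∈ ℤ ] E ≢ + 0 × ∀ j a → Good j a E) →
        (Σ[ D ∈ ℤ ] D ≢ + 0 × ∀ j a → Integral (Nᴿ j) (N._*_ j (N.fromℤ j D) (N.basis j a))) →
        WeakDiv
      go (E , E≢0 , g) (D , D≢0 , b) = D ℤ.* E , ≢0-* D≢0 E≢0 , λ m z small →
        common-multiple (λ s → ¬ + p ∣ s) (∤1 p-prime) (∤-* p-prime) (Divides (D ℤ.* E) m z)
          (λ j {s} t (w , i , e) → N._*_ j (N.fromℤ j t) w , integral-* (Nᴿ j) (integral-fromℤ (Nᴿ j) t) i ,
            scaled-relation (Nᴿ j) t s (N.fromℤ j (P^ m)) e)
          (λ j → assemble m z j (common-multiple (λ s → ¬ + p ∣ s) (∤1 p-prime) (∤-* p-prime) (Fraction′ m z j)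
            (λ a {s} t (r , e) → t ℤ.* r , ≡.subst₂ (λ u v → N._≈_ j (N._*_ j (N.fromℤ j u) (N.ι j (N.coord j (comp j z) a))) (N.fromℤ j v))
              (≡.sym (ℤ.*-assoc t s E)) (*-left-swap t (P^ m) r) (multiple-≈ (Nᴿ j) t (s ℤ.* E) (P^ m ℤ.* r) e))
            (λ a → g j a m z small)))
        where
        Fraction′ : ∀ m (z : 𝒪-Carrier) j → Fin (N.degree j) → ℤ → Set
        Fraction′ m z j a s = Σ[ r ∈ ℤ ]
          N._≈_ j (N._*_ j (N.fromℤ j (s ℤ.* E)) (N.ι j (N.coord j (comp j z) a))) (N.fromℤ j (P^ m ℤ.* r))
        assemble : ∀ m z j → Σ[ s ∈ ℤ ] ¬ + p ∣ s × (∀ a → Fraction′ m z j a s) →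
          Σ[ s ∈ ℤ ] ¬ + p ∣ s × Divides (D ℤ.* E) m z j s
        assemble m z j (s , p∤s , r) = s , p∤s ,
          N.sum j (λ a → N._*_ j (N.fromℤ j (proj₁ (r a))) (N._*_ j (N.fromℤ j D) (N.basis j a))) ,
          integral-sum (Nᴿ j) _ (λ a → integral-* (Nᴿ j) (integral-fromℤ (Nᴿ j) (proj₁ (r a))) (b j a)) ,
          N.trans j (N.*-congˡ j (N.*-congˡ j (proj₂ (NumberField.spanning (EtaleAlgebra.factor K j) (comp j z)))))
            (combine-fractions (Nᴿ j) s E D (P^ m) (λ a → N.ι j (N.coord j (comp j z) a)) (N.basis j) (proj₁ ∘ r) (proj₂ ∘ r))

    Div : Set
    Div = ∃[ e ] ∀ k z → (∀ l → F (e ℕ.+ k) (φ′ l z)) →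
      Σ[ s ∈ ℤ ] Σ[ w ∈ 𝒪-Carrier ] ¬ + p ∣ s × O._≈_ (O.fromℤ s O.* z) (O.fromℤ (P^ k) O.* w)

    -- Only the p-part pᵉ of `E` is a loss; the rest of `E` joins s.
    div : Div
    div = go weak-div
      where
      go : WeakDiv →
        Div
      go (E , E≢0 , f) = reduce (valuation p-prime E E≢0)
        where
        reduce : (Σ[ e ∈ ℕ ] Σ[ E′ ∈ ℤ ] E ≡ P^ e ℤ.* E′ × ¬ + p ∣ E′) → Div
        reduce (e , E′ , E≡ , p∤E′) = e , λ k z small → finish k z (f (e ℕ.+ k) z small)
          where
          finish : ∀ k z → (Σ[ s ∈ ℤ ] ¬ + p ∣ s × (∀ j → Divides E (e ℕ.+ k) z j s)) →
            Σ[ s ∈ ℤ ] Σ[ w ∈ 𝒪-Carrier ] ¬ + p ∣ s × O._≈_ (O.fromℤ s O.* z) (O.fromℤ (P^ k) O.* w)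
          finish k z (s , p∤s , ws) = s ℤ.* E′ , w , ∤-* p-prime p∤s p∤E′ , λ j →
            N.trans j (comp-fromℤ-* j (s ℤ.* E′) z) (N.trans j
              (cancel-relation (Nᴿ j) (λ a a≢0 → N.integer-cancel j a a≢0) (P^ e) s E′ (P^ k) (pow≢0 p-prime e) E≡
                (N.trans j (proj₂ (proj₂ (ws j))) (N.*-congʳ j (N.reflexive j (≡.cong (N.fromℤ j) (P^-+ e k))))))
              (N.sym j (comp-fromℤ-* j (P^ k) w)))
            where
            w : 𝒪-Carrier
            w j = proj₁ (ws j) , proj₁ (proj₂ (ws j))

  preSplitting : PreSplitting V (EtaleAlgebra.𝒪 K)
  preSplitting = record
    { n        = n
    ; φ        = φ′
    ; φ-hom    = φ′-hom
    ; φ-int    = λ i x → integral⇒F (hom-integral Q (E.φ-hom i) x)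
    ; idem     = λ i → approximations i (E.dual i)
    ; div      = div
    ; saturate = saturate
    }
    where
    approximations : ∀ i → (Σ[ t ∈ List (K.Carrier × Carrier) ] ∀ l → pairing Q (φ l) t ≈ δ Q i l) →
      ∃[ c ] ∀ m → Σ[ y ∈ 𝒪-Carrier ] ∀ l → F m (φ′ l y - fromℤ (P^ c) * δ Q i l)
    approximations i (t , e) = proj₁ (approximate t) , λ m → proj₁ (proj₂ (approximate t) m) , λ l →
      F-resp (+-congˡ (-‿cong (*-congˡ (e l)))) (proj₂ (proj₂ (approximate t) m) l)

𝒪-splitting : ∀ {p} (p-prime : Prime p) (K : EtaleAlgebra) → SplitsCompletely p K →
  Splitting (PAdic.ℚₚ-valued p-prime) (EtaleAlgebra.𝒪 K)
𝒪-splitting p-prime K split = splitting p-prime (PAdic.ℚₚ-valued p-prime)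
  (preSplitting p-prime (PAdic.ℚₚ-valued p-prime) K (splits⇒embeddings K split))

-- Compactness and measure in 𝔭-adic completions

·ℚ-mono : ∀ n {q r} → q ℚ.≤ r → n ·ℚ q ℚ.≤ n ·ℚ r
·ℚ-mono zero    q≤r = ℚ.≤-refl
·ℚ-mono (suc n) q≤r = ℚ.+-mono-≤ q≤r (·ℚ-mono n q≤r)

·ℚ-nonNegative : ∀ n {q} → ℚ.0ℚ ℚ.≤ q → ℚ.0ℚ ℚ.≤ n ·ℚ q
·ℚ-nonNegative zero    0≤q = ℚ.≤-refl
·ℚ-nonNegative (suc n) 0≤q = ℚ.+-mono-≤ 0≤q (·ℚ-nonNegative n 0≤q)

·ℚ-mono-< : ∀ n {q r} → q ℚ.< r → suc n ·ℚ q ℚ.< suc n ·ℚ r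
·ℚ-mono-< n q<r = ℚ.+-mono-<-≤ q<r (·ℚ-mono n (ℚ.<⇒≤ q<r))

module AdicTopology {R : Ring₀} (I : Ideal R) where
  open RingOps R
  open Ideal using (member)
  open Adic using (residue; coherent)

  infixl 6 _⊕_
  _⊕_ : Adic I → Adic I → Adic I
  (x ⊕ y) .residue n  = residue x n + residue y n
  (x ⊕ y) .coherent n = mod-+ (I ^ᴵ n) (coherent x n) (coherent y n)

  ⊖_ : Adic I → Adic I
  (⊖ x) .residue n  = - residue x n
  (⊖ x) .coherent n = mod-neg (I ^ᴵ n) (coherent x n)

  power-⊆ : ∀ n {x} → member (I ^ᴵ suc n) x → member (I ^ᴵ n) x
  power-⊆ n (nil e)        = Ideal.resp (I ^ᴵ n) (sym e) (Ideal.0∈ (I ^ᴵ n))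
  power-⊆ n (cons {a = a} _ b s e) = Ideal.resp (I ^ᴵ n) (sym e)
    (Ideal.+∈ (I ^ᴵ n) (Ideal.*∈ (I ^ᴵ n) a b) (power-⊆ n s))

  infix 4 _~[_]_
  _~[_]_ : Adic I → ℕ → Adic I → Set
  x ~[ n ] y = member (I ^ᴵ n) (residue x n - residue y n)

  ~-refl : ∀ n x → x ~[ n ] x
  ~-refl n x = mod-reflexive (I ^ᴵ n) refl

  ~-sym : ∀ {n x y} → x ~[ n ] y → y ~[ n ] x
  ~-sym {n} = mod-sym (I ^ᴵ n)

  ~-trans : ∀ {n x y z} → x ~[ n ] y → y ~[ n ] z → x ~[ n ] z
  ~-trans {n} = mod-trans (I ^ᴵ n)

  ~-+ : ∀ {n x x′ y y′} → x ~[ n ] x′ → y ~[ n ] y′ → (x ⊕ y) ~[ n ] (x′ ⊕ y′)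
  ~-+ {n} = mod-+ (I ^ᴵ n)

  ~-pred : ∀ {n x y} → x ~[ suc n ] y → x ~[ n ] y
  ~-pred {n} {x} {y} p = mod-trans (I ^ᴵ n) (mod-sym (I ^ᴵ n) (coherent x n))
    (mod-trans (I ^ᴵ n) (power-⊆ n p) (coherent y n))

  ~-≤ : ∀ {m n x y} → m ℕ.≤ n → x ~[ n ] y → x ~[ m ] y
  ~-≤ {m} {n} {x} {y} m≤n = go (ℕ.≤⇒≤′ m≤n)
    where
    go : ∀ {n} → m ℕ.≤′ n → x ~[ n ] y → x ~[ m ] y
    go ℕ.≤′-refl     p = p
    go (ℕ.≤′-step {n} l) p = go l (~-pred {n = n} {x = x} {y = y} p)

  Uniform : ℕ → Pred (Adic I) 0ℓ → Set
  Uniform n U = ∀ x y → x ~[ n ] y → U x → U y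

  uniform-≤ : ∀ {m n U} → m ℕ.≤ n → Uniform m U → Uniform n U
  uniform-≤ {m} {n} m≤n u x y p = u x y (~-≤ {m = m} {n = n} {x = x} {y = y} m≤n p)

  open CompactOpen using (set; isOpen; isCompact)

  module _ (∈? : ∀ n x → Dec (member (I ^ᴵ n) x)) where

    -- By compactness U is a finite union of balls.
    uniform : (U : CompactOpen I) → ∃[ n ] Uniform n (set U) × ∀ x → Dec (set U x)
    uniform U = go (isCompact U Centre Ball ball-open (λ x u → (x , u) , ~-refl (radius (x , u)) x))
      where
      Centre : Set
      Centre = Σ (Adic I) (set U)
      radius : Centre → ℕ
      radius (x , u) = proj₁ (isOpen U x u)
      Ball : Centre → Pred (Adic I) 0ℓ
      Ball c y = y ~[ radius c ] proj₁ c
      ball-open : ∀ c → Open I (Ball c)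
      ball-open c y p = radius c , λ z q → ~-trans {n = radius c} {x = z} {y = y} {z = proj₁ c} q p
      ball⊆U : ∀ c y → Ball c y → set U y
      ball⊆U (x , u) y p = proj₂ (isOpen U x u) y p
      some⊆U : ∀ cs y → Any (λ c → Ball c y) cs → set U y
      some⊆U (c ∷ cs) y (here p)  = ball⊆U c y p
      some⊆U (c ∷ cs) y (there p) = some⊆U cs y p
      go : Σ[ cs ∈ List Centre ] (∀ x → set U x → Any (λ c → Ball c x) cs) →
        ∃[ n ] Uniform n (set U) × ∀ x → Dec (set U x)
      go (cs , covers) = bound cs , (λ x y p u → some⊆U cs y (spread cs x y {bound cs} ℕ.≤-refl p (covers x u))) ,
        λ x → map′ (some⊆U cs x) (covers x) (any?ᴸ (λ c → ∈? (radius c) (residue x (radius c) - residue (proj₁ c) (radius c))) cs)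
        where
        bound : List Centre → ℕ
        bound []       = 0
        bound (c ∷ cs) = radius c ℕ.⊔ bound cs
        spread : ∀ cs x y {n} → bound cs ℕ.≤ n → x ~[ n ] y → Any (λ c → Ball c x) cs → Any (λ c → Ball c y) cs
        spread (c ∷ cs) x y {n} b≤n p (here q)  = here (~-trans {n = radius c} {x = y} {y = x} {z = proj₁ c}
          (~-sym {n = radius c} {x = x} {y = y} (~-≤ {m = radius c} {n = n} {x = x} {y = y} (ℕ.≤-trans (ℕ.m≤m⊔n (radius c) (bound cs)) b≤n) p)) q)
        spread (c ∷ cs) x y {n} b≤n p (there q) = there (spread cs x y {n} (ℕ.≤-trans (ℕ.m≤n⊔m (radius c) (bound cs)) b≤n) p q)

  shift-arithmetic : ∀ n {x r t a} → member (I ^ᴵ n) (a - (r - t)) → member (I ^ᴵ n) (x - r) → member (I ^ᴵ n) (t - (x - a))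
  shift-arithmetic n {x} {r} {t} {a} p q = Ideal.resp (I ^ᴵ n)
    (solve 4 (λ x r t a → (a :- (r :- t)) :+ con (ℤ.- + 1) :* (x :- r) := t :- (x :- a)) refl x r t a)
    (Ideal.+∈ (I ^ᴵ n) p (Ideal.*∈ (I ^ᴵ n) (fromℤ (ℤ.- + 1)) q))

  -- An inhabited compact open set contains a ball, and finitely many translates of a ball cover.
  whole-compact : ∀ (U : CompactOpen I) {n} → Uniform n (set U) → ∀ {x₀} → set U x₀ →
    ∀ {P} (rep : Fin P → Carrier) (cell : Carrier → Fin P) → (∀ x → member (I ^ᴵ n) (x - rep (cell x))) →
    Compact I (λ _ → ⊤)
  whole-compact U {n} u {x₀} x₀∈U {P} rep cell cell-rep J V V-open V-covers = union (λ z → translate (shift z))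
    where
    translate : ∀ a → Σ[ js ∈ List J ] (∀ x → set U x → Any (λ j → V j (x ⊕ a)) js)
    translate a = isCompact U J (λ j y → V j (y ⊕ a)) shifted-open (λ x _ → V-covers (x ⊕ a) tt)
      where
      shifted-open : ∀ j → Open I (λ y → V j (y ⊕ a))
      shifted-open j y v = go (V-open j (y ⊕ a) v)
        where
        go : ∃[ m ] (∀ y′ → y′ ~[ m ] (y ⊕ a) → V j y′) → ∃[ m ] (∀ y′ → y′ ~[ m ] y → V j (y′ ⊕ a))
        go (m , b) = m , λ y′ p → b (y′ ⊕ a) (~-+ {n = m} {x = y′} {x′ = y} {y = a} {y′ = a} p (~-refl m a))
    move : ∀ {j x y} → (∀ m → x ~[ m ] y) → V j y → V j x
    move {j} {x} {y} e v = proj₂ (V-open j y v) x (e (proj₁ (V-open j y v)))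
    translated : ∀ x y a js → (∀ m → x ~[ m ] (y ⊕ a)) → Any (λ j → V j (y ⊕ a)) js → Any (λ j → V j x) js
    translated x y a (j ∷ js) e (here v)  = here (move {j} {x} {y ⊕ a} e v)
    translated x y a (j ∷ js) e (there i) = there (translated x y a js e i)
    shift : Fin P → Adic I
    shift z = toCompletion I (rep z) ⊕ (⊖ x₀)
    Piece : Adic I → Set
    Piece a = Σ[ js ∈ List J ] (∀ x → set U x → Any (λ j → V j (x ⊕ a)) js)
    collect : ∀ {m} → (Fin m → List J) → List J
    collect {zero}  f = []
    collect {suc m} f = f zero ++ collect (f ∘ suc)
    collected : ∀ {m} (f : Fin m → List J) i x → Any (λ j → V j x) (f i) → Any (λ j → V j x) (collect f)
    collected f zero    x a = ++⁺ˡ a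
    collected f (suc i) x a = ++⁺ʳ (f zero) (collected (f ∘ suc) i x a)
    covered : ∀ x z {a} → a ~[ n ] shift z → cell (residue x n) ≡ z → (t : Piece a) → Any (λ j → V j x) (proj₁ t)
    covered x z {a} a~ ≡.refl (js , f) = translated x (x ⊕ (⊖ a)) a js
      (λ m → mod-reflexive (I ^ᴵ m) (solve 2 (λ x s → x := (x :- s) :+ s) refl (residue x m) (residue a m)))
      (f (x ⊕ (⊖ a)) (u x₀ (x ⊕ (⊖ a)) (shift-arithmetic n a~ (cell-rep (residue x n))) x₀∈U))
    union : (∀ z → Piece (shift z)) → Σ[ js ∈ List J ] (∀ x → ⊤ → Any (λ j → V j x) js)
    union pieces = collect (λ z → proj₁ (pieces z)) , λ x _ →
      collected (λ z → proj₁ (pieces z)) (cell (residue x n)) x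
        (covered x (cell (residue x n)) {shift (cell (residue x n))} (~-refl n (shift (cell (residue x n)))) ≡.refl (pieces (cell (residue x n))))

  -- A cover of D becomes one of the whole ring by adding the complement of D, indexed by `nothing`.
  clopen : Compact I (λ _ → ⊤) → ∀ {k} D → Uniform k D → (∀ x → Dec (D x)) → CompactOpen I
  clopen compact {k} D uD D? = record
    { set       = D
    ; isOpen    = λ x d → k , λ y p → uD x y (~-sym {n = k} {x = y} {y = x} p) d
    ; isCompact = λ J V V-open V-covers → restrict J V (compact (Maybe J) (V′ J V) (V′-open J V V-open) (λ x _ → V′-covers J V V-covers x))
    }
    where
    V′ : ∀ J → (J → Pred (Adic I) 0ℓ) → Maybe J → Pred (Adic I) 0ℓ
    V′ J V (just j) = V j
    V′ J V nothing  = λ x → ¬ D x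
    V′-open : ∀ J V → (∀ j → Open I (V j)) → ∀ j → Open I (V′ J V j)
    V′-open J V o (just j) = o j
    V′-open J V o nothing  = λ x ¬d → k , λ y p d → ¬d (uD y x p d)
    V′-covers : ∀ J V → (∀ x → D x → ∃[ j ] V j x) → ∀ x → ∃[ j ] V′ J V j x
    V′-covers J V c x with D? x
    ... | yes d = let j , v = c x d in just j , v
    ... | no ¬d = nothing , ¬d
    restrict : ∀ J (V : J → Pred (Adic I) 0ℓ) → Σ[ js ∈ List (Maybe J) ] (∀ x → ⊤ → Any (λ j → V′ J V j x) js) →
      Σ[ js ∈ List J ] (∀ x → D x → Any (λ j → V j x) js)
    restrict J V (js , covers) = catMaybes js , λ x d → go js x d (covers x tt)
      where
      go : ∀ js x → D x → Any (λ j → V′ J V j x) js → Any (λ j → V j x) (catMaybes js)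
      go (just j ∷ js)  x d (here v)  = here v
      go (nothing ∷ js) x d (here ¬d) = contradiction d ¬d
      go (just j ∷ js)  x d (there a) = there (go js x d a)
      go (nothing ∷ js) x d (there a) = go js x d a

  module Cells {k P : ℕ} (rep : Fin P → Carrier) (cell : Carrier → Fin P)
    (cell-rep : ∀ x → member (I ^ᴵ k) (x - rep (cell x)))
    (rep-injective : ∀ a b → member (I ^ᴵ k) (rep a - rep b) → a ≡ b) where

    point : Fin P → Adic I
    point z = toCompletion I (rep z)

    private
      cell-unique : ∀ {x z} → member (I ^ᴵ k) (x - rep z) → cell x ≡ z
      cell-unique {x} {z} p = rep-injective _ _ (mod-trans (I ^ᴵ k) (mod-sym (I ^ᴵ k) (cell-rep x)) p)

      cellᴬ : Adic I → Fin P
      cellᴬ x = cell (residue x k)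

      cellᴬ-cong : ∀ x y → x ~[ k ] y → cellᴬ x ≡ cellᴬ y
      cellᴬ-cong x y p = cell-unique (mod-trans (I ^ᴵ k) p (cell-rep (residue y k)))

      ∈cells : List (Fin P) → Pred (Adic I) 0ℓ
      ∈cells zs x = cellᴬ x ∈ zs

      open import Data.List.Membership.DecPropositional (_≟_ {n = P}) using (_∈?_)
      module _ (compact : Compact I (λ _ → ⊤)) (μ : HaarMeasure I) where
        open HaarMeasure μ

        cells : List (Fin P) → CompactOpen I
        cells zs = clopen compact {k} (∈cells zs) (λ x y p → ≡.subst (_∈ zs) (cellᴬ-cong x y p)) (λ x → cellᴬ x ∈? zs)

        measure-cell : ∀ z z′ → meas (cells (z ∷ [])) ≡ meas (cells (z′ ∷ []))
        measure-cell z z′ = invariant (toCompletion I (rep z - rep z′)) (cells (z′ ∷ [])) (cells (z ∷ []))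
          (λ { x (here ≡.refl) → here (cell-unique (Ideal.resp (I ^ᴵ k)
            (solve 3 (λ a b x → x :- b := ((a :- b) :+ x) :- a) refl (rep z) (rep (cellᴬ x)) (residue x k)) (cell-rep (residue x k)))) })
          (λ { x (here e) → here (cell-unique (Ideal.resp (I ^ᴵ k)
            (solve 3 (λ a b x → ((a :- b) :+ x) :- a := x :- b) refl (rep z) (rep z′) (residue x k))
            (≡.subst (λ w → member (I ^ᴵ k) (((rep z - rep z′) + residue x k) - rep w)) e
              (cell-rep ((rep z - rep z′) + residue x k))))) })

        measure-cells : ∀ z zs → Unique zs → meas (cells zs) ≡ length zs ·ℚ meas (cells (z ∷ []))
        -- The empty set is the disjoint union of itself with itself, so its measure equals its
        -- double.
        measure-cells z [] _ = double (meas (cells [])) (additive (cells []) (cells []) (cells []) (λ x ()) ((λ ()) , λ { (inj₁ ()) ; (inj₂ ()) }))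
          where
          double : ∀ q → q ≡ q ℚ.+ q → q ≡ ℚ.0ℚ
          double q e = GroupProperties.identityʳ-unique ℚ.+-0-group q q (≡.sym e)
        measure-cells z (y ∷ zs) (y∉zs ∷ uniq) = ≡.trans
          (additive (cells (y ∷ [])) (cells zs) (cells (y ∷ zs))
            (λ { x (here e) b → All.lookup y∉zs b (≡.sym e) })
            ((λ { (here e) → inj₁ (here e) ; (there b) → inj₂ b }) , λ { (inj₁ (here e)) → here e ; (inj₂ b) → there b }))
          (≡.cong₂ ℚ._+_ (measure-cell y z) (measure-cells z zs uniq))

        measure-total : ∀ z → P ·ℚ meas (cells (z ∷ [])) ≡ ℚ.1ℚ
        measure-total z = ≡.trans (≡.cong (λ n → n ·ℚ meas (cells (z ∷ []))) (≡.sym (length-tabulate {n = P} (λ (z : Fin P) → z))))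
          (≡.trans (≡.sym (measure-cells z (allFin P) (allFin⁺ P))) (normalised (cells (allFin P)) (λ x → ∈-allFin (cellᴬ x))))

        -- U is a union of cells, which by translation invariance all have measure 1 / P; the factor
        -- P on the left avoids the division.
        measure-count : (U : CompactOpen I) → Uniform k (set U) → (U? : ∀ x → Dec (set U x)) → ∀ z →
          P ·ℚ meas U ≡ length (filter (λ z → U? (point z)) (allFin P)) ·ℚ ℚ.1ℚ
        measure-count U u U? z = ≡.trans (×-congʳ P (≡.trans
            (cong U (cells zs) ((λ {x} x∈U → ∈-filter⁺ (λ z → U? (point z)) (∈-allFin (cellᴬ x)) (u x (point (cellᴬ x)) (cell-rep (residue x k)) x∈U)) ,
              (λ {x} c → u (point (cellᴬ x)) x (mod-sym (I ^ᴵ k) (cell-rep (residue x k))) (proj₂ (∈-filter⁻ (λ z → U? (point z)) {xs = allFin P} c)))))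
            (measure-cells z zs (filter⁺ (λ z → U? (point z)) (allFin⁺ P)))))
          (≡.trans (×-assocˡ β P (length zs)) (≡.trans (≡.cong (_·ℚ β) (ℕ.*-comm P (length zs)))
            (≡.trans (≡.sym (×-assocˡ β (length zs) P)) (×-congʳ (length zs) (measure-total z)))))
          where
          zs = filter (λ z → U? (point z)) (allFin P)
          β = meas (cells (z ∷ []))

    -- An empty U has measure ≥ 0; otherwise compactness of U makes all cells available.
    count≤measure : (μ : HaarMeasure I) (U : CompactOpen I) → Uniform k (set U) → (U? : ∀ x → Dec (set U x)) →
      length (filter (λ z → U? (point z)) (allFin P)) ·ℚ ℚ.1ℚ ℚ.≤ P ·ℚ HaarMeasure.meas μ U
    count≤measure μ U u U? with any? (λ z → U? (point z))
    ... | yes (z , z∈U) = ℚ.≤-reflexive (≡.sym (measure-count (whole-compact U {k} u z∈U rep cell cell-rep) μ U u U? z))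
    ... | no empty = ≡.subst (λ zs → length zs ·ℚ ℚ.1ℚ ℚ.≤ P ·ℚ HaarMeasure.meas μ U)
      (≡.sym (filter-none (λ z → U? (point z)) {allFin P} (All.tabulate (λ {z} _ z∈U → empty (z , z∈U)))))
      (·ℚ-nonNegative P (HaarMeasure.nonNegative μ U))

-- The primes above a completely split prime

-- As u is inverse to a modulo q, z ≡ u (r - b) solves a z + b ≡ r.
inverse-residue : ∀ q a b r u v z → u ℤ.* a ℤ.+ v ℤ.* q ≡ + 1 → q ∣ u ℤ.* (r ℤ.- b) ℤ.- z → q ∣ r ℤ.- (a ℤ.* z ℤ.+ b)
inverse-residue q a b r u v z e (divides t d) = divides (a ℤ.* t ℤ.+ v ℤ.* (r ℤ.- b)) (≡.trans
  (≡.trans (solve 4 (λ a b r z → r :- (a :* z :+ b) := con (+ 1) :* (r :- b) :- a :* z) ≡.refl a b r z)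
    (≡.cong (λ o → o ℤ.* (r ℤ.- b) ℤ.- a ℤ.* z) (≡.sym e)))
  (≡.trans (solve 7 (λ q a b r u v z → (u :* a :+ v :* q) :* (r :- b) :- a :* z := a :* (u :* (r :- b) :- z) :+ v :* (r :- b) :* q)
      ≡.refl q a b r u v z)
    (≡.trans (≡.cong (λ o → a ℤ.* o ℤ.+ v ℤ.* (r ℤ.- b) ℤ.* q) d)
      (solve 6 (λ q a b r v t → a :* (t :* q) :+ v :* (r :- b) :* q := (a :* t :+ v :* (r :- b)) :* q) ≡.refl q a b r v t))))
  where open ℤSolver.+-*-Solver

residue-class : ∀ n .{{_ : ℕ.NonZero n}} u → Σ[ z ∈ Fin n ] + n ∣ u ℤ.- + toℕ z
residue-class n u = fromℕ< (ℤ.n%ℕd<d u n) , divides (u ℤ./ℕ n) (≡.trans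
  (≡.cong₂ (λ a b → a ℤ.- + b) (ℤ.a≡a%ℕn+[a/ℕn]*n u n) (toℕ-fromℕ< (ℤ.n%ℕd<d u n)))
  (solve 2 (λ r q → (r :+ q) :- r := q) ≡.refl (+ (u ℤ.%ℕ n)) (u ℤ./ℕ n ℤ.* + n)))
  where open ℤSolver.+-*-Solver

residue-unique : ∀ {n} (a b : Fin n) → + n ∣ + toℕ a ℤ.- + toℕ b → a ≡ b
residue-unique {n} a b d = toℕ-injective (ℤ.+-injective (ℤ.i-j≡0⇒i≡j (+ toℕ a) (+ toℕ b) (ℤ.∣i∣≡0⇒i≡0
  (small (ℤ.∣ + toℕ a ℤ.- + toℕ b ∣) (∣⇒∣ᵤ d) (ℕ.≤-<-trans
    (≡.subst (λ i → ℤ.∣ i ∣ ℕ.≤ toℕ a ℕ.⊔ toℕ b) (≡.sym (ℤ.m-n≡m⊖n (toℕ a) (toℕ b))) (ℤ.∣m⊝n∣≤m⊔n (toℕ a) (toℕ b)))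
    (ℕ.⊔-lub (toℕ<n a) (toℕ<n b)))))))
  where
  small : ∀ k → n ℕ∣.∣ k → k ℕ.< n → k ≡ 0
  small zero    _ _   = ≡.refl
  small (suc k) d k<n = contradiction d (ℕ∣.>⇒∤ k<n)

module SplitPrimes {p : ℕ} (p-prime : Prime p) {Q : Ring₀} (V : Valued p Q) {O : Ring₀} (S : Splitting V O) where
  open Ideal using (member)
  private
    module O = RingOps O
    module φ i = Hom {O} {Q} (Splitting.φ-hom S i)
  open ValuedOps p-prime V
  open Splitting S public
  open IntegralValuation p-prime V

  private
    P^ : ℕ → ℤ
    P^ k = (+ p) ℤ.^ k

  crt : ∀ k (r : Fin n → ℤ) → Σ[ x ∈ O.Carrier ] ∀ l → F k (φ l x - fromℤ (r l))
  crt k r = O.sum (λ i → O.fromℤ (r i) O.* proj₁ (idem k i)) ,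
    interpolate p-prime V {O} φ φ-hom (λ i → proj₁ (idem k i)) (λ i → proj₂ (idem k i)) r

  φ-fromℤ-* : ∀ l z x → φ l (O.fromℤ z O.* x) ≈ fromℤ z * φ l x
  φ-fromℤ-* l z x = trans (φ.*-homo l _ x) (*-congʳ (φ.h-fromℤ l z))

  idem-≡ : ∀ k i → F k (φ i (proj₁ (idem k i)) - 1#)
  idem-≡ k i = F-resp (+-congˡ (-‿cong (reflexive (ProductOps.place-≡ {n} (λ _ → Q) i 1#)))) (proj₂ (idem k i) i)

  idem-≢ : ∀ k {i l} → i ≢ l → F k (φ l (proj₁ (idem k i)))
  idem-≢ k {i} {l} i≢l = F-resp (trans (+-congˡ (trans (-‿cong (reflexive (ProductOps.place-≢ {n} (λ _ → Q) 1# i≢l))) -0#≈0#))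
    (+-identityʳ _)) (proj₂ (idem k i) l)

  ∤1-F : ¬ F 1 1#
  ∤1-F f = ∤1 p-prime (^1-∣ p (+ 1) (F⇒∣ (F-resp (sym fromℤ-1) f)))

  bezout-member : ∀ (I : Ideal O) {k s z} → ¬ + p ∣ s → member I (O.fromℤ (P^ k)) → member I (O.fromℤ s O.* z) → member I z
  bezout-member I {k} {s} {z} p∤s pᵏ∈I sz∈I = go (bezout-^ p-prime s p∤s k)
    where
    go : Σ[ u ∈ ℤ ] Σ[ v ∈ ℤ ] u ℤ.* s ℤ.+ v ℤ.* P^ k ≡ + 1 → member I z
    go (u , v , e) = Ideal.resp I (O.trans
      (O.solve 5 (λ u s z v t → u O.:* (s O.:* z) O.:+ (v O.:* z) O.:* t O.:= (u O.:* s O.:+ v O.:* t) O.:* z) O.refl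
        (O.fromℤ u) (O.fromℤ s) z (O.fromℤ v) (O.fromℤ (P^ k)))
      (O.trans (O.*-congʳ (O.trans (O.sym (O.trans (O.fromℤ-+ (u ℤ.* s) (v ℤ.* P^ k)) (O.+-cong (O.fromℤ-* u s) (O.fromℤ-* v (P^ k)))))
        (O.trans (O.reflexive (≡.cong O.fromℤ e)) O.fromℤ-1))) (O.*-identityˡ z)))
      (Ideal.+∈ I (Ideal.*∈ I (O.fromℤ u) sz∈I) (Ideal.*∈ I (O.fromℤ v O.* z) pᵏ∈I))

  kernel : Fin n → Ideal O
  kernel i = record
    { member = λ x → F 1 (φ i x)
    ; resp   = λ e → F-resp (φ.⟦⟧-cong i e)
    ; 0∈     = F-resp (sym (φ.0#-homo i)) F-0
    ; +∈     = λ {x} {y} f g → F-resp (sym (φ.+-homo i x y)) (F-+ f g)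
    ; *∈     = λ r {x} f → F-resp (sym (φ.*-homo i r x)) (F-*ˡ (φ-int i r) f)
    }

  p∈kernel : ∀ i → member (kernel i) (O.fromℤ (+ p))
  p∈kernel i = F-resp (sym (φ.h-fromℤ i (+ p))) (∣⇒F (∣-^1 p (+ p) (divides (+ 1) (≡.sym (ℤ.*-identityˡ (+ p))))))

  kernel-proper : ∀ i → ¬ member (kernel i) O.1#
  kernel-proper i f = ∤1-F (F-resp (φ.1#-homo i) f)

  -- Modulo the kernel every x is congruent to an integer r. If x ∈ J is outside the kernel then p ∤
  -- r, so J contains r and p, hence 1.
  kernel-maximal : ∀ i (J : Ideal O) → ¬ member J O.1# → member (kernel i) ⊆ member J → member J ⊆ member (kernel i)
  kernel-maximal i J proper ⊆J {x} x∈J = decidable-stable (F? (φ-int i x) 1) λ x∉ → go x∉ (approx (φ-int i x) 1)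
    where
    go : ¬ F 1 (φ i x) → Σ[ r ∈ ℤ ] F 1 (φ i x - fromℤ r) → ⊥
    go x∉ (r , f) = proper (bezout-member J {1} {r} {O.1#} p∤r
        (⊆J (F-resp (sym (φ.h-fromℤ i (P^ 1))) (F-p^ 1)))
        (Ideal.resp J (O.solve 3 (λ x r o → x O.:+ O.con (ℤ.- + 1) O.:* (x O.:- r O.:* o) O.:= r O.:* o) O.refl x (O.fromℤ r) O.1#)
          (Ideal.+∈ J x∈J (Ideal.*∈ J (O.fromℤ (ℤ.- + 1)) (⊆J {x O.- O.fromℤ r O.* O.1#} (F-resp
            (sym (trans (φ.h-minus i x _) (+-congˡ (-‿cong (trans (φ-fromℤ-* i r O.1#) (trans (*-congˡ (φ.1#-homo i)) (*-identityʳ _))))))) f))))))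
      where
      p∤r : ¬ + p ∣ r
      p∤r d = x∉ (F-resp (solve 2 (λ x r → (x :- r) :+ r := x) refl (φ i x) (fromℤ r)) (F-+ f (∣⇒F (∣-^1 p r d))))

  prime : Fin n → MaximalIdeal O
  prime i = record { ideal = kernel i ; proper = kernel-proper i ; maximal = kernel-maximal i }

  kernel-injective : ∀ {i l} → (∀ {x} → member (kernel l) x → member (kernel i) x) → i ≡ l
  kernel-injective {i} {l} l⊆i = decidable-stable (i ≟ l) λ i≢l → ∤1-F (F-resp
    (solve 2 (λ x o → x :- (x :- o) := o) refl (φ i (proj₁ (idem 1 i))) 1#)
    (F-minus (l⊆i {proj₁ (idem 1 i)} (idem-≢ 1 i≢l)) (idem-≡ 1 i)))

  private
    ¬¬-all : ∀ {m} {A : Fin m → Set} → (∀ i → ¬ ¬ A i) → ¬ ¬ (∀ i → A i)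
    ¬¬-all {zero}  f k = k λ ()
    ¬¬-all {suc m} f k = f zero λ a → ¬¬-all (f ∘ suc) λ as → k λ { zero → a ; (suc i) → as i }

    ideal-sum : (I : Ideal O) → ∀ {m} (v : Fin m → O.Carrier) → (∀ i → member I (v i)) → member I (O.sum v)
    ideal-sum I {zero}  v f = Ideal.0∈ I
    ideal-sum I {suc m} v f = Ideal.+∈ I (f zero) (ideal-sum I (v ∘ suc) (f ∘ suc))

  -- If no kernel lies in J, all idempotents modulo p lie in J, and then so does their sum 1.
  kernel⊆maximal : (J : MaximalIdeal O) → member (MaximalIdeal.ideal J) (O.fromℤ (+ p)) →
    ¬ ¬ (Σ[ i ∈ Fin n ] (∀ {x} → member (kernel i) x → member (MaximalIdeal.ideal J) x))
  -- An eᵢ outside J would yield a kernel inside J, against `none`; so each eᵢ lies in J up to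
  -- double negation.
  kernel⊆maximal J p∈J none = ¬¬-all {A = λ i → member I (e i)} (λ i e∉J → none (i , λ {x} → e∉J⇒kernel⊆J i e∉J {x})) λ e∈J →
    MaximalIdeal.proper J (Ideal.resp I (O.solve 2 (λ o v → (o O.:- v) O.:+ v O.:= o) O.refl O.1# v) (Ideal.+∈ I
      (∩⊆J (λ l → F-resp (trans (solve 3 (λ o v r → (o :- r) :- (v :- r) := o :- v) refl 1# (φ l v) (fromℤ (+ 1)))
          (sym (trans (φ.h-minus l O.1# v) (+-congʳ (φ.1#-homo l)))))
        (F-minus (F-resp (sym (trans (+-congˡ (-‿cong fromℤ-1)) (-‿inverseʳ 1#))) F-0)
          (interpolate p-prime V {O} φ φ-hom e (λ i → proj₂ (idem 1 i)) (λ _ → + 1) l))))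
      (ideal-sum I (λ i → O.fromℤ (+ 1) O.* e i) (λ i → Ideal.*∈ I (O.fromℤ (+ 1)) (e∈J i)))))
    where
    I = MaximalIdeal.ideal J
    e : Fin n → O.Carrier
    e i = proj₁ (idem 1 i)
    v = O.sum (λ i → O.fromℤ (+ 1) O.* e i)
    p¹∈I : member I (O.fromℤ (P^ 1))
    p¹∈I = ≡.subst (λ z → member I (O.fromℤ z)) (≡.sym (ℤ.*-identityʳ (+ p))) p∈J
    ∩⊆J : ∀ {z} → (∀ l → F 1 (φ l z)) → member I z
    ∩⊆J {z} f = go (div 1 z f)
      where
      go : Σ[ s ∈ ℤ ] Σ[ w ∈ O.Carrier ] ¬ + p ∣ s × O.fromℤ s O.* z O.≈ O.fromℤ (P^ 1) O.* w → member I z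
      go (s , w , p∤s , eq) = bezout-member I {1} p∤s p¹∈I (Ideal.resp I (O.trans (O.*-comm w _) (O.sym eq)) (Ideal.*∈ I w p¹∈I))
    -- The colon ideal (J : eᵢ) contains J and is proper because eᵢ ∉ J, so it equals J. It contains
    -- the i-th kernel: for x in that kernel, eᵢ x is divisible by p at every l.
    e∉J⇒kernel⊆J : ∀ i → ¬ member I (e i) → ∀ {x} → member (kernel i) x → member I x
    e∉J⇒kernel⊆J i e∉J {x} x∈ = MaximalIdeal.maximal J quotient (λ e1 → e∉J (Ideal.resp I (O.*-identityʳ (e i)) e1))
      (λ {y} → Ideal.*∈ I (e i) {y}) {x} (∩⊆J {e i O.* x} λ l → F-resp (sym (φ.*-homo l (e i) x)) (small l (i ≟ l)))
      where
      quotient : Ideal O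
      quotient = record
        { member = λ y → member I (e i O.* y)
        ; resp   = λ y≈z → Ideal.resp I (O.*-congˡ y≈z)
        ; 0∈     = Ideal.resp I (O.sym (O.zeroʳ (e i))) (Ideal.0∈ I)
        ; +∈     = λ f g → Ideal.resp I (O.sym (O.distribˡ (e i) _ _)) (Ideal.+∈ I f g)
        ; *∈     = λ r {y} f → Ideal.resp I (O.solve 3 (λ r e y → r O.:* (e O.:* y) O.:= e O.:* (r O.:* y)) O.refl r (e i) y) (Ideal.*∈ I r f)
        }
      small : ∀ l → Dec (i ≡ l) → F 1 (φ l (e i) * φ l x)
      small l (yes ≡.refl) = F-*ˡ (φ-int l (e l)) x∈
      small l (no  i≢l)    = F-*ʳ (idem-≢ 1 i≢l) (φ-int l x)

  -- I is any ideal with the same members as the i-th kernel: the measures are given on an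
  -- enumeration of the primes, which agree with the kernels only extensionally.
  module Powers (i : Fin n) (I : Ideal O) (I⊆ : ∀ {x} → member I x → F 1 (φ i x)) (⊆I : ∀ {x} → F 1 (φ i x) → member I x) where

    power⇒F : ∀ k {x} → member (I ^ᴵ k) x → F k (φ i x)
    power⇒F zero    {x} _ = φ-int i x
    power⇒F (suc k) m = go m
      where
      go : ∀ {x} → ProductMember I (I ^ᴵ k) x → F (suc k) (φ i x)
      go (nil e) = F-resp (sym (trans (φ.⟦⟧-cong i e) (φ.0#-homo i))) F-0
      go (cons {a = a} {b = b} {s = s} a∈ b∈ s∈ e) = F-resp
        (sym (trans (φ.⟦⟧-cong i e) (trans (φ.+-homo i (a O.* b) s) (+-congʳ (φ.*-homo i a b)))))
        (F-+ (F-* (I⊆ a∈) (power⇒F k b∈)) (go s∈))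

    private
      power-∈ : ∀ {b} → member I b → ∀ k → member (I ^ᴵ k) (b O.^ k)
      power-∈ b∈ zero    = tt
      power-∈ b∈ (suc k) = cons b∈ (power-∈ b∈ k) (nil O.refl) (O.sym (O.+-identityʳ _))

      pᵏ∈ : ∀ k → member (I ^ᴵ k) (O.fromℤ (P^ k))
      pᵏ∈ k = Ideal.resp (I ^ᴵ k) (O.sym (fromℤ-^ O (+ p) k)) (power-∈ (⊆I (p∈kernel i)) k)

    -- With x ≡ δᵢ modulo pᵏ, multiplication by 1 − (1 − x)ᵏ kills the other components and is 1 modulo Iᵏ.
    F⇒power : ∀ k {x} → F k (φ i x) → member (I ^ᴵ k) x
    F⇒power zero    _ = tt
    F⇒power k@(suc _) {x} f = Ideal.resp (I ^ᴵ k)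
      (O.solve 3 (λ x o b → x O.:* (o O.:- b) O.:+ (x O.:* b O.:+ x O.:* (O.con (+ 1) O.:- o)) O.:= x O.:* O.con (+ 1)) O.refl x O.1# (b O.^ k) ⟨≈⟩ O.*-congˡ O.fromℤ-1 ⟨≈⟩ O.*-identityʳ x)
      (Ideal.+∈ (I ^ᴵ k) main (Ideal.+∈ (I ^ᴵ k) (Ideal.*∈ (I ^ᴵ k) x (power-∈ b∈I k))
        (Ideal.resp (I ^ᴵ k) (O.sym (O.trans (O.*-congˡ (O.trans (O.+-congʳ O.fromℤ-1) (O.-‿inverseʳ O.1#))) (O.zeroʳ x))) (Ideal.0∈ (I ^ᴵ k)))))
      where
      infixl 4 _⟨≈⟩_
      _⟨≈⟩_ : ∀ {a b c} → a O.≈ b → b O.≈ c → a O.≈ c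
      _⟨≈⟩_ = O.trans
      e = proj₁ (idem k i)
      b = O.1# O.- e
      φb : ∀ l → φ l b ≈ 1# - φ l e
      φb l = trans (φ.h-minus l O.1# e) (+-congʳ (φ.1#-homo l))
      b∈I : member I b
      b∈I = ⊆I (F-≤ {1} {k} (s≤s z≤n) (F-resp (sym (trans (φb i) (solve 2 (λ o e → o :- e := :- (e :- o)) refl 1# (φ i e))))
        (F-neg (idem-≡ k i))))
      main : member (I ^ᴵ k) (x O.* (O.1# O.- b O.^ k))
      main = go (div k (x O.* (O.1# O.- b O.^ k)) λ l → F-resp (sym (φ.*-homo l x _)) (small l (i ≟ l)))
        where
        go : Σ[ s ∈ ℤ ] Σ[ w ∈ O.Carrier ] ¬ + p ∣ s × O.fromℤ s O.* (x O.* (O.1# O.- b O.^ k)) O.≈ O.fromℤ (P^ k) O.* w →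
          member (I ^ᴵ k) (x O.* (O.1# O.- b O.^ k))
        go (s , w , p∤s , eq) = bezout-member (I ^ᴵ k) {k} p∤s (pᵏ∈ k)
          (Ideal.resp (I ^ᴵ k) (O.trans (O.*-comm w _) (O.sym eq)) (Ideal.*∈ (I ^ᴵ k) w (pᵏ∈ k)))
        1^ : ∀ m → 1# ^ m ≈ 1#
        1^ zero    = refl
        1^ (suc m) = trans (*-identityˡ _) (1^ m)
        small : ∀ l → Dec (i ≡ l) → F k (φ l x * φ l (O.1# O.- b O.^ k))
        small l (yes ≡.refl) = F-*ʳ f (φ-int l _)
        small l (no  i≢l)    = F-*ˡ (φ-int l x) (F-resp
          (trans (+-cong (1^ k) (-‿cong (trans (^-congˡ k (sym (φb l))) (sym (φ.h-^ l b k)))))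
            (sym (trans (φ.h-minus l O.1# (b O.^ k)) (+-congʳ (φ.1#-homo l)))))
          (F-^-cong F-1 (F-minus F-1 (φ-int l e)) (F-resp (solve 2 (λ o e → e := o :- (o :- e)) refl 1# (φ l e)) (idem-≢ k i≢l)) k))

    power? : ∀ k x → Dec (member (I ^ᴵ k) x)
    power? k x = map′ (F⇒power k) (power⇒F k) (F? (φ-int i x) k)

    open AdicTopology I using (Uniform; module Cells)
    open CompactOpen using (set)

    -- The residues az + b, 0 ≤ z < pᵏ, represent O/Iᵏ ≅ ℤ/pᵏ.
    cell-count : ∀ k a b → ¬ + p ∣ a → (μ : HaarMeasure I) (U : CompactOpen I) → Uniform k (set U) →
      (U? : ∀ x → Dec (set U x)) →
      length (filter (λ z → U? (toCompletion I (O.fromℤ (a ℤ.* + toℕ z ℤ.+ b)))) (allFin (p ℕ.^ k))) ·ℚ ℚ.1ℚ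
        ℚ.≤ (p ℕ.^ k) ·ℚ HaarMeasure.meas μ U
    cell-count k a b p∤a = Cells.count≤measure {k} {p ℕ.^ k} rep (λ x → proj₁ (cell x)) (λ x → F⇒power k (proj₂ (cell x)))
      (λ z z′ z≡z′ → residue-unique z z′ (≡.subst (_∣ + toℕ z ℤ.- + toℕ z′) (≡.sym (pos-^ p k))
        (^-∣-cancel p-prime a p∤a k (+ toℕ z ℤ.- + toℕ z′) (F⇒∣ (F-resp (difference z z′) (power⇒F k z≡z′))))))
      where
      value : Fin (p ℕ.^ k) → ℤ
      value z = a ℤ.* + toℕ z ℤ.+ b
      rep : Fin (p ℕ.^ k) → O.Carrier
      rep z = O.fromℤ (value z)
      fromℤ-minus : ∀ x y → fromℤ (x ℤ.- y) ≈ fromℤ x - fromℤ y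
      fromℤ-minus x y = trans (fromℤ-+ x (ℤ.- y)) (+-congˡ (fromℤ-neg y))
      difference : ∀ z z′ → φ i (rep z O.- rep z′) ≈ fromℤ (a ℤ.* (+ toℕ z ℤ.- + toℕ z′))
      difference z z′ = trans (trans (φ.h-minus i (rep z) (rep z′)) (+-cong (φ.h-fromℤ i (value z)) (-‿cong (φ.h-fromℤ i (value z′)))))
        (trans (sym (fromℤ-minus (value z) (value z′))) (reflexive (≡.cong fromℤ (identity a b (+ toℕ z) (+ toℕ z′)))))
        where
        identity : ∀ a b x y → (a ℤ.* x ℤ.+ b) ℤ.- (a ℤ.* y ℤ.+ b) ≡ a ℤ.* (x ℤ.- y)
        identity = ℤS.solve 4 (λ a b x y → (a ℤS.:* x ℤS.:+ b) ℤS.:- (a ℤS.:* y ℤS.:+ b) ℤS.:= a ℤS.:* (x ℤS.:- y)) ≡.refl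
          where module ℤS = ℤSolver.+-*-Solver
      cell : ∀ x → Σ[ z ∈ Fin (p ℕ.^ k) ] F k (φ i (x O.- rep z))
      cell x = go (approx (φ-int i x) k) (bezout-^ p-prime a p∤a k)
        where
        go : Σ[ r ∈ ℤ ] F k (φ i x - fromℤ r) → Σ[ u ∈ ℤ ] Σ[ v ∈ ℤ ] u ℤ.* a ℤ.+ v ℤ.* P^ k ≡ + 1 →
          Σ[ z ∈ Fin (p ℕ.^ k) ] F k (φ i (x O.- rep z))
        go (r , f) (u , v , e) = found (residue-class (p ℕ.^ k) {{ℕ.m^n≢0 p k {{ℕ.nonTrivial⇒nonZero p {{prime⇒nonTrivial p-prime}}}}}} (u ℤ.* (r ℤ.- b)))
          where
          found : Σ[ z ∈ Fin (p ℕ.^ k) ] + (p ℕ.^ k) ∣ u ℤ.* (r ℤ.- b) ℤ.- + toℕ z → Σ[ z ∈ Fin (p ℕ.^ k) ] F k (φ i (x O.- rep z))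
          found (z , d) = z , F-resp
            (trans (solve 3 (λ x r s → (x :- r) :+ (r :- s) := x :- s) refl (φ i x) (fromℤ r) (fromℤ (value z)))
              (sym (trans (φ.h-minus i x (rep z)) (+-congˡ (-‿cong (φ.h-fromℤ i (value z)))))))
            (F-+ f (F-resp (fromℤ-minus r (value z)) (∣⇒F (inverse-residue (P^ k) a b r u v (+ toℕ z) e
              (≡.subst (_∣ u ℤ.* (r ℤ.- b) ℤ.- + toℕ z) (pos-^ p k) d)))))

-- The sieve argument modulo p

module _ (R S : Ring₀) {f : ∣R∣ R → ∣R∣ S} (f-cong : ∀ {x y} → CommutativeRing._≈_ R x y → CommutativeRing._≈_ S (f x) (f y))
  (f-+ : ∀ x y → CommutativeRing._≈_ S (f (CommutativeRing._+_ R x y)) (CommutativeRing._+_ S (f x) (f y))) where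
  private module R = RingOps R
  open RingOps S

  additive-0 : f R.0# ≈ 0#
  additive-0 = trans (solve 1 (λ x → x := (x :+ x) :- x) refl (f R.0#))
    (trans (+-congʳ (trans (sym (f-+ R.0# R.0#)) (f-cong (R.+-identityˡ R.0#)))) (-‿inverseʳ _))

  additive-neg : ∀ x → f (R.- x) ≈ - f x
  additive-neg x = trans (solve 2 (λ x y → y := (y :+ x) :- x) refl (f x) (f (R.- x)))
    (trans (+-congʳ (trans (sym (f-+ (R.- x) x)) (trans (f-cong (R.-‿inverseˡ x)) additive-0))) (+-identityˡ _))

  additive-minus : ∀ x y → f (x R.- y) ≈ f x - f y
  additive-minus x y = trans (f-+ x (R.- y)) (+-congˡ (additive-neg y))

  additive-fromℤ : ∀ z x → f (R.fromℤ z R.* x) ≈ fromℤ z * f x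
  additive-fromℤ (+ n) x = go n
    where
    go : ∀ n → f (R.fromℤ (+ n) R.* x) ≈ fromℤ (+ n) * f x
    go zero    = trans (f-cong (R.zeroˡ x)) (trans additive-0 (sym (zeroˡ (f x))))
    go (suc n) = trans (f-cong (R.trans (R.distribʳ x _ _) (R.+-congʳ (R.*-identityˡ x)))) (trans (f-+ x _)
      (trans (+-cong (sym (*-identityˡ (f x))) (go n)) (sym (distribʳ (f x) _ _))))
  additive-fromℤ (-[1+ n ]) x = trans (f-cong (R.solve 2 (λ a x → (R.:- a) R.:* x R.:= R.:- (a R.:* x)) R.refl (R.fromℤ (+ suc n)) x))
    (trans (additive-neg _) (trans (-‿cong (additive-fromℤ (+ suc n) x))
      (solve 2 (λ a x → :- (a :* x) := (:- a) :* x) refl (fromℤ (+ suc n)) (f x))))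

  additive-sum : ∀ {n} (v : Vector R.Carrier n) → f (R.sum v) ≈ sum (f ∘ v)
  additive-sum {zero}  v = additive-0
  additive-sum {suc n} v = trans (f-+ _ _) (+-congˡ (additive-sum (v ∘ suc)))

-- f stands for the composite of A with a homomorphism O_L → ℤₚ, c for its value at a point of the
-- image lying in S, and Bad i for R at the i-th prime.
module Sieving {p : ℕ} (p-prime : Prime p) {Q : Ring₀} (V : Valued p Q) {O : Ring₀} (S : Splitting V O)
  {f : ∣R∣ O → ∣R∣ Q} (f-cong : ∀ {x y} → CommutativeRing._≈_ O x y → CommutativeRing._≈_ Q (f x) (f y))
  (f-+ : ∀ x y → CommutativeRing._≈_ Q (f (CommutativeRing._+_ O x y)) (CommutativeRing._+_ Q (f x) (f y)))
  (f-int : ∀ x → Valued.F V 0 (f x)) (k : ℕ)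
  (Bad : Fin (Splitting.n S) → Pred ℤ 0ℓ)
  (avoid : ∀ i → Σ[ r ∈ ℤ ] ¬ Bad i r)
  (avoid₂ : ∀ {i l} → i ≢ l → ∀ a b → ¬ + p ∣ a → Σ[ z ∈ ℤ ] ¬ Bad i z × ¬ Bad l (a ℤ.* z ℤ.+ b))
  {c : ∣R∣ Q} (c-int : Valued.F V 0 c)
  (escape : ∀ x (r : Fin (Splitting.n S) → ℤ) →
    (∀ l → Valued.F V (suc k) (CommutativeRing._-_ Q (Splitting.φ S l x) (Integers.fromℤ Q (r l)))) →
    (∀ l → ¬ Bad l (r l)) → ¬ Valued.F V (suc k) (CommutativeRing._-_ Q (f x) c)) where
  open SplitPrimes p-prime V S
  open ValuedOps p-prime V
  private
    module O = RingOps O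
    module φ i = Hom {O} {Q} (φ-hom i)

    f-fromℤ : ∀ z x → f (O.fromℤ z O.* x) ≈ fromℤ z * f x
    f-fromℤ = additive-fromℤ O Q f-cong f-+

    f-minus : ∀ x y → f (x O.- y) ≈ f x - f y
    f-minus = additive-minus O Q f-cong f-+

    m = suc k

    e : Fin n → O.Carrier
    e i = proj₁ (idem m i)

  -- Some x avoids all bad residues. Were f zero modulo pᵐ, f x and c would both be small, against
  -- `escape`.
  nonvanishing : F m c → ¬ (∀ x → F m (f x))
  nonvanishing fc f≈0 = escape (proj₁ (crt m r)) r (proj₂ (crt m r)) (λ l → proj₂ (avoid l)) (F-minus (f≈0 _) fc)
    where
    r : Fin n → ℤ
    r l = proj₁ (avoid l)

  -- f is additive, hence ℤ-linear: s x = pᵐ w gives s f x = pᵐ f w, and s is a unit. So f modulo pᵐ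
  -- depends only on the φₗ modulo pᵐ.
  f-small : ∀ {x} → (∀ l → F m (φ l x)) → F m (f x)
  f-small {x} small = go (div m x small)
    where
    go : Σ[ s ∈ ℤ ] Σ[ w ∈ O.Carrier ] ¬ + p ∣ s × O.fromℤ s O.* x O.≈ O.fromℤ ((+ p) ℤ.^ m) O.* w → F m (f x)
    go (s , w , p∤s , eq) = F-unit p∤s (F-resp (trans (sym (f-fromℤ ((+ p) ℤ.^ m) w)) (trans (f-cong (O.sym eq)) (f-fromℤ s x)))
      (F-*ʳ (F-p^ m) (f-int w)))

  module _ (α : Fin n → Carrier) (α≡ : ∀ i → f (e i) ≈ α i) where

    f-expansion : ∀ x (r : Fin n → ℤ) → (∀ l → F m (φ l x - fromℤ (r l))) → F m (f x - sum (λ i → fromℤ (r i) * α i))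
    f-expansion x r close = F-resp
      (trans (f-minus x v) (+-congˡ (-‿cong (trans (additive-sum O Q f-cong f-+ (λ i → O.fromℤ (r i) O.* e i))
        (sum-cong-≋ (λ i → trans (f-fromℤ (r i) (e i)) (*-congˡ (α≡ i))))))))
      (f-small {x O.- v} λ l → F-resp
        (trans (solve 3 (λ x v r → (x :- r) :- (v :- r) := x :- v) refl (φ l x) (φ l v) (fromℤ (r l))) (sym (φ.h-minus l x v)))
        (F-minus (close l) (proj₂ (crt m r) l)))
      where
      v = proj₁ (crt m r)

    private
      α-int : ∀ i → F 0 (α i)
      α-int i = F-resp (α≡ i) (f-int (e i))

      p∤approx : ∀ {x a} → ¬ F 1 x → F m (x - fromℤ a) → ¬ + p ∣ a
      p∤approx {x} {a} ¬f g d = ¬f (F-resp (solve 2 (λ x r → (x :- r) :+ r := x) refl x (fromℤ a))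
        (F-+ (F-≤ {1} {m} (s≤s z≤n) g) (∣⇒F (∣-^1 p a d))))

    -- Two unit coefficients αᵢ, αₗ would allow to solve f x ≡ c with x outside all bad sets.
    orthogonal : ∀ {i l} → i ≢ l → F 1 (α i * α l)
    orthogonal {i} {l} i≢l = decidable-stable (F? (F-*ˡ (α-int i) (α-int l)) 1) λ ¬f →
      contra (λ fi → ¬f (F-*ʳ fi (α-int l))) (λ fl → ¬f (F-*ˡ (α-int i) fl))
        (approx (α-int i) m) (approx (α-int l) m) (approx (f-int v₀) m) (approx c-int m)
      where
      -- Zero at i and l leaves these two coordinates free; elsewhere a residue outside the bad set
      -- is taken.
      r₀ : Fin n → ℤ
      r₀ j with i ≟ j | l ≟ j
      ... | no _ | no _ = proj₁ (avoid j)
      ... | _    | _    = + 0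
      v₀ = proj₁ (crt m r₀)
      contra : ¬ F 1 (α i) → ¬ F 1 (α l) → Σ[ a ∈ ℤ ] F m (α i - fromℤ a) → Σ[ b ∈ ℤ ] F m (α l - fromℤ b) →
        Σ[ t ∈ ℤ ] F m (f v₀ - fromℤ t) → Σ[ s ∈ ℤ ] F m (c - fromℤ s) → ⊥
      contra ¬fi ¬fl (a , fa) (b , fb) (t , ft) (s , fs) = inverse (bezout-^ p-prime b p∤b m)
        where
        p∤a = p∤approx ¬fi fa
        p∤b = p∤approx ¬fl fb
        inverse : Σ[ u ∈ ℤ ] Σ[ v ∈ ℤ ] u ℤ.* b ℤ.+ v ℤ.* (+ p) ℤ.^ m ≡ + 1 → ⊥
        -- The condition is t + z a + z′ b ≡ s. As u is inverse to b modulo pᵐ, it is solved by z′ =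
        -- -u a z + u (s - t), and p ∤ u a makes this a bijection on residues.
        inverse (u , v , ub≡1) = select (avoid₂ i≢l (ℤ.- (u ℤ.* a)) (u ℤ.* (s ℤ.- t)) p∤-ua)
          where
          p∤-ua : ¬ + p ∣ ℤ.- (u ℤ.* a)
          p∤-ua d = ∤-* p-prime p∤u p∤a (≡.subst (+ p ∣_) (ℤ.neg-involutive (u ℤ.* a)) (ℤ∣.∣m⇒∣-m d))
            where
            p∤u : ¬ + p ∣ u
            p∤u d = ∤1 p-prime (≡.subst (+ p ∣_) ub≡1 (ℤ∣.∣m∣n⇒∣m+n (ℤ∣.∣m⇒∣m*n b d)
              (ℤ∣.∣n⇒∣m*n v (ℤ∣.∣m⇒∣m*n ((+ p) ℤ.^ k) ℤ∣.∣-refl))))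
          select : Σ[ z ∈ ℤ ] ¬ Bad i z × ¬ Bad l (ℤ.- (u ℤ.* a) ℤ.* z ℤ.+ u ℤ.* (s ℤ.- t)) → ⊥
          select (z , ¬z , ¬z′) = escape x r close good f-close
            where
            z′ = ℤ.- (u ℤ.* a) ℤ.* z ℤ.+ u ℤ.* (s ℤ.- t)
            x = v₀ O.+ (O.fromℤ z O.* e i O.+ O.fromℤ z′ O.* e l)
            r : Fin n → ℤ
            r j with i ≟ j | l ≟ j
            ... | yes _ | _     = z
            ... | no _  | yes _ = z′
            ... | no _  | no _  = proj₁ (avoid j)
            good : ∀ j → ¬ Bad j (r j)
            good j with i ≟ j | l ≟ j
            ... | yes ≡.refl | _          = ¬z
            ... | no _       | yes ≡.refl = ¬z′
            ... | no _       | no _       = proj₂ (avoid j)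
            r-split : ∀ j → fromℤ (r₀ j) + (fromℤ z * δ Q i j + fromℤ z′ * δ Q l j) ≈ fromℤ (r j)
            r-split j with i ≟ j | l ≟ j
            ... | yes ≡.refl | yes ≡.refl = contradiction ≡.refl i≢l
            ... | yes ≡.refl | no _       = trans (+-congˡ (+-cong (*-identityʳ _) (zeroʳ _))) (trans (+-identityˡ _) (+-identityʳ _))
            ... | no _       | yes ≡.refl = trans (+-congˡ (+-cong (zeroʳ _) (*-identityʳ _))) (trans (+-identityˡ _) (+-identityˡ _))
            ... | no _       | no _       = trans (+-congˡ (trans (+-cong (zeroʳ _) (zeroʳ _)) (+-identityˡ 0#))) (+-identityʳ _)
            close : ∀ j → F m (φ j x - fromℤ (r j))
            close j = F-resp (begin
              (φ j v₀ - fromℤ (r₀ j)) + (fromℤ z * (φ j (e i) - δ Q i j) + fromℤ z′ * (φ j (e l) - δ Q l j))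
                ≈⟨ solve 8 (λ v r z x d z′ x′ d′ → (v :- r) :+ (z :* (x :- d) :+ z′ :* (x′ :- d′)) :=
                     (v :+ (z :* x :+ z′ :* x′)) :- (r :+ (z :* d :+ z′ :* d′))) refl
                     (φ j v₀) (fromℤ (r₀ j)) (fromℤ z) (φ j (e i)) (δ Q i j) (fromℤ z′) (φ j (e l)) (δ Q l j) ⟩
              (φ j v₀ + (fromℤ z * φ j (e i) + fromℤ z′ * φ j (e l))) - (fromℤ (r₀ j) + (fromℤ z * δ Q i j + fromℤ z′ * δ Q l j))
                ≈⟨ +-cong (sym (trans (φ.+-homo j v₀ _) (+-congˡ (trans (φ.+-homo j _ _) (+-cong (φ-fromℤ-* j z (e i)) (φ-fromℤ-* j z′ (e l)))))))
                     (-‿cong (r-split j)) ⟩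
              φ j x - fromℤ (r j) ∎)
              (F-+ (proj₂ (crt m r₀) j) (F-+ (F-*ˡ (F-ℤ z) (proj₂ (idem m i) j)) (F-*ˡ (F-ℤ z′) (proj₂ (idem m l) j))))
            f-close : F m (f x - c)
            f-close = F-resp (begin
              (f v₀ - fromℤ t) + (fromℤ z * (α i - fromℤ a) + fromℤ z′ * (α l - fromℤ b)) - (c - fromℤ s) - fromℤ ((v ℤ.* (+ p) ℤ.^ m) ℤ.* w)
                ≈⟨ +-congˡ (-‿cong (trans (fromℤ-≡ (target (v ℤ.* (+ p) ℤ.^ m) u b a z s t ub≡1))
                     (trans (fromℤ-+ (s ℤ.- t) (ℤ.- (z ℤ.* a ℤ.+ z′ ℤ.* b))) (+-cong (trans (fromℤ-+ s (ℤ.- t)) (+-congˡ (fromℤ-neg t)))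
                       (trans (fromℤ-neg (z ℤ.* a ℤ.+ z′ ℤ.* b)) (-‿cong (trans (fromℤ-+ (z ℤ.* a) (z′ ℤ.* b)) (+-cong (fromℤ-* z a) (fromℤ-* z′ b))))))))) ⟩
              (f v₀ - fromℤ t) + (fromℤ z * (α i - fromℤ a) + fromℤ z′ * (α l - fromℤ b)) - (c - fromℤ s)
                - ((fromℤ s - fromℤ t) - (fromℤ z * fromℤ a + fromℤ z′ * fromℤ b))
                ≈⟨ solve 10 (λ v t z α a z′ β b c s → (v :- t) :+ (z :* (α :- a) :+ z′ :* (β :- b)) :- (c :- s) :- ((s :- t) :- (z :* a :+ z′ :* b)) :=
                     (v :+ (z :* α :+ z′ :* β)) :- c) refl
                     (f v₀) (fromℤ t) (fromℤ z) (α i) (fromℤ a) (fromℤ z′) (α l) (fromℤ b) c (fromℤ s) ⟩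
              (f v₀ + (fromℤ z * α i + fromℤ z′ * α l)) - c
                ≈⟨ +-congʳ (trans (f-+ v₀ _) (+-congˡ (trans (f-+ _ _) (+-cong (trans (f-fromℤ z (e i)) (*-congˡ (α≡ i)))
                     (trans (f-fromℤ z′ (e l)) (*-congˡ (α≡ l))))))) ⟨
              f x - c ∎)
              (F-minus (F-minus (F-+ ft (F-+ (F-*ˡ (F-ℤ z) fa) (F-*ˡ (F-ℤ z′) fb))) fs)
                (∣⇒F (ℤ∣.∣m⇒∣m*n w (ℤ∣.∣n⇒∣m*n v ℤ∣.∣-refl))))
              where
              -- Since u b = 1 - v pᵐ, the choice of z′ solves the condition up to the error v pᵐ w.
              w = (s ℤ.- t) ℤ.- z ℤ.* a
              fromℤ-≡ : ∀ {x y} → x ≡ y → fromℤ x ≈ fromℤ y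
              fromℤ-≡ e = reflexive (≡.cong fromℤ e)
              target : ∀ q u b a z s t → u ℤ.* b ℤ.+ q ≡ + 1 → q ℤ.* ((s ℤ.- t) ℤ.- z ℤ.* a) ≡
                (s ℤ.- t) ℤ.- (z ℤ.* a ℤ.+ (ℤ.- (u ℤ.* a) ℤ.* z ℤ.+ u ℤ.* (s ℤ.- t)) ℤ.* b)
              target q u b a z s t e = ≡.trans
                (ℤS.solve 7 (λ q u b a z s t → q ℤS.:* ((s ℤS.:- t) ℤS.:- z ℤS.:* a) ℤS.:=
                  (u ℤS.:* b ℤS.:+ q) ℤS.:* ((s ℤS.:- t) ℤS.:- z ℤS.:* a) ℤS.:- (u ℤS.:* b) ℤS.:* ((s ℤS.:- t) ℤS.:- z ℤS.:* a)) ≡.refl q u b a z s t)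
                (≡.trans (≡.cong (λ o → o ℤ.* ((s ℤ.- t) ℤ.- z ℤ.* a) ℤ.- (u ℤ.* b) ℤ.* ((s ℤ.- t) ℤ.- z ℤ.* a)) e)
                  (ℤS.solve 6 (λ u b a z s t → ℤS.con (+ 1) ℤS.:* ((s ℤS.:- t) ℤS.:- z ℤS.:* a) ℤS.:- (u ℤS.:* b) ℤS.:* ((s ℤS.:- t) ℤS.:- z ℤS.:* a) ℤS.:=
                    (s ℤS.:- t) ℤS.:- (z ℤS.:* a ℤS.:+ ((ℤS.:- (u ℤS.:* a)) ℤS.:* z ℤS.:+ u ℤS.:* (s ℤS.:- t)) ℤS.:* b)) ≡.refl u b a z s t))
                where module ℤS = ℤSolver.+-*-Solver

    private
      F-sum-* : ∀ {j} (u v : Vector Carrier j) x y → (∀ i → F 1 (u i * x - v i * y)) → F 1 (sum u * x - sum v * y)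
      F-sum-* {zero}  u v x y f = F-resp (solve 2 (λ x y → con (+ 0) := con (+ 0) :* x :- con (+ 0) :* y) refl x y) F-0
      F-sum-* {suc j} u v x y f = F-resp
        (solve 6 (λ u v s t x y → (u :* x :- v :* y) :+ (s :* x :- t :* y) := (u :+ s) :* x :- (v :+ t) :* y) refl
          (u zero) (v zero) (sum (u ∘ suc)) (sum (v ∘ suc)) x y)
        (F-+ (f zero) (F-sum-* (u ∘ suc) (v ∘ suc) x y (f ∘ suc)))

      F-*-cong : ∀ {j x x′ y y′} → F 0 x → F 0 y′ → F j (x - x′) → F j (y - y′) → F j (x * y - x′ * y′)
      F-*-cong {x = x} {x′} {y} {y′} fx fy′ f g = F-resp
        (solve 4 (λ x x′ y y′ → x :* (y :- y′) :+ (x :- x′) :* y′ := x :* y :- x′ :* y′) refl x x′ y y′)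
        (F-+ (F-*ˡ fx g) (F-*ʳ f fy′))

      -- The difference is the double sum of αᵢ αₗ rᵢ (tₗ - tᵢ): the diagonal terms vanish and the
      -- others are divisible by p by `orthogonal`.
      F-diagonal : ∀ (r t : Fin n → ℤ) →
        F 1 (sum (λ i → fromℤ (r i) * α i) * sum (λ i → fromℤ (t i) * α i)
           - sum (λ i → fromℤ (r i ℤ.* t i) * α i) * sum (λ i → fromℤ (+ 1) * α i))
      F-diagonal r t = F-sum-* (λ i → fromℤ (r i) * α i) (λ i → fromℤ (r i ℤ.* t i) * α i) _ _ λ i → F-resp (+-cong (*-comm _ _) (-‿cong (*-comm _ _)))
        (F-sum-* (λ l → fromℤ (t l) * α l) (λ l → fromℤ (+ 1) * α l) _ _ λ l → F-resp
          (trans (solve 5 (λ a b r t u → (a :* b) :* (r :* (t :- u)) := (t :* b) :* (r :* a) :- (con (+ 1) :* b) :* ((r :* u) :* a)) refl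
              (α i) (α l) (fromℤ (r i)) (fromℤ (t l)) (fromℤ (t i)))
            (+-congˡ (-‿cong (*-cong refl (*-congʳ (sym (fromℤ-* (r i) (t i))))))))
          (term i l (i ≟ l)))
        where
        term : ∀ i l → Dec (i ≡ l) → F 1 ((α i * α l) * (fromℤ (r i) * (fromℤ (t l) - fromℤ (t i))))
        term i l (yes ≡.refl) = F-resp (sym (trans (*-congˡ (trans (*-congˡ (-‿inverseʳ _)) (zeroʳ _))) (zeroʳ _))) F-0
        term i l (no  i≢l)    = F-*ʳ (orthogonal i≢l) (F-*ˡ (F-ℤ (r i)) (F-minus (F-ℤ (t l)) (F-ℤ (t i))))

    -- Modulo p at most one αᵢ survives, so f is a multiple of one φᵢ.
    multiplicative : ∀ x y → F 1 (f x * f y - f (x O.* y) * f O.1#)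
    multiplicative x y = F-resp (solve 4 (λ a b c d → (a :- b) :+ (b :- c) :- (d :- c) := a :- d) refl
        (f x * f y) (s r * s t) (s (λ i → r i ℤ.* t i) * s (λ _ → + 1)) (f (x O.* y) * f O.1#))
      (F-minus (F-+ (F-*-cong (f-int x) (s-int t) (expand x r (λ l → proj₂ (r′ l))) (expand y t (λ l → proj₂ (t′ l)))) (F-diagonal r t))
        (F-*-cong (f-int _) (s-int (λ _ → + 1))
          (expand (x O.* y) (λ i → r i ℤ.* t i) (λ l → F-resp (+-cong (sym (φ.*-homo l x y)) (-‿cong (sym (fromℤ-* (r l) (t l)))))
            (F-*-cong {y = φ l y} (φ-int l x) (F-ℤ (t l)) (proj₂ (r′ l)) (proj₂ (t′ l)))))
          (expand O.1# (λ _ → + 1) (λ l → F-resp (sym (trans (+-cong (φ.1#-homo l) (-‿cong fromℤ-1)) (-‿inverseʳ 1#))) F-0))))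
      where
      r′ : ∀ l → Σ[ r ∈ ℤ ] F m (φ l x - fromℤ r)
      r′ l = approx (φ-int l x) m
      t′ : ∀ l → Σ[ t ∈ ℤ ] F m (φ l y - fromℤ t)
      t′ l = approx (φ-int l y) m
      r t : Fin n → ℤ
      r l = proj₁ (r′ l)
      t l = proj₁ (t′ l)
      s : (Fin n → ℤ) → Carrier
      s r = sum (λ i → fromℤ (r i) * α i)
      s-int : ∀ r → F 0 (s r)
      s-int r = F-sum _ (λ i → F-*ˡ (F-ℤ (r i)) (α-int i))
      expand : ∀ x r → (∀ l → F m (φ l x - fromℤ (r l))) → F 1 (f x - s r)
      expand x r close = F-≤ {1} {m} (s≤s z≤n) (f-expansion x r close)

-- Residues outside two sets of total measure less than 1

module _ {A : Set} {F G : Pred A 0ℓ} (F? : ∀ x → Dec (F x)) (G? : ∀ x → Dec (G x)) where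

  length-cover : ∀ xs → (∀ x → F x ⊎ G x) → length xs ℕ.≤ length (filter F? xs) ℕ.+ length (filter G? xs)
  length-cover []       c = z≤n
  length-cover (x ∷ xs) c with F? x | G? x | length-cover xs c
  ... | yes _ | yes _ | l = s≤s (ℕ.≤-trans l (ℕ.+-monoʳ-≤ (length (filter F? xs)) (ℕ.n≤1+n _)))
  ... | yes _ | no _  | l = s≤s l
  ... | no _  | yes _ | l = ℕ.≤-trans (s≤s l) (ℕ.≤-reflexive (≡.sym (ℕ.+-suc (length (filter F? xs)) _)))
  ... | no ¬f | no ¬g | l with c x
  ...   | inj₁ f = contradiction f ¬f
  ...   | inj₂ g = contradiction g ¬g

uncovered : ∀ {n} {F G : Pred (Fin n) 0ℓ} (F? : ∀ x → Dec (F x)) (G? : ∀ x → Dec (G x)) →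
  length (filter F? (allFin n)) ℕ.+ length (filter G? (allFin n)) < n → Σ[ z ∈ Fin n ] ¬ F z × ¬ G z
uncovered {n} F? G? small with any? (λ z → ¬? (F? z) ×-dec ¬? (G? z))
... | yes found = found
... | no none = contradiction (ℕ.≤-trans (ℕ.≤-reflexive (≡.sym (length-tabulate {n = n} (λ (z : Fin n) → z))))
  (length-cover F? G? (allFin n) cover)) (ℕ.<⇒≱ small)
  where
  cover : ∀ z → _
  cover z with F? z | G? z
  ... | yes f | _     = inj₁ f
  ... | no _  | yes g = inj₂ g
  ... | no ¬f | no ¬g = contradiction (z , ¬f , ¬g) none

counts<total : ∀ {P c d q r} → 0 < P → c ·ℚ ℚ.1ℚ ℚ.≤ P ·ℚ q → d ·ℚ ℚ.1ℚ ℚ.≤ P ·ℚ r → q ℚ.+ r ℚ.< ℚ.1ℚ → c ℕ.+ d < P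
counts<total {P@(suc P′)} {c} {d} {q} {r} _ c≤ d≤ q+r<1 = ℕ.≰⇒> λ P≤ → ℚ.<-irrefl ≡.refl (ℚ.<-≤-trans
  (ℚ.≤-<-trans (ℚ.≤-trans (ℚ.≤-reflexive (×-homo-+ ℚ.1ℚ c d)) (ℚ.≤-trans (ℚ.+-mono-≤ c≤ d≤) (ℚ.≤-reflexive (≡.sym (×-distrib-+ q r P)))))
    (·ℚ-mono-< P′ q+r<1))
  (mono P≤))
  where
  mono : ∀ {m n} → m ℕ.≤ n → m ·ℚ ℚ.1ℚ ℚ.≤ n ·ℚ ℚ.1ℚ
  mono {n = n} z≤n = ·ℚ-nonNegative n 0≤1
    where
    0≤1 : ℚ.0ℚ ℚ.≤ ℚ.1ℚ
    0≤1 = ℚ.nonNegative⁻¹ ℚ.1ℚ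
  mono (s≤s m≤n) = ℚ.+-mono-≤ (ℚ.≤-refl {ℚ.1ℚ}) (mono m≤n)

uncovered-by-measure : ∀ {n} → 0 < n → {F G : Pred (Fin n) 0ℓ} (F? : ∀ x → Dec (F x)) (G? : ∀ x → Dec (G x)) (q r : ℚ) →
  length (filter F? (allFin n)) ·ℚ ℚ.1ℚ ℚ.≤ n ·ℚ q → length (filter G? (allFin n)) ·ℚ ℚ.1ℚ ℚ.≤ n ·ℚ r →
  q ℚ.+ r ℚ.< ℚ.1ℚ → Σ[ z ∈ Fin n ] ¬ F z × ¬ G z
uncovered-by-measure {n} n>0 F? G? q r F≤ G≤ q+r<1 = uncovered F? G?
  (counts<total {n} {length (filter F? (allFin n))} {length (filter G? (allFin n))} {q} {r} n>0 F≤ G≤ q+r<1)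

module _ where
  open Algebra.Definitions.RawMonoid ℚ.+-0-rawMonoid using () renaming (sum to sumℚ)

  sum-nonNegative : ∀ {n} (v : Vector ℚ n) → (∀ i → ℚ.0ℚ ℚ.≤ v i) → ℚ.0ℚ ℚ.≤ sumℚ v
  sum-nonNegative {zero}  v 0≤v = ℚ.≤-refl
  sum-nonNegative {suc n} v 0≤v = ℚ.+-mono-≤ (0≤v zero) (sum-nonNegative (v ∘ suc) (0≤v ∘ suc))

  term≤sum : ∀ {n} (v : Vector ℚ n) → (∀ i → ℚ.0ℚ ℚ.≤ v i) → ∀ i → v i ℚ.≤ sumℚ v
  term≤sum v 0≤v zero = ℚ.≤-trans (ℚ.≤-reflexive (≡.sym (ℚ.+-identityʳ (v zero))))
    (ℚ.+-mono-≤ (ℚ.≤-refl {v zero}) (sum-nonNegative (v ∘ suc) (0≤v ∘ suc)))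
  term≤sum v 0≤v (suc i) = ℚ.≤-trans (ℚ.≤-reflexive (≡.sym (ℚ.+-identityˡ (v (suc i)))))
    (ℚ.+-mono-≤ (0≤v zero) (term≤sum (v ∘ suc) (0≤v ∘ suc) i))

  terms≤sum : ∀ {n} (v : Vector ℚ n) → (∀ i → ℚ.0ℚ ℚ.≤ v i) → ∀ {i j} → i ≢ j → v i ℚ.+ v j ℚ.≤ sumℚ v
  terms≤sum v 0≤v {zero}  {zero}  i≢j = contradiction ≡.refl i≢j
  terms≤sum v 0≤v {zero}  {suc j} i≢j = ℚ.+-mono-≤ (ℚ.≤-refl {v zero}) (term≤sum (v ∘ suc) (0≤v ∘ suc) j)
  terms≤sum v 0≤v {suc i} {zero}  i≢j = ℚ.≤-trans (ℚ.≤-reflexive (ℚ.+-comm (v (suc i)) (v zero)))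
    (ℚ.+-mono-≤ (ℚ.≤-refl {v zero}) (term≤sum (v ∘ suc) (0≤v ∘ suc) i))
  terms≤sum v 0≤v {suc i} {suc j} i≢j = ℚ.≤-trans (ℚ.≤-reflexive (≡.sym (ℚ.+-identityˡ (v (suc i) ℚ.+ v (suc j)))))
    (ℚ.+-mono-≤ (0≤v zero) (terms≤sum (v ∘ suc) (0≤v ∘ suc) (i≢j ∘ ≡.cong suc)))

module SievingByMeasure {p : ℕ} (p-prime : Prime p) {Q : Ring₀} (V : Valued p Q) {O : Ring₀} (S : Splitting V O)
  (I : Fin (Splitting.n S) → Ideal O)
  (I⊆ : ∀ i {x} → Ideal.member (I i) x → Valued.F V 1 (Splitting.φ S i x))
  (⊆I : ∀ i {x} → Valued.F V 1 (Splitting.φ S i x) → Ideal.member (I i) x)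
  (U : ∀ i → CompactOpen (I i)) (μ : ∀ i → HaarMeasure (I i))
  (small : ∀ i → HaarMeasure.meas (μ i) (U i) ℚ.< ℚ.1ℚ)
  (small₂ : ∀ {i l} → i ≢ l → HaarMeasure.meas (μ i) (U i) ℚ.+ HaarMeasure.meas (μ l) (U l) ℚ.< ℚ.1ℚ) where
  open SplitPrimes p-prime V S
  open ValuedOps p-prime V
  open CompactOpen using (set)
  private
    module O = RingOps O
    module φ i = Hom {O} {Q} (φ-hom i)
    module 𝔭 i = Powers i (I i) (I⊆ i) (⊆I i)
    module T i = AdicTopology (I i)

  Meets : Fin n → Pred O.Carrier 0ℓ
  Meets i x = set (U i) (toCompletion (I i) x)

  private
    Bad : Fin n → Pred ℤ 0ℓ
    Bad i r = Meets i (O.fromℤ r)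

  module AtLevel (N : ℕ) (uniform-N : ∀ i → T.Uniform i N (set (U i))) (U? : ∀ i x → Dec (set (U i) x)) where
    private
      p>0 : 0 < p ℕ.^ N
      p>0 = ℕ.m^n>0 p {{ℕ.nonTrivial⇒nonZero p {{prime⇒nonTrivial p-prime}}}} N

      count : ∀ i a b → ¬ + p ∣ a →
        length (filter (λ z → U? i (toCompletion (I i) (O.fromℤ (a ℤ.* + toℕ z ℤ.+ b)))) (allFin (p ℕ.^ N))) ·ℚ ℚ.1ℚ
          ℚ.≤ (p ℕ.^ N) ·ℚ HaarMeasure.meas (μ i) (U i)
      count i a b p∤a = 𝔭.cell-count i N a b p∤a (μ i) (U i) (uniform-N i) (U? i)

      avoid : ∀ i → Σ[ r ∈ ℤ ] ¬ Bad i r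
      -- A single set is treated as a pair whose second member is empty and has measure 0.
      avoid i = go (uncovered-by-measure p>0 (λ z → U? i (toCompletion (I i) (O.fromℤ (+ 1 ℤ.* + toℕ z ℤ.+ + 0)))) (λ _ → no (λ ()))
          (HaarMeasure.meas (μ i) (U i)) ℚ.0ℚ (count i (+ 1) (+ 0) (∤1 p-prime))
          (≡.subst (λ l → length l ·ℚ ℚ.1ℚ ℚ.≤ (p ℕ.^ N) ·ℚ ℚ.0ℚ)
            (≡.sym (filter-none {P = λ _ → ⊥} (λ _ → no (λ ())) {allFin (p ℕ.^ N)} (All.tabulate (λ _ ()))))
            (·ℚ-nonNegative (p ℕ.^ N) (ℚ.≤-refl {ℚ.0ℚ})))
          (≡.subst (ℚ._< ℚ.1ℚ) (≡.sym (ℚ.+-identityʳ (HaarMeasure.meas (μ i) (U i)))) (small i)))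
        where
        go : (Σ[ z ∈ Fin (p ℕ.^ N) ] ¬ Bad i (+ 1 ℤ.* + toℕ z ℤ.+ + 0) × ¬ ⊥) → Σ[ r ∈ ℤ ] ¬ Bad i r
        go (z , ¬b , _) = + 1 ℤ.* + toℕ z ℤ.+ + 0 , ¬b

      avoid₂ : ∀ {i l} → i ≢ l → ∀ a b → ¬ + p ∣ a → Σ[ z ∈ ℤ ] ¬ Bad i z × ¬ Bad l (a ℤ.* z ℤ.+ b)
      avoid₂ {i} {l} i≢l a b p∤a = go (uncovered-by-measure p>0 (λ z → U? i (toCompletion (I i) (O.fromℤ (+ 1 ℤ.* + toℕ z ℤ.+ + 0))))
          (λ z → U? l (toCompletion (I l) (O.fromℤ (a ℤ.* + toℕ z ℤ.+ b))))
          (HaarMeasure.meas (μ i) (U i)) (HaarMeasure.meas (μ l) (U l))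
          (count i (+ 1) (+ 0) (∤1 p-prime)) (count l a b p∤a) (small₂ i≢l))
        where
        go : (Σ[ z ∈ Fin (p ℕ.^ N) ] ¬ Bad i (+ 1 ℤ.* + toℕ z ℤ.+ + 0) × ¬ Bad l (a ℤ.* + toℕ z ℤ.+ b)) →
          Σ[ z ∈ ℤ ] ¬ Bad i z × ¬ Bad l (a ℤ.* z ℤ.+ b)
        go (z , ¬b , ¬b′) = + toℕ z , ≡.subst (λ t → ¬ Bad i t) (≡.trans (ℤ.+-identityʳ _) (ℤ.*-identityˡ (+ toℕ z))) ¬b , ¬b′

    module _ {f : ∣R∣ O → ∣R∣ Q} (f-cong : ∀ {x y} → x O.≈ y → f x ≈ f y) (f-+ : ∀ x y → f (x O.+ y) ≈ f x + f y)
      (f-int : ∀ x → F 0 (f x)) {c : Carrier} (c-int : F 0 c)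
      (k : ℕ) (escape : ∀ x → (∀ i → ¬ Meets i x) → ¬ F k (f x - c)) where
      private
        m : ℕ
        -- Level N decides membership in the `U i`, and `escape` applies at level k. `Sieving` works
        -- modulo pᵐ⁺¹, which is divisible by p even for m = 0.
        m = N ℕ.⊔ k

        escape′ : ∀ x (r : Fin n → ℤ) → (∀ l → F (suc m) (φ l x - fromℤ (r l))) → (∀ l → ¬ Bad l (r l)) → ¬ F (suc m) (f x - c)
        escape′ x r close good f-close = escape x
          (λ i bad → good i (uniform-N i (toCompletion (I i) x) (toCompletion (I i) (O.fromℤ (r i)))
            (𝔭.F⇒power i N (F-≤ {N} {suc m} (ℕ.≤-trans (ℕ.m≤m⊔n N k) (ℕ.n≤1+n m)) (F-resp
              (sym (trans (φ.h-minus i x _) (+-congˡ (-‿cong (φ.h-fromℤ i (r i)))))) (close i)))) bad))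
          (F-≤ {k} {suc m} (ℕ.≤-trans (ℕ.m≤n⊔m N k) (ℕ.n≤1+n m)) f-close)

        module Σ′ = Sieving p-prime V S f-cong f-+ f-int m Bad avoid avoid₂ c-int escape′

      level-multiplicative : ∀ x y → F 1 (f x * f y - f (x O.* y) * f O.1#)
      level-multiplicative = Σ′.multiplicative _ (λ _ → refl)

      level-nonvanishing : (∀ j → F j c) → ¬ (∀ x j → F j (f x))
      level-nonvanishing fc f≈0 = Σ′.nonvanishing (fc (suc m)) (λ x → f≈0 x (suc m))

  private
    level : ∀ i → ∃[ N ] T.Uniform i N (set (U i)) × ∀ x → Dec (set (U i) x)
    level i = T.uniform i (𝔭.power? i) (U i)

    uniform-level : ∃[ N ] ∀ i → T.Uniform i N (set (U i))
    uniform-level = max-bound (λ i N → T.Uniform i N (set (U i))) (λ i {c} {e} c≤e u → T.uniform-≤ i {c} {e} {set (U i)} c≤e u)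
      (λ i → proj₁ (level i) , proj₁ (proj₂ (level i)))

    module Lv = AtLevel (proj₁ uniform-level) (proj₂ uniform-level) (λ i → proj₂ (proj₂ (level i)))

  module _ {f : ∣R∣ O → ∣R∣ Q} (f-cong : ∀ {x y} → x O.≈ y → f x ≈ f y) (f-+ : ∀ x y → f (x O.+ y) ≈ f x + f y)
    (f-int : ∀ x → F 0 (f x)) {c : Carrier} (c-int : F 0 c)
    (k : ℕ) (escape : ∀ x → (∀ i → ¬ Meets i x) → ¬ F k (f x - c)) where

    sieved-multiplicative : ∀ x y → F 1 (f x * f y - f (x O.* y) * f O.1#)
    sieved-multiplicative = Lv.level-multiplicative f-cong f-+ f-int c-int k escape

    sieved-nonvanishing : (∀ j → F j c) → ¬ (∀ x j → F j (f x))
    sieved-nonvanishing = Lv.level-nonvanishing f-cong f-+ f-int c-int k escape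

-- A map a with a x · a y = a (x y) · a 1 is a 1 times a ring homomorphism, extended here from O to K = O ⊗ ℚ.
module Extension (O K T : Ring₀) {incl : ∣R∣ O → ∣R∣ K} (incl-hom : IsHom O K incl)
  (incl-injective : ∀ {x y} → CommutativeRing._≈_ K (incl x) (incl y) → CommutativeRing._≈_ O x y)
  (denominator : ∀ x → Σ[ D ∈ ℤ ] Σ[ o ∈ ∣R∣ O ] D ≢ + 0 ×
    CommutativeRing._≈_ K (incl o) (CommutativeRing._*_ K (Integers.fromℤ K D) x))
  (inverse : ∀ D → D ≢ + 0 → Σ[ i ∈ ∣R∣ T ] CommutativeRing._≈_ T (CommutativeRing._*_ T (Integers.fromℤ T D) i) (CommutativeRing.1# T))
  {a : ∣R∣ O → ∣R∣ T} (a-cong : ∀ {x y} → CommutativeRing._≈_ O x y → CommutativeRing._≈_ T (a x) (a y))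
  (a-+ : ∀ x y → CommutativeRing._≈_ T (a (CommutativeRing._+_ O x y)) (CommutativeRing._+_ T (a x) (a y)))
  (a-* : ∀ x y → CommutativeRing._≈_ T (CommutativeRing._*_ T (a x) (a y))
    (CommutativeRing._*_ T (a (CommutativeRing._*_ O x y)) (a (CommutativeRing.1# O))))
  (unit : Σ[ i ∈ ∣R∣ T ] CommutativeRing._≈_ T (CommutativeRing._*_ T (a (CommutativeRing.1# O)) i) (CommutativeRing.1# T)) where
  private
    module O = RingOps O
    module K = RingOps K
    module incl = Hom {O} {K} incl-hom
  open RingOps T
  private
    ε = a O.1#

    a-fromℤ : ∀ z x → a (O.fromℤ z O.* x) ≈ fromℤ z * a x
    a-fromℤ = additive-fromℤ O T a-cong a-+

    incl-fromℤ-* : ∀ z x → incl (O.fromℤ z O.* x) K.≈ K.fromℤ z K.* incl x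
    incl-fromℤ-* z x = K.trans (incl.*-homo (O.fromℤ z) x) (K.*-congʳ (incl.h-fromℤ z))

  extend : ∣R∣ K → Carrier
  extend x = go (denominator x)
    where
    go : Σ[ D ∈ ℤ ] Σ[ o ∈ O.Carrier ] D ≢ + 0 × incl o K.≈ K.fromℤ D K.* x → Carrier
    go (D , o , D≢0 , _) = a o * (proj₁ unit * proj₁ (inverse D D≢0))

  private
    extend-spec : ∀ x → Σ[ D ∈ ℤ ] Σ[ o ∈ O.Carrier ] D ≢ + 0 × incl o K.≈ K.fromℤ D K.* x × fromℤ D * (ε * extend x) ≈ a o
    extend-spec x with denominator x
    ... | D , o , D≢0 , e = D , o , D≢0 , e , (begin
      fromℤ D * (ε * (a o * (proj₁ unit * proj₁ (inverse D D≢0))))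
        ≈⟨ solve 5 (λ d ε a u i → d :* (ε :* (a :* (u :* i))) := a :* ((ε :* u) :* (d :* i))) refl
             (fromℤ D) ε (a o) (proj₁ unit) (proj₁ (inverse D D≢0)) ⟩
      a o * ((ε * proj₁ unit) * (fromℤ D * proj₁ (inverse D D≢0)))
        ≈⟨ *-congˡ (trans (*-cong (proj₂ unit) (proj₂ (inverse D D≢0))) (*-identityˡ 1#)) ⟩
      a o * 1#  ≈⟨ *-identityʳ _ ⟩
      a o       ∎)

  -- Two denominators of x are compared by cross-multiplication. As `extend` uses an arbitrary
  -- choice of denominator, its homomorphism laws are verified through this characterisation.
  extend-unique : ∀ {x t} D o → D ≢ + 0 → incl o K.≈ K.fromℤ D K.* x → fromℤ D * (ε * t) ≈ a o → t ≈ extend x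
  extend-unique {x} {t} D o D≢0 e f = go (extend-spec x)
    where
    go : Σ[ D′ ∈ ℤ ] Σ[ o′ ∈ O.Carrier ] D′ ≢ + 0 × incl o′ K.≈ K.fromℤ D′ K.* x × fromℤ D′ * (ε * extend x) ≈ a o′ → t ≈ extend x
    go (D′ , o′ , D′≢0 , e′ , f′) = unit-cancel unit (unit-cancel (inverse D D≢0) (unit-cancel (inverse D′ D′≢0)
      (trans (trans (*-congˡ f) (sym (a-fromℤ D′ o))) (trans (a-cong D′o≈Do′) (trans (a-fromℤ D o′) (trans (*-congˡ (sym f′))
        (solve 3 (λ d d′ t → d :* (d′ :* t) := d′ :* (d :* t)) refl (fromℤ D) (fromℤ D′) (ε * extend x))))))))
      where
      D′o≈Do′ : O.fromℤ D′ O.* o O.≈ O.fromℤ D O.* o′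
      D′o≈Do′ = incl-injective (K.trans (incl-fromℤ-* D′ o) (K.trans (K.*-congˡ e) (K.trans
        (K.solve 3 (λ d d′ x → d′ K.:* (d K.:* x) K.:= d K.:* (d′ K.:* x)) K.refl (K.fromℤ D) (K.fromℤ D′) x)
        (K.sym (K.trans (incl-fromℤ-* D o′) (K.*-congˡ e′))))))

  extend-incl : ∀ x → ε * extend (incl x) ≈ a x
  extend-incl x = go (extend-spec (incl x))
    where
    go : Σ[ D ∈ ℤ ] Σ[ o ∈ O.Carrier ] D ≢ + 0 × incl o K.≈ K.fromℤ D K.* incl x × fromℤ D * (ε * extend (incl x)) ≈ a o →
      ε * extend (incl x) ≈ a x
    go (D , o , D≢0 , e , f) = unit-cancel (inverse D D≢0) (trans f (trans
      (a-cong (incl-injective (K.trans e (K.sym (incl-fromℤ-* D x))))) (a-fromℤ D x)))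

  extend-hom : IsHom K T extend
  extend-hom = mkHom K T
    (λ {x} {y} x≈y → let D , o , D≢0 , e , f = extend-spec x in extend-unique D o D≢0 (K.trans e (K.*-congˡ x≈y)) f)
    (λ x y → sum′ (extend-spec x) (extend-spec y)) (λ x y → product (extend-spec x) (extend-spec y))
    (sym (extend-unique (+ 1) O.1# (λ ()) (K.trans incl.1#-homo (K.sym (K.trans (K.*-congʳ K.fromℤ-1) (K.*-identityʳ K.1#))))
      (trans (*-congʳ fromℤ-1) (trans (*-identityˡ _) (*-identityʳ ε)))))
    where
    Spec : ∣R∣ K → Set
    Spec x = Σ[ D ∈ ℤ ] Σ[ o ∈ O.Carrier ] D ≢ + 0 × incl o K.≈ K.fromℤ D K.* x × fromℤ D * (ε * extend x) ≈ a o
    sum′ : ∀ {x y} → Spec x → Spec y → extend (x K.+ y) ≈ extend x + extend y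
    sum′ {x} {y} (D , o , D≢0 , e , f) (D′ , o′ , D′≢0 , e′ , f′) = sym (extend-unique (D ℤ.* D′)
      (O.fromℤ D′ O.* o O.+ O.fromℤ D O.* o′) (≢0-* D≢0 D′≢0)
      (K.trans (incl.+-homo _ _) (K.trans (K.+-cong (K.trans (incl-fromℤ-* D′ o) (K.*-congˡ e)) (K.trans (incl-fromℤ-* D o′) (K.*-congˡ e′)))
        (K.trans (K.solve 4 (λ d d′ x y → d′ K.:* (d K.:* x) K.:+ d K.:* (d′ K.:* y) K.:= (d K.:* d′) K.:* (x K.:+ y)) K.refl (K.fromℤ D) (K.fromℤ D′) x y)
          (K.*-congʳ (K.sym (K.fromℤ-* D D′))))))
      (trans (*-congʳ (fromℤ-* D D′)) (trans
        (solve 5 (λ d d′ ε x y → (d :* d′) :* (ε :* (x :+ y)) := d′ :* (d :* (ε :* x)) :+ d :* (d′ :* (ε :* y))) refl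
          (fromℤ D) (fromℤ D′) ε (extend x) (extend y))
        (trans (+-cong (trans (*-congˡ f) (sym (a-fromℤ D′ o))) (trans (*-congˡ f′) (sym (a-fromℤ D o′)))) (sym (a-+ _ _))))))
    product : ∀ {x y} → Spec x → Spec y → extend (x K.* y) ≈ extend x * extend y
    product {x} {y} (D , o , D≢0 , e , f) (D′ , o′ , D′≢0 , e′ , f′) = sym (extend-unique (D ℤ.* D′) (o O.* o′) (≢0-* D≢0 D′≢0)
      (K.trans (incl.*-homo o o′) (K.trans (K.*-cong e e′)
        (K.trans (K.solve 4 (λ d d′ x y → (d K.:* x) K.:* (d′ K.:* y) K.:= (d K.:* d′) K.:* (x K.:* y)) K.refl (K.fromℤ D) (K.fromℤ D′) x y)
          (K.*-congʳ (K.sym (K.fromℤ-* D D′))))))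
      -- After multiplication by ε the left side is the product of D ε `extend x` and D′ ε
      -- `extend y`, that is a o · a o′, and `a-*` applies.
      (unit-cancel unit (trans (*-congˡ (*-congʳ (fromℤ-* D D′))) (trans
        (solve 5 (λ d d′ ε x y → ε :* ((d :* d′) :* (ε :* (x :* y))) := (d :* (ε :* x)) :* (d′ :* (ε :* y))) refl
          (fromℤ D) (fromℤ D′) ε (extend x) (extend y))
        (trans (*-cong f f′) (trans (a-* o o′) (*-comm _ _)))))))

  extension : Σ[ h ∈ (∣R∣ K → Carrier) ] IsHom K T h × (∀ x → a O.1# * h (incl x) ≈ a x)
  extension = extend , extend-hom , extend-incl

-- h preserves integers, and the denominator of q cancels in B.
ring-hom⇒ℚ-hom : (A B : ℚ-ring -Algebra) {h : _-Algebra.Carrier A → _-Algebra.Carrier B} →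
  IsHom (_-Algebra.ring A) (_-Algebra.ring B) h →
  ∀ q → CommutativeRing._≈_ (_-Algebra.ring B) (h (_-Algebra.ι A q)) (_-Algebra.ι B q)
ring-hom⇒ℚ-hom A B {h} h-hom q = go (ℚ.↧ q) (ℚ.↥ q) (λ ()) ≡.refl ≡.refl
  where
  open RingOps (_-Algebra.ring B)
  open Hom {_-Algebra.ring A} {_-Algebra.ring B} h-hom
  go : ∀ d z → d ≢ + 0 → ℚ.↧ q ≡ d → ℚ.↥ q ≡ z → h (_-Algebra.ι A q) ≈ _-Algebra.ι B q
  go d z d≢0 d≡ z≡ = ℚAlgebra.integer-cancel B d d≢0 (trans (h-fromℤ-* d _ (ℚAlgebra.ι-fraction A q d≡ z≡))
    (trans (h-fromℤ z) (sym (ℚAlgebra.ι-fraction B q d≡ z≡))))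

-- The sieve conditions at a single prime number

module _ (R S : Ring₀) {f : ∣R∣ R → ∣R∣ S}
  (f-hom : IsGroupHomomorphism (RawRing.+-rawGroup (CommutativeRing.rawRing R)) (RawRing.+-rawGroup (CommutativeRing.rawRing S)) f)
  (T : Ring₀) {g : ∣R∣ S → ∣R∣ T} (g-hom : IsHom S T g) where
  private
    module T = RingOps T
    module g = Hom {S} {T} g-hom
    open IsGroupHomomorphism f-hom

  composite-cong : ∀ {x y} → CommutativeRing._≈_ R x y → g (f x) T.≈ g (f y)
  composite-cong e = g.⟦⟧-cong (⟦⟧-cong e)

  composite-+ : ∀ x y → g (f (CommutativeRing._+_ R x y)) T.≈ g (f x) T.+ g (f y)
  composite-+ x y = T.trans (g.⟦⟧-cong (homo x y)) (g.+-homo (f x) (f y))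

module AtPrime (K L : EtaleAlgebra) (R : Sieve K) (S : Sieve L)
  (A : EtaleAlgebra.𝒪-Carrier K → EtaleAlgebra.𝒪-Carrier L) (A-linear : IsℤLinear K L A)
  {p : ℕ} (p-prime : Prime p)
  (A-V : ∀ t → V K p R t → V L p S (induced K L A p t))
  (A-meets : ∀ (𝔮 : PrimeOf L) → _∣ᴾ_ L 𝔮 p → ∃[ x ] CompactOpen.set (Sieve.at S 𝔮) (toCompletion (MaximalIdeal.ideal 𝔮) (A x)))
  (measure<1 : MeasureSum<1 K R p) {Q : Ring₀} {𝕍 : Valued p Q}
  (Sᴷ : Splitting 𝕍 (EtaleAlgebra.𝒪 K)) (Sᴸ : Splitting 𝕍 (EtaleAlgebra.𝒪 L)) where
  private
    Oᴷ Oᴸ : Ring₀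
    Oᴷ = EtaleAlgebra.𝒪 K
    Oᴸ = EtaleAlgebra.𝒪 L
    module Oᴷ = RingOps Oᴷ
    module Oᴸ = RingOps Oᴸ

  open Valued 𝕍 using (F)
  open Splitting Sᴸ using () renaming (n to nᴸ; φ to ψ; φ-hom to ψ-hom; φ-int to ψ-int)
  private
    module 𝔎 = SplitPrimes p-prime 𝕍 Sᴷ
    module 𝔏 = SplitPrimes p-prime 𝕍 Sᴸ
    open CompactOpen using (set; isOpen)
    open MaximalIdeal using (ideal)
    open Ideal using (member)

    P : PrimesAbove K p
    P = proj₁ measure<1
    module P = PrimesAbove P
    open HaarMeasure using (meas; nonNegative)

    matching : ∀ i → ∃[ c ] _≐ᴾ_ K (𝔎.prime i) (P.prime c)
    matching i = P.complete (𝔎.prime i) (𝔎.p∈kernel i)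

    σ : Fin 𝔎.n → Fin P.count
    σ i = proj₁ (matching i)

    I : ∀ i → Ideal Oᴷ
    I i = ideal (P.prime (σ i))

    I⊆ : ∀ i {x} → member (I i) x → F 1 (𝔎.φ i x)
    I⊆ i {x} = proj₂ (proj₂ (matching i)) {x}

    ⊆I : ∀ i {x} → F 1 (𝔎.φ i x) → member (I i) x
    ⊆I i {x} = proj₁ (proj₂ (matching i)) {x}

    σ-injective : ∀ {i l} → i ≢ l → σ i ≢ σ l
    σ-injective {i} {l} i≢l σ≡ = i≢l (𝔎.kernel-injective λ {x} x∈l → I⊆ i {x}
      (≡.subst (λ c → member (ideal (P.prime c)) x) (≡.sym σ≡) (⊆I l {x} x∈l)))

    U : ∀ i → CompactOpen (I i)
    U i = Sieve.at R (P.prime (σ i))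

    measures : Vector ℚ P.count
    measures c = meas (proj₁ (proj₂ measure<1) c) (Sieve.at R (P.prime c))

    measures≥0 : ∀ c → ℚ.0ℚ ℚ.≤ measures c
    measures≥0 c = nonNegative (proj₁ (proj₂ measure<1) c) (Sieve.at R (P.prime c))

    module M = SievingByMeasure p-prime 𝕍 Sᴷ I I⊆ ⊆I U (λ i → proj₁ (proj₂ measure<1) (σ i))
      (λ i → ℚ.≤-<-trans (term≤sum measures measures≥0 (σ i)) (proj₂ (proj₂ measure<1)))
      (λ {i} {l} i≢l → ℚ.≤-<-trans (terms≤sum measures measures≥0 (σ-injective i≢l)) (proj₂ (proj₂ measure<1)))

    pure-tensor : EtaleAlgebra.𝒪-Carrier K → 𝒪[_] K p
    pure-tensor x = (x , CommutativeRing.1# ℤ[ p ]) ∷ []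

    -- `localise` takes x ⊗ 1 to x · 1 + 0, with 1 written as the image of the integer 1.
    unit-term : (T : Ring₀) (let open RingOps T) → ∀ x → x ≈ x * fromℤ (+ 1) + 0#
    unit-term T x = sym (trans (+-identityʳ _) (trans (*-congˡ fromℤ-1) (*-identityʳ x)))
      where open RingOps T

    unit-term-minus : (T : Ring₀) (let open RingOps T) → ∀ x y → x - y ≈ (x * fromℤ (+ 1) + 0#) - y
    unit-term-minus T x y = RingOps.+-congʳ T (unit-term T x)

    -- A prime 𝔭 above p contains some kernel, which is maximal, so 𝔭 is the corresponding
    -- enumerated prime and the sieve set at 𝔭 transports to it. Openness absorbs the passage from x
    -- · 1 + 0 to x. The double negation of `kernel⊆maximal` is harmless since `V` asserts a
    -- negation.
    avoids⇒V : ∀ x → (∀ i → ¬ M.Meets i x) → V K p R (pure-tensor x)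
    avoids⇒V x avoids 𝔭 𝔭∣p u = 𝔎.kernel⊆maximal 𝔭 𝔭∣p found
      where
      found : Σ[ i ∈ Fin 𝔎.n ] (∀ {y} → member (𝔎.kernel i) y → member (ideal 𝔭) y) → ⊥
      found (i , kernel⊆𝔭) = avoids i (transport (Sieve.extensional R 𝔭 (P.prime (σ i)) 𝔭≐ (localise K p 𝔭 𝔭∣p (pure-tensor x)) u)
          (λ n → mod-reflexive (I i ^ᴵ n) (unit-term Oᴷ x)))
        where
        𝔭≐ : _≐ᴾ_ K 𝔭 (P.prime (σ i))
        𝔭≐ = (λ {y} y∈𝔭 → ⊆I i {y} (𝔎.kernel-maximal i (ideal 𝔭) (MaximalIdeal.proper 𝔭) (λ {z} → kernel⊆𝔭 {z}) {y} y∈𝔭)) ,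
          (λ {y} y∈I → kernel⊆𝔭 {y} (I⊆ i {y} y∈I))
        transport : ∀ {y} → set (U i) y → (∀ n → member (I i ^ᴵ n) (x Oᴷ.- Adic.residue y n)) → M.Meets i x
        transport {y} u e = proj₂ (isOpen (U i) y u) (toCompletion (I i) x) (e (proj₁ (isOpen (U i) y u)))

    module _ (l : Fin nᴸ) where
      𝔮 : PrimeOf L
      𝔮 = 𝔏.prime l

      open RingOps Q using (_-_)

      Uᴸ : CompactOpen (ideal 𝔮)
      Uᴸ = Sieve.at S 𝔮

      module 𝔮-powers = 𝔏.Powers l (ideal 𝔮) id id

      x₀ : EtaleAlgebra.𝒪-Carrier K
      x₀ = proj₁ (A-meets 𝔮 (𝔏.p∈kernel l))

      near : ∃[ k ] (∀ y → member (ideal 𝔮 ^ᴵ k) (Adic.residue y k Oᴸ.- A x₀) → set Uᴸ y)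
      near = isOpen Uᴸ (toCompletion (ideal 𝔮) (A x₀)) (proj₂ (A-meets 𝔮 (𝔏.p∈kernel l)))

      -- Condition (a) keeps A x out of the set of S at 𝔮, whereas a value close to that of A x₀,
      -- the point supplied by (b), would put A x into a ball around A x₀ inside that set.
      escape : ∀ x → (∀ i → ¬ M.Meets i x) → ¬ F (proj₁ near) (ψ l (A x) - ψ l (A x₀))
      escape x avoids close = A-V (pure-tensor x) (avoids⇒V x avoids) 𝔮 (𝔏.p∈kernel l)
        (proj₂ near (localise L p 𝔮 (𝔏.p∈kernel l) (induced K L A p (pure-tensor x)))
          (Ideal.resp (ideal 𝔮 ^ᴵ proj₁ near) (unit-term-minus Oᴸ (A x) (A x₀))
            (𝔮-powers.F⇒power (proj₁ near) {A x Oᴸ.- A x₀}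
              (Valued.F-resp 𝕍 {proj₁ near} (CommutativeRing.sym Q (Hom.h-minus {Oᴸ} {Q} (ψ-hom l) (A x) (A x₀))) close))))

  open RingOps Q using (_-_; _*_)

  sieved-* : ∀ l x y → F 1 (ψ l (A x) * ψ l (A y) - ψ l (A (x Oᴷ.* y)) * ψ l (A Oᴷ.1#))
  sieved-* l = M.sieved-multiplicative (composite-cong Oᴷ Oᴸ A-linear Q (ψ-hom l))
    (composite-+ Oᴷ Oᴸ A-linear Q (ψ-hom l)) (λ x → ψ-int l (A x)) (ψ-int l (A (x₀ l)))
    (proj₁ (near l)) (escape l)

  sieved-≢0 : ∀ l → ¬ (∀ x k → F k (ψ l (A x)))
  sieved-≢0 l vanishes = M.sieved-nonvanishing (composite-cong Oᴷ Oᴸ A-linear Q (ψ-hom l))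
    (composite-+ Oᴷ Oᴸ A-linear Q (ψ-hom l)) (λ x → ψ-int l (A x)) (ψ-int l (A (x₀ l)))
    (proj₁ (near l)) (escape l) (vanishes (x₀ l)) vanishes

-- The theorem

module _ (L : EtaleAlgebra) where
  open EtaleOps L
  private
    Oᴸ : Ring₀
    Oᴸ = EtaleAlgebra.𝒪 L
    module Oᴸ = RingOps Oᴸ

    Nᴿ : ∀ j → Ring₀
    Nᴿ j = NumberField.ring (EtaleAlgebra.factor L j)

    comp-fromℤ-* : ∀ j z x → N._≈_ j (comp j (Oᴸ.fromℤ z Oᴸ.* x)) (N._*_ j (N.fromℤ j z) (comp j x))
    comp-fromℤ-* j z x = N.*-congʳ j (Hom.h-fromℤ {Oᴸ} {Nᴿ j} (comp-hom j) z)

  -- D takes the place of a norm: it depends on z and j alone, and for a split p greater than |D|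
  -- the right side is nonzero modulo some prime above p.
  multiple-of-idem : ∀ j z → ¬ N._≈_ j (comp j z) (N.0# j) →
    Σ[ D ∈ ℤ ] Σ[ v ∈ 𝒪-Carrier ] D ≢ + 0 × Oᴸ._≈_ (z Oᴸ.* v) (Oᴸ.fromℤ D Oᴸ.* OP.idem j)
  multiple-of-idem j z z≢0 = go (N.inverse j (comp j z) z≢0)
    where
    go : ∃[ w ] N._≈_ j (N._*_ j (comp j z) w) (N.1# j) →
      Σ[ D ∈ ℤ ] Σ[ v ∈ 𝒪-Carrier ] D ≢ + 0 × Oᴸ._≈_ (z Oᴸ.* v) (Oᴸ.fromℤ D Oᴸ.* OP.idem j)
    go (w , zw≈1) = scale (N.integral-denominator j w)
      where
      scale : Σ[ D ∈ ℤ ] D ≢ + 0 × Integral (Nᴿ j) (N._*_ j (N.fromℤ j D) w) →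
        Σ[ D ∈ ℤ ] Σ[ v ∈ 𝒪-Carrier ] D ≢ + 0 × Oᴸ._≈_ (z Oᴸ.* v) (Oᴸ.fromℤ D Oᴸ.* OP.idem j)
      scale (D , D≢0 , i) = D , v , D≢0 , zv≈
        where
        v : 𝒪-Carrier
        v = OP.place j (N._*_ j (N.fromℤ j D) w , i)
        zv≈ : Oᴸ._≈_ (z Oᴸ.* v) (Oᴸ.fromℤ D Oᴸ.* OP.idem j)
        zv≈ i′ with j ≟ i′
        ... | yes ≡.refl = N.trans j (N.trans j (N.*-comm j _ _) (N.trans j (N.*-assoc j _ _ _)
          (N.*-congˡ j (N.trans j (N.*-comm j _ _) zw≈1)))) (N.*-congʳ j (N.sym j (Hom.h-fromℤ {Oᴸ} {Nᴿ j} (comp-hom j) D)))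
        ... | no _ = N.trans i′ (N.zeroʳ i′ _) (N.sym i′ (N.zeroʳ i′ _))

  module _ {p : ℕ} (p-prime : Prime p) {Q : Ring₀} (𝕍 : Valued p Q) (S : Splitting 𝕍 Oᴸ) where
    open Splitting S
    open ValuedOps p-prime 𝕍 using (F; F-resp; F-*ʳ; F-minus; F-+; F-unit; F-≤; F-pred; F?; approx; ∣⇒F; F-0)
    private
      module Q = RingOps Q
      module φ i = Hom {Oᴸ} {Q} (φ-hom i)

    -- Otherwise s D eⱼ = p w, whose j-th component s D = p wⱼ with wⱼ integral forces p ∣ s D; but
    -- p ∤ s and 0 < |D| < p.
    idem-not-small : ∀ j D → D ≢ + 0 → ℤ.∣ D ∣ < p → ¬ (∀ l → F 1 (φ l (Oᴸ.fromℤ D Oᴸ.* OP.idem j)))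
    idem-not-small j D D≢0 D<p small = go (div 1 (Oᴸ.fromℤ D Oᴸ.* OP.idem j) small)
      where
      p∤D : ¬ + p ∣ D
      p∤D d = ℕ.<⇒≱ D<p (ℕ∣.∣⇒≤ {{ℕ.≢-nonZero (λ e → D≢0 (ℤ.∣i∣≡0⇒i≡0 e))}} (∣⇒∣ᵤ d))
      go : Σ[ s ∈ ℤ ] Σ[ w ∈ 𝒪-Carrier ] ¬ + p ∣ s ×
        Oᴸ._≈_ (Oᴸ.fromℤ s Oᴸ.* (Oᴸ.fromℤ D Oᴸ.* OP.idem j)) (Oᴸ.fromℤ ((+ p) ℤ.^ 1) Oᴸ.* w) → ⊥
      go (s , w , p∤s , e) = ∤-* p-prime p∤s p∤D (integral-fraction p-prime (Nᴿ j) (N.fromℤ-inj j) (proj₂ (w j))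
        (N.trans j (N.*-congʳ j (N.reflexive j (≡.cong (N.fromℤ j) (≡.sym (ℤ.*-identityʳ (+ p))))))
          (N.trans j (N.sym j (comp-fromℤ-* j ((+ p) ℤ.^ 1) w)) (N.trans j (N.sym j (e j))
            (N.trans j (comp-fromℤ-* j s (Oᴸ.fromℤ D Oᴸ.* OP.idem j)) (N.trans j (N.*-congˡ j
              (N.trans j (comp-fromℤ-* j D (OP.idem j)) (N.trans j (N.*-congˡ j (N.reflexive j (≡.cong proj₁ (OP.place-≡ j _)))) (N.*-identityʳ j _))))
              (N.sym j (N.fromℤ-* j s D))))))))

    divisor-not-small : ∀ j z D v → D ≢ + 0 → ℤ.∣ D ∣ < p → Oᴸ._≈_ (z Oᴸ.* v) (Oᴸ.fromℤ D Oᴸ.* OP.idem j) → ¬ (∀ l → F 1 (φ l z))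
    divisor-not-small j z D v D≢0 D<p zv≈ small = idem-not-small j D D≢0 D<p λ l → F-resp
      (Q.trans (Q.sym (φ.*-homo l z v)) (φ.⟦⟧-cong l {z Oᴸ.* v} {Oᴸ.fromℤ D Oᴸ.* OP.idem j} zv≈))
      (F-*ʳ (small l) (φ-int l v))

    -- Some l belongs to the j-th factor; there φ l only sees the j-th component.
    component-detected : ∀ j → 1 < p → ¬ (∀ l → ¬ (∀ {x : 𝒪-Carrier} → N._≈_ j (comp j x) (N.0# j) → ∀ k → F k (φ l x)))
    component-detected j 1<p none = idem-not-small j (+ 1) (λ ()) 1<p λ l →
      decidable-stable (F? (φ-int l E) 1) λ E∉ → none l λ {x} x≈0 k → F-pred (detect l E∉ (annihilates {x} x≈0) k)
      where
      E : 𝒪-Carrier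
      E = Oᴸ.fromℤ (+ 1) Oᴸ.* OP.idem j
      annihilates : ∀ {x} → N._≈_ j (comp j x) (N.0# j) → Oᴸ._≈_ (E Oᴸ.* x) Oᴸ.0#
      annihilates {x} x≈0 i with j ≟ i
      ... | yes ≡.refl = N.trans j (N.*-congˡ j x≈0) (N.zeroʳ j _)
      ... | no _ = N.trans i (N.*-congʳ i (N.zeroʳ i _)) (N.zeroˡ i _)
      detect : ∀ l → ¬ F 1 (φ l E) → ∀ {x} → Oᴸ._≈_ (E Oᴸ.* x) Oᴸ.0# → ∀ k → F (suc k) (φ l x)
      detect l E∉ {x} Ex≈0 k = go (approx (φ-int l E) (suc k))
        where
        go : Σ[ r ∈ ℤ ] F (suc k) (φ l E Q.- Q.fromℤ r) → F (suc k) (φ l x)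
        go (r , f) = F-unit {r} (λ p∣r → E∉ (F-resp (Q.solve 2 (λ e r → (e Q.:- r) Q.:+ r Q.:= e) Q.refl (φ l E) (Q.fromℤ r))
            (F-+ (F-≤ {1} {suc k} (s≤s z≤n) f) (∣⇒F (∣-^1 p r p∣r)))))
          (F-resp (Q.trans (Q.+-congʳ (Q.sym Eφ≈0)) (Q.solve 3 (λ e r x → e Q.:* x Q.:- (e Q.:- r) Q.:* x Q.:= r Q.:* x) Q.refl (φ l E) (Q.fromℤ r) (φ l x)))
            (F-minus F-0 (F-*ʳ f (φ-int l x))))
          where
          Eφ≈0 : φ l E Q.* φ l x Q.≈ Q.0#
          Eφ≈0 = Q.trans (Q.sym (φ.*-homo l E x)) (Q.trans (φ.⟦⟧-cong l {E Oᴸ.* x} {Oᴸ.0#} Ex≈0) (φ.0#-homo l))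

module _ (K L : EtaleAlgebra) (R : Sieve K) (S : Sieve L)
  (A : EtaleAlgebra.𝒪-Carrier K → EtaleAlgebra.𝒪-Carrier L) (A-linear : IsℤLinear K L A)
  (primes : ∀ (N : ℕ) → ∃[ p ] N < p × Prime p
    × (∀ t → V K p R t → V L p S (induced K L A p t))
    × (∀ (𝔮 : PrimeOf L) → _∣ᴾ_ L 𝔮 p →
        ∃[ x ] CompactOpen.set (Sieve.at S 𝔮) (toCompletion (MaximalIdeal.ideal 𝔮) (A x)))
    × MeasureSum<1 K R p
    × SplitsCompletely p K × SplitsCompletely p L) where
  private
    Oᴷ Oᴸ : Ring₀
    Oᴷ = EtaleAlgebra.𝒪 K
    Oᴸ = EtaleAlgebra.𝒪 L
    module Oᴷ = RingOps Oᴷ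
    module Oᴸ = RingOps Oᴸ
    open EtaleOps L using (module N; comp; comp-hom)

    Nᴿ : ∀ j → Ring₀
    Nᴿ j = NumberField.ring (EtaleAlgebra.factor L j)

    record SievedPrime (p : ℕ) : Set₁ where
      field
        p-prime   : Prime p
        {Q}       : Ring₀
        {𝕍}       : Valued p Q
        primes-L  : Splitting 𝕍 Oᴸ
      open Splitting primes-L public
      open Valued 𝕍 using (F) public
      open CommutativeRing Q using (_-_; _*_)
      field
        sieved-*  : ∀ l x y → F 1 (φ l (A x) * φ l (A y) - φ l (A (x Oᴷ.* y)) * φ l (A Oᴷ.1#))
        sieved-≢0 : ∀ l → ¬ (∀ x k → F k (φ l (A x)))

    sieved : ∀ {p} → Prime p → (∀ t → V K p R t → V L p S (induced K L A p t)) →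
      (∀ (𝔮 : PrimeOf L) → _∣ᴾ_ L 𝔮 p →
        ∃[ x ] CompactOpen.set (Sieve.at S 𝔮) (toCompletion (MaximalIdeal.ideal 𝔮) (A x))) →
      MeasureSum<1 K R p → ∀ {Q} {𝕍 : Valued p Q} → Splitting 𝕍 Oᴷ → Splitting 𝕍 Oᴸ → SievedPrime p
    sieved p-prime a b c Sᴷ Sᴸ = record
      { p-prime   = p-prime
      ; primes-L  = Sᴸ
      ; sieved-*  = P.sieved-*
      ; sieved-≢0 = P.sieved-≢0
      }
      where module P = AtPrime K L R S A A-linear p-prime a b c Sᴷ Sᴸ

    sieved-prime : ∀ N → ∃[ p ] N < p × SievedPrime p
    sieved-prime N = go (primes N)
      where
      go : ∃[ p ] N < p × Prime p
        × (∀ t → V K p R t → V L p S (induced K L A p t))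
        × (∀ (𝔮 : PrimeOf L) → _∣ᴾ_ L 𝔮 p →
            ∃[ x ] CompactOpen.set (Sieve.at S 𝔮) (toCompletion (MaximalIdeal.ideal 𝔮) (A x)))
        × MeasureSum<1 K R p
        × SplitsCompletely p K × SplitsCompletely p L → ∃[ p ] N < p × SievedPrime p
      go (p , N<p , p-prime , a , b , c , dᴷ , dᴸ) = p , N<p ,
        sieved p-prime a b c (𝒪-splitting p-prime K dᴷ) (𝒪-splitting p-prime L dᴸ)

  -- If component j of z were nonzero, `multiple-of-idem` would supply D; at a sieved prime p
  -- greater than |D| all φₗ z are divisible by p, against `divisor-not-small`.
  A-multiplicative : ∀ x y j → N._≈_ j (comp j (A x Oᴸ.* A y)) (comp j (A (x Oᴷ.* y) Oᴸ.* A Oᴷ.1#))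
  A-multiplicative x y j = N.x-y≈0⇒x≈y j (decidable-stable (N.≈0? j (comp j z)) λ z≢0 → go (multiple-of-idem L j z z≢0))
    where
    z = A x Oᴸ.* A y Oᴸ.- A (x Oᴷ.* y) Oᴸ.* A Oᴷ.1#
    go : Σ[ D ∈ ℤ ] Σ[ v ∈ Oᴸ.Carrier ] D ≢ + 0 × Oᴸ._≈_ (z Oᴸ.* v) (Oᴸ.fromℤ D Oᴸ.* EtaleOps.OP.idem L j) → ⊥
    go (D , v , D≢0 , zv≈) = at (sieved-prime ℤ.∣ D ∣)
      where
      at : ∃[ p ] ℤ.∣ D ∣ < p × SievedPrime p → ⊥
      at (p , D<p , P) = divisor-not-small L P.p-prime P.𝕍 P.primes-L j z D v D≢0 D<p zv≈ λ l →
        Valued.F-resp P.𝕍 (Q.sym (Q.trans (Hom.h-minus {Oᴸ} {P.Q} (P.φ-hom l) (A x Oᴸ.* A y) (A (x Oᴷ.* y) Oᴸ.* A Oᴷ.1#))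
          (Q.+-cong (Hom.*-homo {Oᴸ} {P.Q} (P.φ-hom l) (A x) (A y)) (Q.-‿cong (Hom.*-homo {Oᴸ} {P.Q} (P.φ-hom l) (A (x Oᴷ.* y)) (A Oᴷ.1#))))))
          (P.sieved-* l x y)
        where
        module P = SievedPrime P
        module Q = CommutativeRing P.Q

  -- If component j of A 1 is 0, then that of (A x)² = A (x²) · A 1 is 0, so A x vanishes in the
  -- j-th field for every x. An l that only sees this field then contradicts `sieved-≢0`.
  A1≢0 : ∀ j → ¬ N._≈_ j (comp j (A Oᴷ.1#)) (N.0# j)
  A1≢0 j A1≈0 = at (sieved-prime 1)
    where
    A≈0 : ∀ x → N._≈_ j (comp j (A x)) (N.0# j)
    A≈0 x = decidable-stable (N.≈0? j (comp j (A x))) λ Ax≢0 → invertible (N.inverse j (comp j (A x)) Ax≢0)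
      where
      invertible : ∃[ i ] N._≈_ j (N._*_ j (comp j (A x)) i) (N.1# j) → ⊥
      invertible u = N.nontrivial j (N.trans j (N.sym j (proj₂ u)) (N.trans j (N.*-congʳ j
        (N.unit-cancel j u (N.trans j (A-multiplicative x x j) (N.trans j (N.*-congˡ j A1≈0)
          (N.trans j (N.zeroʳ j _) (N.sym j (N.zeroʳ j _))))))) (N.zeroˡ j _)))
    at : ∃[ p ] 1 < p × SievedPrime p → ⊥
    at (p , 1<p , P) = component-detected L P.p-prime P.𝕍 P.primes-L j 1<p λ l kills →
      P.sieved-≢0 l λ x → kills {A x} (A≈0 x)
      where module P = SievedPrime P

  private
    a-cong : ∀ j {x y} → CommutativeRing._≈_ Oᴷ x y → CommutativeRing._≈_ (Nᴿ j) (comp j (A x)) (comp j (A y))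
    a-cong j {x} {y} = composite-cong Oᴷ Oᴸ A-linear (Nᴿ j) (comp-hom j) {x} {y}

    a-* : ∀ j x y → CommutativeRing._≈_ (Nᴿ j) (CommutativeRing._*_ (Nᴿ j) (comp j (A x)) (comp j (A y)))
      (CommutativeRing._*_ (Nᴿ j) (comp j (A (CommutativeRing._*_ Oᴷ x y))) (comp j (A (CommutativeRing.1# Oᴷ))))
    a-* j x y = A-multiplicative x y j

    a-unit : ∀ j → Σ[ i ∈ ∣R∣ (Nᴿ j) ] CommutativeRing._≈_ (Nᴿ j)
      (CommutativeRing._*_ (Nᴿ j) (comp j (A (CommutativeRing.1# Oᴷ))) i) (CommutativeRing.1# (Nᴿ j))
    a-unit j = N.inverse j (comp j (A Oᴷ.1#)) (A1≢0 j)

  -- The division by A 1 takes place in one factor of L at a time, where it is the division by a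
  -- nonzero element of a field.
  component-hom : ∀ j → Σ[ h ∈ (∣R∣ (EtaleAlgebra.ring K) → ∣R∣ (Nᴿ j)) ] IsHom (EtaleAlgebra.ring K) (Nᴿ j) h ×
    (∀ x → CommutativeRing._≈_ (Nᴿ j) (CommutativeRing._*_ (Nᴿ j) (comp j (A (CommutativeRing.1# Oᴷ))) (h (EtaleAlgebra.incl K x))) (comp j (A x)))
  component-hom j = Extension.extension Oᴷ (EtaleAlgebra.ring K) (Nᴿ j) {EtaleAlgebra.incl K} (EtaleOps.incl-hom K)
    (λ e → e) (EtaleOps.denominator K) (N.integer-inverse j) {λ x → comp j (A x)} (λ {x} {y} → a-cong j {x} {y})
    (composite-+ Oᴷ Oᴸ A-linear (Nᴿ j) (comp-hom j)) (a-* j) (a-unit j)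

module _ (K L : EtaleAlgebra) (A : EtaleAlgebra.𝒪-Carrier K → EtaleAlgebra.𝒪-Carrier L) (ε : EtaleAlgebra.𝒪-Carrier L)
  (h : ∀ j → EtaleAlgebra.Carrier K → ∣R∣ (NumberField.ring (EtaleAlgebra.factor L j)))
  (h-hom : ∀ j → IsHom (EtaleAlgebra.ring K) (NumberField.ring (EtaleAlgebra.factor L j)) (h j)) where
  private
    Nᴿ : ∀ j → Ring₀
    Nᴿ j = NumberField.ring (EtaleAlgebra.factor L j)
    module h j = Hom {EtaleAlgebra.ring K} {Nᴿ j} (h-hom j)

    τ : EtaleAlgebra.Carrier K → EtaleAlgebra.Carrier L
    τ k j = h j k

    τ-hom : IsHom (EtaleAlgebra.ring K) (EtaleAlgebra.ring L) τ
    τ-hom = mkHom (EtaleAlgebra.ring K) (EtaleAlgebra.ring L)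
      (λ e j → h.⟦⟧-cong j e) (λ x y j → h.+-homo j x y) (λ x y j → h.*-homo j x y) (λ j → h.1#-homo j)

    τ₀ : EtaleAlgebra.𝒪-Carrier K → EtaleAlgebra.𝒪-Carrier L
    τ₀ x j = h j (EtaleAlgebra.incl K x) , EtaleOps.hom-integral K (Nᴿ j) (h-hom j) x

  assemble : (∀ x → EtaleAlgebra._≈𝒪_ L (A x) (M L ε (τ₀ x))) →
    Σ[ τ ∈ (EtaleAlgebra.Carrier K → EtaleAlgebra.Carrier L) ] IsAlgebraHom (EtaleAlgebra.algebra K) (EtaleAlgebra.algebra L) τ
    × Σ[ τ₀ ∈ (EtaleAlgebra.𝒪-Carrier K → EtaleAlgebra.𝒪-Carrier L) ] IsRestriction K L τ τ₀
    × Σ[ ε ∈ EtaleAlgebra.𝒪-Carrier L ] (∀ x → EtaleAlgebra._≈𝒪_ L (A x) (M L ε (τ₀ x)))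
  assemble factors = τ , (τ-hom , λ q j → ring-hom⇒ℚ-hom (EtaleAlgebra.algebra K) (NumberField.algebra (EtaleAlgebra.factor L j)) (h-hom j) q) ,
    τ₀ , (λ x j → CommutativeRing.refl (Nᴿ j)) , ε , factors

open EtaleAlgebra using (Carrier; 𝒪-Carrier; _≈𝒪_; algebra)

theorem4p1 : (K L : EtaleAlgebra) (R : Sieve K) (S : Sieve L)
    (A : 𝒪-Carrier K → 𝒪-Carrier L) → IsℤLinear K L A →
    (∀ (N : ℕ) → ∃[ p ] N < p × Prime p
    × (∀ t → V K p R t → V L p S (induced K L A p t))
    × (∀ (𝔮 : PrimeOf L) → _∣ᴾ_ L 𝔮 p →
    ∃[ x ] CompactOpen.set (Sieve.at S 𝔮) (toCompletion (MaximalIdeal.ideal 𝔮) (A x)))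
    × MeasureSum<1 K R p
    × SplitsCompletely p K × SplitsCompletely p L) →
    Σ[ τ ∈ (Carrier K → Carrier L) ] IsAlgebraHom (algebra K) (algebra L) τ
    × Σ[ τ₀ ∈ (𝒪-Carrier K → 𝒪-Carrier L) ] IsRestriction K L τ τ₀
    × Σ[ ε ∈ 𝒪-Carrier L ] (∀ x → _≈𝒪_ L (A x) (M L ε (τ₀ x)))
theorem4p1 K L R S A A-linear primes = assemble K L A (A (CommutativeRing.1# (EtaleAlgebra.𝒪 K)))
  (λ j → proj₁ (h j)) (λ j → proj₁ (proj₂ (h j)))
  (λ x j → CommutativeRing.sym (NumberField.ring (EtaleAlgebra.factor L j)) (proj₂ (proj₂ (h j)) x))
  where
  h = component-hom K L R S A A-linear primes
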